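{- \textsc{MD-SPP} restricted to instances with target $T\le 1$ is fixed-parameter tractable when parameterized by the number $|K|$ of commodities.
   Context: For a digraph $D=(V,E)$, $\mathcal{T}(D)$ is its transitive closure (edge $(i,j)$ iff $D$ has a directed $i$-$j$-path); for a directed path $P$, $\mathcal{T}(P)$ is the transitive closure of $P$. \textsc{MD-SPP}: input is a digraph $D$, an integer $T$ (the target), and a set $K$ of routed commodities $(s,t,P)$ with $s,t\in V$ and $P$ a directed $s$-$t$-path in $D$; the question is whether there is a subgraph $H$ of $\mathcal{T}(D)$ of maximum outdegree at most $T$ such that for every $(s,t,P)\in K$ there is a directed $s$-$t$-path in $H\cap\mathcal{T}(P)$. -}

module Defs where

open import Data.Nat using (ℕ; zero; suc; _+_; _*_; _^_; _≤_)
open import Data.Bool using (Bool; true; false)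
open import Data.Fin using (Fin; toℕ) renaming (zero to fzero; suc to fsuc)
open import Data.Fin.Subset using (Subset; ∣_∣) renaming (_∈_ to _∈ₛ_)
open import Data.List using (List; []; _∷_; [_]; _++_; length; replicate; concatMap)
open import Data.List.Membership.Propositional using () renaming (_∈_ to _∈ₗ_)
open import Data.List.Relation.Unary.Unique.Propositional using (Unique)
open import Data.Product using (Σ; _×_; _,_)
open import Data.Sum using (_⊎_)
open import Data.Maybe using (Maybe; just; nothing)
open import Relation.Nullary using (¬_)
open import Relation.Binary.PropositionalEquality using (_≡_; _≢_)
open import Relation.Binary.Construct.Closure.ReflexiveTransitive using (Star)

EdgeList : ℕ → Set
EdgeList n = List (Fin n × Fin n)

EdgeOf : ∀ {n} → EdgeList n → Fin n → Fin n → Set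
EdgeOf E i j = (i , j) ∈ₗ E

data Walk {n : ℕ} (E : EdgeList n) : Fin n → Fin n → List (Fin n) → Set where
  single : ∀ {s} → Walk E s s [ s ]
  cons   : ∀ {u v t vs} → EdgeOf E u v → Walk E v t (v ∷ vs) → Walk E u t (u ∷ v ∷ vs)

IsDPath : ∀ {n} → EdgeList n → Fin n → Fin n → List (Fin n) → Set
IsDPath E s t P = Walk E s t P × Unique P

Reach : ∀ {n} → EdgeList n → Fin n → Fin n → Set
Reach E = Star (EdgeOf E)

ClosureEdge : ∀ {n} → EdgeList n → Fin n → Fin n → Set
ClosureEdge E i j = i ≢ j × Reach E i j

data PathClosureEdge {n : ℕ} : List (Fin n) → Fin n → Fin n → Set where
  here  : ∀ {x xs v} → v ∈ₗ xs → PathClosureEdge (x ∷ xs) x v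
  there : ∀ {x xs u v} → PathClosureEdge xs u v → PathClosureEdge (x ∷ xs) u v

Commodity : ℕ → Set
Commodity n = Fin n × Fin n × List (Fin n)

record Instance : Set where
  field
    n : ℕ
    E : EdgeList n
    T : ℕ
    K : List (Commodity n)

ValidInstance : Instance → Set
ValidInstance I = ∀ {s t P} → (s , t , P) ∈ₗ K → IsDPath E s t P
  where open Instance I

-- A subgraph H on vertex set Fin n: H i is the out-neighbourhood of i.
Graph : ℕ → Set
Graph n = Fin n → Subset n

HEdge : ∀ {n} → Graph n → Fin n → Fin n → Set
HEdge H i j = j ∈ₛ H i

outdeg : ∀ {n} → Graph n → Fin n → ℕ
outdeg H i = ∣ H i ∣

HPEdge : ∀ {n} → Graph n → List (Fin n) → Fin n → Fin n → Set
HPEdge H P u v = HEdge H u v × PathClosureEdge P u v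

IsSolution : (I : Instance) → Graph (Instance.n I) → Set
IsSolution I H =
    (∀ i j → HEdge H i j → ClosureEdge E i j)
  × (∀ i → outdeg H i ≤ T)
  × (∀ {s t P} → (s , t , P) ∈ₗ K → Star (HPEdge H P) s t)
  where open Instance I

MDSPP : Instance → Set
MDSPP I = Σ (Graph (Instance.n I)) (IsSolution I)

unary : ℕ → List Bool
unary k = replicate k true ++ [ false ]

encList : ∀ {A : Set} → (A → List Bool) → List A → List Bool
encList f xs = unary (length xs) ++ concatMap f xs

encVertex : ∀ {n} → Fin n → List Bool
encVertex v = unary (toℕ v)

encEdge : ∀ {n} → Fin n × Fin n → List Bool
encEdge (u , v) = encVertex u ++ encVertex v

encCommodity : ∀ {n} → Commodity n → List Bool
encCommodity (s , t , P) = encVertex s ++ encVertex t ++ encList encVertex P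

encode : Instance → List Bool
encode I = unary n ++ unary T ++ encList encEdge E ++ encList encCommodity K
  where open Instance I

size : Instance → ℕ
size I = length (encode I)

-- Deterministic single-tape Turing machines (bi-infinite tape)

data Move : Set where
  L R S : Move

-- Tape alphabet Fin (3 + g): fzero is the blank, 1 encodes false, 2 encodes true.
data Action (Q g : ℕ) : Set where
  halt : Bool → Action Q g
  go   : Fin Q → Fin (3 + g) → Move → Action Q g

record TM : Set where
  field
    Q     : ℕ
    g     : ℕ
    start : Fin Q
    δ     : Fin Q → Fin (3 + g) → Action Q g

module _ (M : TM) where
  open TM M

  Sym : Set
  Sym = Fin (3 + g)

  blank : Sym
  blank = fzero

  inSym : Bool → Sym
  inSym false = fsuc fzero
  inSym true  = fsuc (fsuc fzero)

  -- state, cells left of head (nearest first), head cell, cells right of head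
  record Config : Set where
    constructor conf
    field
      state : Fin Q
      left  : List Sym
      head  : Sym
      right : List Sym

  initConfig : List Bool → Config
  initConfig []       = conf start [] blank []
  initConfig (b ∷ bs) = conf start [] (inSym b) (Data.List.map inSym bs)

  moveHead : Move → List Sym → Sym → List Sym → List Sym × Sym × List Sym
  moveHead S ls h rs             = ls , h , rs
  moveHead L []       h rs       = [] , blank , h ∷ rs
  moveHead L (l ∷ ls) h rs       = ls , l , h ∷ rs
  moveHead R ls h []             = h ∷ ls , blank , []
  moveHead R ls h (r ∷ rs)       = h ∷ ls , r , rs

  step : Config → Bool ⊎ Config
  step (conf q ls h rs) with δ q h
  ... | halt b      = Data.Sum.inj₁ b
  ... | go q' w m   with moveHead m ls w rs
  ...   | ls' , h' , rs' = Data.Sum.inj₂ (conf q' ls' h' rs')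

  -- Run for at most the given number of steps (each transition, including
  -- the halting one, costs one step); just b if M has halted with answer b.
  runFor : ℕ → Config → Maybe Bool
  runFor zero    c = nothing
  runFor (suc k) c with step c
  ... | Data.Sum.inj₁ b  = just b
  ... | Data.Sum.inj₂ c' = runFor k c'

  DecidesWithin : List Bool → ℕ → Bool → Set
  DecidesWithin w t b = runFor t (initConfig w) ≡ just b

FPT-MDSPP-T≤1-by-K : Set
FPT-MDSPP-T≤1-by-K =
  Σ TM λ M → Σ (ℕ → ℕ) λ f → Σ ℕ λ c →
    ∀ (I : Instance) → ValidInstance I → Instance.T I ≤ 1 →
      let t = f (length (Instance.K I)) * size I ^ c in
      (DecidesWithin M (encode I) t true × MDSPP I)
      ⊎ (DecidesWithin M (encode I) t false × ¬ MDSPP I)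

{-# OPTIONS --safe #-}
-- For T = 1 a solution H is a partial function. A vertex x at which no commodity ends can be bypassed: an edge
-- u → x of H that a commodity uses is replaced by u → y, where x → y is the edge of H at x; outdegrees stay at
-- most 1, and u → y lies in the closure of every path on which u → x was used, since those paths go on to y.
-- So a commodity (s , t , P) may be assumed to visit, besides s and t, only sinks (targets of commodities) lying on
-- P. With k commodities this leaves at most k optional vertices per path, hence at most 2^(k²) candidates, and a
-- candidate is a solution iff the pairs of consecutive vertices of its k walks form a function. For T = 0 the
-- question is whether all paths are trivial. A binary counter runs through the candidates; each of them is
-- tested in polynomial time on a machine with twelve stacks, which a single-tape Turing machine simulates with
-- polynomial overhead.
module Submission where

open import Defs hiding (L; R; S)
open import Data.Bool using (Bool; true; false; if_then_else_)
open import Data.Fin using (Fin; toℕ; combine; remQuot; splitAt; _↑ˡ_; _↑ʳ_; _≟_) renaming (zero to fzero; suc to fsuc)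
open import Data.Fin.Patterns
open import Data.Fin.Properties using (remQuot-combine; splitAt-↑ˡ; splitAt-↑ʳ; toℕ≤n; toℕ-injective)
open import Data.Fin.Subset using (Subset; ∣_∣; ⁅_⁆; ⊥) renaming (_∈_ to _∈ₛ_)
open import Data.Fin.Subset.Properties using (x∈p⇒∣p-x∣<∣p∣; x∈p∧x≢y⇒x∈p-y; ∣⁅x⁆∣≡1; ∣⊥∣≡0; ∉⊥; x∈⁅y⁆⇒x≡y; x∈⁅x⁆)
open import Data.List using (List; []; _∷_; [_]; _++_; _ʳ++_; length; map; concatMap)
open import Data.List.Properties using (++-assoc; ++-identityʳ; length-++; length-map; length-tabulate; length-ʳ++; ʳ++-ʳ++)
open import Data.List.Membership.Propositional using (_∈_; _∉_)
open import Data.List.Membership.Propositional.Properties using (∈-++⁺ˡ; ∈-++⁺ʳ; ∈-++⁻; ∈-∃++; ∈-allFin; ∈-map⁺; ∈-map⁻)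
open import Data.List.Relation.Unary.All as All using (All; []; _∷_)
open import Data.List.Relation.Unary.AllPairs using ([]; _∷_)
open import Data.List.Relation.Unary.Any using (here; there)
open import Data.List.Relation.Unary.Unique.Propositional using (Unique)
open import Data.Maybe using (Maybe; just; nothing; maybe)
open import Data.Nat using (ℕ; zero; suc; _+_; _*_; _∸_; _^_; _⊓_; _≤_; _<_; z≤n; s≤s)
open import Data.Nat.Properties hiding (_≟_)
open import Data.Nat.Tactic.RingSolver using (solve-∀)
open import Data.Product using (Σ; ∃; _×_; _,_; proj₁; proj₂)
open import Data.Sum as Sum using (_⊎_; inj₁; inj₂)
open import Data.Unit using (⊤; tt)
open import Data.Vec as Vec using (Vec; []; _∷_; lookup; _[_]≔_)
import Data.Vec.Properties as VecP
open import Relation.Binary.Construct.Closure.ReflexiveTransitive using (Star; ε; _◅_)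
open import Relation.Binary.PropositionalEquality hiding ([_])
open import Relation.Nullary using (¬_; Dec; yes; no; contradiction)

-- The bypassing is not carried out vertex by vertex. For a solution `H`, `Next` relates `v` to the
-- first sink on the walk of `H` that leaves `v`. Outdegree at most 1 makes this relation a function
-- whichever commodity asks, so all paths can be shortened independently and still agree. A
-- candidate then reduces to one flag for each sink strictly inside a path. The shape of the rest is
-- dictated by the demand for one concrete Turing machine with time `f k * size ^ c`: every program
-- carries an explicit step count. All counts are expressed through a single number `B` that bounds
-- vertex numbers and list lengths; with `B` equal to `box s`, quadratic in the input size `s`, they
-- become polynomials in `s`, and the parameter enters only through the number of candidates. This
-- number appears squared in the final bound, because a sweep over the tape can be as long as the
-- run has been so far, which makes the simulation quadratic in the number of instructions.

-- Stack machines and their simulation on a single tape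

module StackMachine where

  record Finite (A : Set) : Set where
    field
      card    : ℕ
      enc     : A → Fin card
      dec     : Fin card → A
      dec-enc : ∀ a → dec (enc a) ≡ a

  open Finite

  finiteFin : ∀ n → Finite (Fin n)
  finiteFin n = record { card = n ; enc = λ i → i ; dec = λ i → i ; dec-enc = λ _ → refl }

  finiteMaybe : ∀ {A} → Finite A → Finite (Maybe A)
  finiteMaybe F .card = suc (card F)
  finiteMaybe F .enc nothing  = fzero
  finiteMaybe F .enc (just a) = fsuc (enc F a)
  finiteMaybe F .dec fzero    = nothing
  finiteMaybe F .dec (fsuc i) = just (dec F i)
  finiteMaybe F .dec-enc nothing  = refl
  finiteMaybe F .dec-enc (just a) = cong just (dec-enc F a)

  finite× : ∀ {A B} → Finite A → Finite B → Finite (A × B)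
  finite× F G .card = card F * card G
  finite× F G .enc (a , b) = combine (enc F a) (enc G b)
  finite× F G .dec i = let (x , y) = remQuot {card F} (card G) i in dec F x , dec G y
  finite× F G .dec-enc (a , b) =
    trans (cong (λ p → dec F (proj₁ p) , dec G (proj₂ p)) (remQuot-combine {card F} {card G} (enc F a) (enc G b)))
          (cong₂ _,_ (dec-enc F a) (dec-enc G b))

  finiteVec : ∀ {A} → Finite A → ∀ n → Finite (Vec A n)
  finiteVec F zero    = record { card = 1 ; enc = λ _ → fzero ; dec = λ _ → [] ; dec-enc = λ { [] → refl } }
  finiteVec F (suc n) = record
    { card    = card F*
    ; enc     = λ { (x ∷ xs) → enc F* (x , xs) }
    ; dec     = λ i → proj₁ (dec F* i) ∷ proj₂ (dec F* i)
    ; dec-enc = λ { (x ∷ xs) → cong (λ p → proj₁ p ∷ proj₂ p) (dec-enc F* (x , xs)) }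
    }
    where F* = finite× F (finiteVec F n)

  -- Stack symbols; a digit is the top of a stack, 0F meaning that the stack is empty.
  Letter : Set
  Letter = Fin 5

  Digit : Set
  Digit = Fin 6

  hd : List Letter → Digit
  hd []      = 0F
  hd (a ∷ _) = fsuc a

  tl : List Letter → List Letter
  tl []       = []
  tl (_ ∷ as) = as

  cons? : Digit → List Letter → List Letter
  cons? fzero    as = as
  cons? (fsuc a) as = a ∷ as

  bit : Bool → Letter
  bit false = 0F
  bit true  = 1F

  data Op : Set where
    push : Letter → Op
    pop  : Op
    nop  : Op

  record Instr (k : ℕ) (Lab : Set) : Set where
    constructor instr
    field
      op   : Op
      idx  : Fin k
      next : Digit → Maybe Lab

  open Instr

  Store : ℕ → Set
  Store k = Vec (List Letter) k

  execOp : ∀ {k} {Lab : Set} → Op → Fin k → (Digit → Maybe Lab) → Store k → Maybe Lab × Store k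
  execOp (push a) i f σ = f 0F , (σ [ i ]≔ (a ∷ lookup σ i))
  execOp pop      i f σ = f (hd (lookup σ i)) , (σ [ i ]≔ tl (lookup σ i))
  execOp nop      i f σ = f 0F , σ

  execInstr : ∀ {k} {Lab : Set} → Instr k Lab → Store k → Maybe Lab × Store k
  execInstr c = execOp (op c) (idx c) (next c)

  data Exec {k Lab} (code : Lab → Instr k Lab) : Maybe Lab → Store k → ℕ → Store k → Set where
    done : ∀ {σ} → Exec code nothing σ 0 σ
    more : ∀ {l σ n τ} →
           Exec code (proj₁ (execInstr (code l) σ)) (proj₂ (execInstr (code l) σ)) n τ →
           Exec code (just l) σ (suc n) τ

  answer : Digit → Bool
  answer 2F = true
  answer _  = false

  -- One tape cell inside the used area holds, for every stack, its entry at that depth (the tops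
  -- are at the origin), so that a push or a pop is a sweep shifting a single track.
  module Compile {m : ℕ} {Lab : Set} (FL : Finite Lab) (code : Lab → Instr (suc m) Lab) (init : Lab) where

    Cell : Set
    Cell = Vec Digit (suc m)

    FC : Finite Cell
    FC = finiteVec (finiteFin 6) (suc m)

    TSym : Set
    TSym = Fin (3 + card FC)

    base : Letter → Cell
    base a = fsuc a ∷ Vec.replicate m 0F

    -- The two raw input symbols decode to cells in which only the track of stack 0 is occupied, so
    -- the untouched input already represents `inputStore`. The blank decodes to `nothing` and
    -- thereby delimits the used area on both sides.
    decC : TSym → Maybe Cell
    decC 0F = nothing
    decC 1F = just (base (bit false))
    decC 2F = just (base (bit true))
    decC (fsuc (fsuc (fsuc i))) = just (dec FC i)

    encC : Cell → TSym
    encC v = fsuc (fsuc (fsuc (enc FC v)))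

    decC-encC : ∀ v → decC (encC v) ≡ just v
    decC-encC v = cong just (dec-enc FC v)

    pattern fetch  = 0F
    pattern pushR  = 1F
    pattern backL  = 2F
    pattern popR   = 3F
    pattern popL   = 4F
    pattern start₀ = 5F
    pattern start₁ = 6F

    -- Phase, label and carried digit. The label belongs to the instruction being carried out or, in
    -- `backL`, to its successor; `fetch` with label `nothing` halts. The digit is the entry that a
    -- shifting sweep has displaced and not yet written back.
    State : Set
    State = Fin 7 × Maybe Lab × Digit

    FS : Finite State
    FS = finite× (finiteFin 7) (finite× (finiteMaybe FL) (finiteFin 6))

    data Act : Set where
      stop : Bool → Act
      to   : State → TSym → Move → Act

    zeros : Cell
    zeros = Vec.replicate (suc m) 0F

    actFetch : Lab → TSym → Act
    actFetch l h with op (code l)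
    ... | push a = to (pushR , just l , fsuc a) h Move.S
    ... | pop    = to (popR , just l , 0F) h Move.S
    ... | nop    = to (fetch , next (code l) 0F , 0F) h Move.S

    actHalt : Maybe Cell → Act
    actHalt nothing  = stop false
    actHalt (just v) = stop (answer (lookup v 0F))

    actPushR : Lab → Digit → Maybe Cell → Act
    actPushR l x nothing  = to (backL , next (code l) 0F , 0F) (encC (zeros [ idx (code l) ]≔ x)) Move.L
    actPushR l x (just v) = to (pushR , just l , lookup v (idx (code l))) (encC (v [ idx (code l) ]≔ x)) Move.R

    actBackL : Maybe Lab → TSym → Maybe Cell → Act
    actBackL ml h nothing  = to (fetch , ml , 0F) h Move.R
    actBackL ml h (just _) = to (backL , ml , 0F) h Move.L

    actPopR : Lab → TSym → Maybe Cell → Act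
    actPopR l h nothing  = to (popL , just l , 0F) h Move.L
    actPopR l h (just _) = to (popR , just l , 0F) h Move.R

    actPopL : Lab → Digit → TSym → Maybe Cell → Act
    actPopL l x h nothing  = to (fetch , next (code l) x , 0F) h Move.R
    actPopL l x h (just v) = to (popL , just l , lookup v (idx (code l))) (encC (v [ idx (code l) ]≔ x)) Move.L

    act : State → TSym → Act
    act (fetch , nothing , _) h = actHalt (decC h)
    act (fetch , just l , _)  h = actFetch l h
    act (pushR , just l , x)  h = actPushR l x (decC h)
    act (backL , ml , _)      h = actBackL ml h (decC h)
    act (popR , just l , _)   h = actPopR l h (decC h)
    act (popL , just l , x)   h = actPopL l x h (decC h)
    act (start₀ , _ , _)      h = to (start₁ , nothing , 0F) h Move.L
    act (start₁ , _ , _)      h = to (fetch , just init , 0F) h Move.R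
    act _                     h = stop false

    toAction : Act → Action (card FS) (card FC)
    toAction (stop b)   = halt b
    toAction (to q h d) = go (enc FS q) h d

    machine : TM
    machine = record
      { Q = card FS ; g = card FC
      ; start = enc FS (start₀ , nothing , 0F)
      ; δ = λ q h → toAction (act (dec FS q) h) }

    record ACfg : Set where
      constructor cfg
      field
        st    : State
        left  : List TSym
        head  : TSym
        right : List TSym

    concrete : ACfg → Config machine
    concrete (cfg s ls h rs) = conf (enc FS s) ls h rs

    hdT : List TSym → TSym
    hdT []      = 0F
    hdT (h ∷ _) = h

    tlT : List TSym → List TSym
    tlT []       = []
    tlT (_ ∷ hs) = hs

    at : State → List TSym → List TSym → ACfg
    at s ls xs = cfg s ls (hdT xs) (tlT xs)

    -- `runFor` returns only an answer, so an intermediate configuration is captured by what happens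
    -- from it on; quantifying over the remaining fuel `t` makes such statements compose.
    record Steps (n : ℕ) (c c′ : ACfg) : Set where
      constructor steps
      field run : ∀ t → runFor machine (n + t) (concrete c) ≡ runFor machine t (concrete c′)

    open Steps public

    infixr 5 _▸_
    _▸_ : ∀ {a b c₁ c₂ c₃} → Steps a c₁ c₂ → Steps b c₂ c₃ → Steps (a + b) c₁ c₃
    _▸_ {a} {b} {c₁} p q .run t =
      trans (cong (λ k → runFor machine k (concrete c₁)) (+-assoc a b t)) (trans (run p (b + t)) (run q t))

    stepS : ∀ {s s′ ls h rs w} → act s h ≡ to s′ w Move.S → Steps 1 (cfg s ls h rs) (cfg s′ ls w rs)
    stepS {s} e .run t rewrite dec-enc FS s | e = refl

    stepR : ∀ {s s′ ls h w} rs → act s h ≡ to s′ w Move.R → Steps 1 (cfg s ls h rs) (at s′ (w ∷ ls) rs)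
    stepR {s} []      e .run t rewrite dec-enc FS s | e = refl
    stepR {s} (_ ∷ _) e .run t rewrite dec-enc FS s | e = refl

    stepL₀ : ∀ {s s′ h rs w} → act s h ≡ to s′ w Move.L → Steps 1 (cfg s [] h rs) (cfg s′ [] 0F (w ∷ rs))
    stepL₀ {s} e .run t rewrite dec-enc FS s | e = refl

    stepL₁ : ∀ {s s′ l ls h rs w} → act s h ≡ to s′ w Move.L → Steps 1 (cfg s (l ∷ ls) h rs) (cfg s′ ls l (w ∷ rs))
    stepL₁ {s} e .run t rewrite dec-enc FS s | e = refl

    halts : ∀ {s ls h rs b} → act s h ≡ stop b → runFor machine 1 (concrete (cfg s ls h rs)) ≡ just b
    halts {s} e rewrite dec-enc FS s | e = refl

    recount : ∀ {n n′ c c′} → n ≡ n′ → Steps n c c′ → Steps n′ c c′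
    recount refl p = p

    retarget : ∀ {n c c′ c″} → c′ ≡ c″ → Steps n c c′ → Steps n c c″
    retarget refl p = p

    heads : Store (suc m) → Cell
    heads = Vec.map hd

    tails : Store (suc m) → Store (suc m)
    tails = Vec.map tl

    empty : Store (suc m)
    empty = Vec.replicate (suc m) []

    -- The used area may be longer than every stack, since a cell of zeros is admissible below the
    -- bottom; hence a pop need not shorten it.
    data Rep : Store (suc m) → List TSym → Set where
      end  : Rep empty []
      cell : ∀ {σ h hs} → decC h ≡ just (heads σ) → Rep (tails σ) hs → Rep σ (h ∷ hs)

    -- What the tape stores to the right of the used area: a pop sweep turns around at the first
    -- blank and leaves it behind as an explicit symbol.
    data End : List TSym → Set where
      none : End []
      one  : End (0F ∷ [])

    pushD popD : Fin (suc m) → Digit → Store (suc m) → Store (suc m)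
    pushD i x σ = σ [ i ]≔ cons? x (lookup σ i)
    popD i _ σ  = σ [ i ]≔ tl (lookup σ i)

    lookup-heads : ∀ σ i → lookup (heads σ) i ≡ hd (lookup σ i)
    lookup-heads σ i = VecP.lookup-map i hd σ

    lookup-tails : ∀ σ i → lookup (tails σ) i ≡ tl (lookup σ i)
    lookup-tails σ i = VecP.lookup-map i tl σ

    cons?-tl : ∀ as → cons? (hd as) (tl as) ≡ as
    cons?-tl []      = refl
    cons?-tl (_ ∷ _) = refl

    hd-cons? : ∀ x as → (x ≡ 0F → as ≡ []) → hd (cons? x as) ≡ x
    hd-cons? fzero    as e rewrite e refl = refl
    hd-cons? (fsuc a) as e = refl

    tl-cons? : ∀ x as → (x ≡ 0F → as ≡ []) → tl (cons? x as) ≡ as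
    tl-cons? fzero    as e rewrite e refl = refl
    tl-cons? (fsuc a) as e = refl

    hd-nil : ∀ {as} → hd as ≡ 0F → tl as ≡ []
    hd-nil {[]} _ = refl

    heads-empty : heads empty ≡ zeros
    heads-empty = VecP.map-replicate hd [] (suc m)

    tails-empty : tails empty ≡ empty
    tails-empty = VecP.map-replicate tl [] (suc m)

    heads-update : ∀ σ i as → heads (σ [ i ]≔ as) ≡ heads σ [ i ]≔ hd as
    heads-update σ i as = VecP.map-[]≔ hd σ i

    tails-update : ∀ σ i as → tails (σ [ i ]≔ as) ≡ tails σ [ i ]≔ tl as
    tails-update σ i as = VecP.map-[]≔ tl σ i

    heads-push : ∀ i x σ → (x ≡ 0F → lookup σ i ≡ []) → heads (pushD i x σ) ≡ heads σ [ i ]≔ x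
    heads-push i x σ e = trans (heads-update σ i _) (cong (heads σ [ i ]≔_) (hd-cons? x _ e))

    tails-push : ∀ i x σ → (x ≡ 0F → lookup σ i ≡ []) →
                 tails (pushD i x σ) ≡ pushD i (lookup (heads σ) i) (tails σ)
    tails-push i x σ e = begin
      tails (pushD i x σ)                          ≡⟨ tails-update σ i _ ⟩
      tails σ [ i ]≔ tl (cons? x (lookup σ i))     ≡⟨ cong (tails σ [ i ]≔_) (tl-cons? x _ e) ⟩
      tails σ [ i ]≔ lookup σ i                    ≡⟨ cong (tails σ [ i ]≔_) (sym (cons?-tl _)) ⟩
      tails σ [ i ]≔ cons? (hd (lookup σ i)) (tl (lookup σ i))
        ≡⟨ cong₂ (λ d as → tails σ [ i ]≔ cons? d as) (sym (lookup-heads σ i)) (sym (lookup-tails σ i)) ⟩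
      pushD i (lookup (heads σ) i) (tails σ)       ∎
      where open ≡-Reasoning

    record Sweep (σ : Store (suc m)) (len n : ℕ) (from : TSym → List TSym → ACfg)
                 (back : List TSym → TSym → List TSym → ACfg) : Set where
      field
        {hs rest} : List TSym
        rep    : Rep σ hs
        short  : length hs ≤ len
        isEnd  : End rest
        moves  : ∀ l ls → Steps n (from l ls) (back ls l (hs ++ rest))

    sweepCount : ∀ n → suc (2 * n + 1 + 1) ≡ 2 * suc n + 1
    sweepCount = solve-∀

    -- Each cell takes the carried digit and hands on its own, so the induction continues with a
    -- push onto `tails σ`. The premise on `x` says that the empty digit is carried only past the
    -- bottom of the stack; otherwise it would open a gap in the track. The turn appends a cell even
    -- when the carried digit is empty, whence the length `suc (length xs)`.
    pushSweep : ∀ l {σ xs rest} → Rep σ xs → End rest → ∀ x →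
                (x ≡ 0F → lookup σ (idx (code l)) ≡ []) →
                Sweep (pushD (idx (code l)) x σ) (suc (length xs)) (2 * length xs + 1)
                      (λ c ls → at (pushR , just l , x) (c ∷ ls) (xs ++ rest))
                      (λ ls c rs → cfg (backL , next (code l) 0F , 0F) ls c rs)
    pushSweep l {rest = rest} end e x nx = record
      { hs    = encC (zeros [ i ]≔ x) ∷ []
      ; rep   = cell (trans (decC-encC _) (cong just (trans (cong (_[ i ]≔ x) (sym heads-empty)) (sym (heads-push i x empty nx)))))
                     (subst (λ σ → Rep σ []) (sym tl-eq) end)
      ; short = ≤-refl
      ; isEnd = none
      ; moves = λ c ls → turn e c ls }
      where
      i = idx (code l)
      turn : ∀ {rest} → End rest → ∀ c ls →
             Steps 1 (at (pushR , just l , x) (c ∷ ls) rest)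
                     (cfg (backL , next (code l) 0F , 0F) ls c (encC (zeros [ i ]≔ x) ∷ []))
      turn none c ls = stepL₁ refl
      turn one  c ls = stepL₁ refl
      emptyᵢ : lookup empty i ≡ []
      emptyᵢ = VecP.lookup-replicate i []
      tl-eq : tails (pushD i x empty) ≡ empty
      tl-eq = begin
        tails (pushD i x empty) ≡⟨ tails-push i x empty nx ⟩
        tails empty [ i ]≔ cons? (lookup (heads empty) i) (lookup (tails empty) i)
          ≡⟨ cong₂ (λ a b → a [ i ]≔ cons? b (lookup a i)) tails-empty
                   (trans (lookup-heads empty i) (cong hd emptyᵢ)) ⟩
        empty [ i ]≔ lookup empty i ≡⟨ VecP.[]≔-lookup empty i ⟩
        empty ∎
        where open ≡-Reasoning
    pushSweep l {σ} {h ∷ xs} {rest} (cell d r) e x nx = record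
      { hs    = encC (heads σ [ i ]≔ x) ∷ IH.hs
      ; rep   = cell (trans (decC-encC _) (cong just (sym (heads-push i x σ nx))))
                     (subst (λ τ → Rep τ IH.hs) (sym (tails-push i x σ nx)) IH.rep)
      ; short = s≤s IH.short
      ; isEnd = IH.isEnd
      ; moves = λ c ls → recount (sweepCount (length xs))
          (stepR (xs ++ rest) (cong (actPushR l x) d) ▸ IH.moves _ (c ∷ ls) ▸
           stepL₁ (cong (actBackL (next (code l) 0F) (encC (heads σ [ i ]≔ x))) (decC-encC (heads σ [ i ]≔ x)))) }
      where
      i = idx (code l)
      module IH = Sweep (pushSweep l r e (lookup (heads σ) i)
        λ z → trans (lookup-tails σ i) (hd-nil (trans (sym (lookup-heads σ i)) z)))

    -- The track is shifted on the way back: a cell receives the entry found one position deeper and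
    -- gives up its own, so that the popped top ends up in the state.
    popSweep : ∀ l {σ xs rest} → Rep σ xs → End rest →
               Sweep (popD (idx (code l)) 0F σ) (length xs) (2 * length xs + 1)
                     (λ c ls → at (popR , just l , 0F) (c ∷ ls) (xs ++ rest))
                     (λ ls c rs → cfg (popL , just l , hd (lookup σ (idx (code l)))) ls c rs)
    popSweep l {rest = rest} end e = record
      { hs = [] ; rep = subst (λ σ → Rep σ []) (sym same) end
      ; short = z≤n ; isEnd = one
      ; moves = λ c ls → retarget (cong (λ d → cfg (popL , just l , hd d) ls c (0F ∷ [])) (sym emptyᵢ)) (turn e c ls) }
      where
      i = idx (code l)
      turn : ∀ {rest} → End rest → ∀ c ls →
             Steps 1 (at (popR , just l , 0F) (c ∷ ls) rest) (cfg (popL , just l , 0F) ls c (0F ∷ []))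
      turn none c ls = stepL₁ refl
      turn one  c ls = stepL₁ refl
      emptyᵢ : lookup empty i ≡ []
      emptyᵢ = VecP.lookup-replicate i []
      same : empty [ i ]≔ tl (lookup empty i) ≡ empty
      same = trans (cong (empty [ i ]≔_) (trans (cong tl emptyᵢ) (sym emptyᵢ))) (VecP.[]≔-lookup empty i)
    popSweep l {σ} {h ∷ xs} {rest} (cell d r) e = record
      { hs    = encC (heads σ [ i ]≔ hd (lookup (tails σ) i)) ∷ IH.hs
      ; rep   = cell (trans (decC-encC _) (cong just (sym heads-eq)))
                     (subst (λ τ → Rep τ IH.hs) (sym tails-eq) IH.rep)
      ; short = s≤s IH.short
      ; isEnd = IH.isEnd
      ; moves = λ c ls → recount (sweepCount (length xs)) (retarget
          (cong (λ x → cfg (popL , just l , x) ls c (encC (heads σ [ i ]≔ hd (lookup (tails σ) i)) ∷ IH.hs ++ IH.rest)) (lookup-heads σ i))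
          (stepR (xs ++ rest) (cong (actPopR l h) d) ▸ IH.moves _ (c ∷ ls) ▸
           stepL₁ (cong (actPopL l _ h) d))) }
      where
      i = idx (code l)
      module IH = Sweep (popSweep l r e)
      heads-eq : heads (σ [ i ]≔ tl (lookup σ i)) ≡ heads σ [ i ]≔ hd (lookup (tails σ) i)
      heads-eq = trans (heads-update σ i _) (cong (λ as → heads σ [ i ]≔ hd as) (sym (lookup-tails σ i)))
      tails-eq : tails (σ [ i ]≔ tl (lookup σ i)) ≡ tails σ [ i ]≔ tl (lookup (tails σ) i)
      tails-eq = trans (tails-update σ i _) (cong (λ as → tails σ [ i ]≔ tl as) (sym (lookup-tails σ i)))

    record Reached (ml : Maybe Lab) (σ : Store (suc m)) (bound len : ℕ) (c : ACfg) : Set where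
      field
        {hs rest} : List TSym
        {time}    : ℕ
        rep       : Rep σ hs
        short     : length hs ≤ len
        isEnd     : End rest
        inTime    : time ≤ bound
        moves     : Steps time c (at (fetch , ml , 0F) (0F ∷ []) (hs ++ rest))

    private
      wrap : ∀ n → 1 + (2 * n + 1 + 1) ≤ 2 * n + 4
      wrap n = ≤-trans (≤-reflexive (regroup n)) (+-monoʳ-≤ (2 * n) (n≤1+n 3))
        where
        regroup : ∀ n → 1 + (2 * n + 1 + 1) ≡ 2 * n + 3
        regroup = solve-∀

      budget : ∀ {t u n v} k → t ≤ 2 * k + 4 → v ≤ suc k → u ≤ n * (2 * (v + n) + 4) →
               t + u ≤ suc n * (2 * (k + suc n) + 4)
      budget {t} {u} {n} {v} k p v≤ q = +-mono-≤
        (≤-trans p (+-monoˡ-≤ 4 (*-monoʳ-≤ 2 (m≤m+n k (suc n)))))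
        (≤-trans q (*-monoʳ-≤ n (+-monoˡ-≤ 4 (*-monoʳ-≤ 2 (grown v≤)))))
        where
        grown : v ≤ suc k → v + n ≤ k + suc n
        grown p = ≤-trans (+-monoˡ-≤ n p) (≤-reflexive (sym (+-suc k n)))

    instrSteps : ∀ l {σ xs rest} → Rep σ xs → End rest →
                 let (ml , τ) = execInstr (code l) σ in
                 Reached ml τ (2 * length xs + 4) (suc (length xs))
                         (at (fetch , just l , 0F) (0F ∷ []) (xs ++ rest))
    instrSteps l {σ} {xs} {rest} r e with op (code l) in eq
    ... | push a = record
      { rep = Sw.rep ; short = Sw.short ; isEnd = Sw.isEnd ; inTime = wrap (length xs)
      ; moves = stepS fetched ▸ Sw.moves 0F [] ▸ stepR (Sw.hs ++ Sw.rest) refl }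
      where
      module Sw = Sweep (pushSweep l r e (fsuc a) (λ ()))
      fetched : ∀ {h} → actFetch l h ≡ to (pushR , just l , fsuc a) h Move.S
      fetched rewrite eq = refl
    ... | pop = record
      { rep = Sw.rep ; short = m≤n⇒m≤1+n Sw.short ; isEnd = Sw.isEnd ; inTime = wrap (length xs)
      ; moves = stepS fetched ▸ Sw.moves 0F [] ▸ stepR (Sw.hs ++ Sw.rest) refl }
      where
      module Sw = Sweep (popSweep l r e)
      fetched : ∀ {h} → actFetch l h ≡ to (popR , just l , 0F) h Move.S
      fetched rewrite eq = refl
    ... | nop = record
      { rep = r ; short = n≤1+n _ ; isEnd = e ; inTime = ≤-trans (s≤s z≤n) (m≤n+m 4 (2 * length xs))
      ; moves = stepS fetched }
      where
      fetched : ∀ {h} → actFetch l h ≡ to (fetch , next (code l) 0F , 0F) h Move.S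
      fetched rewrite eq = refl

    -- One instruction lengthens the used area by at most one cell, so every sweep of the run stays
    -- within `length xs + n` cells. This is the source of the quadratic overhead.
    reach-halt : ∀ {ml σ n τ} → Exec code ml σ n τ → ∀ {xs rest} → Rep σ xs → End rest →
                 Reached nothing τ (n * (2 * (length xs + n) + 4)) (length xs + n)
                         (at (fetch , ml , 0F) (0F ∷ []) (xs ++ rest))
    reach-halt done {xs} r e = record
      { rep = r ; short = m≤m+n (length xs) 0 ; isEnd = e ; time = 0 ; inTime = z≤n
      ; moves = steps λ t → refl }
    reach-halt (more {l = l} {n = n} ex) {xs} r e = record
      { rep = E.rep ; isEnd = E.isEnd
      ; short = ≤-trans E.short (≤-trans (+-monoˡ-≤ n I.short) (≤-reflexive (sym (+-suc (length xs) n))))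
      ; inTime = budget (length xs) I.inTime I.short E.inTime
      ; moves = I.moves ▸ E.moves }
      where
      module I = Reached (instrSteps l r e)
      module E = Reached (reach-halt ex I.rep I.isEnd)

    top : Store (suc m) → Digit
    top τ = hd (lookup τ 0F)

    halt-answer : ∀ {τ hs rest} → Rep τ hs → End rest →
                  actHalt (decC (hdT (hs ++ rest))) ≡ stop (answer (top τ))
    halt-answer end none = refl
    halt-answer end one  = refl
    halt-answer {τ} (cell d _) _ = trans (cong actHalt d) (cong (λ x → stop (answer x)) (lookup-heads τ 0F))

    inputStore : List Bool → Store (suc m)
    inputStore w = map bit w ∷ Vec.replicate m []

    rep-input : ∀ w → Rep (inputStore w) (map (inSym machine) w)
    rep-input []          = end
    rep-input (false ∷ w) = cell (cong (λ v → just (1F ∷ v)) (sym (VecP.map-replicate hd [] m)))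
                                 (subst (λ v → Rep (map bit w ∷ v) (map (inSym machine) w)) (sym (VecP.map-replicate tl [] m)) (rep-input w))
    rep-input (true ∷ w)  = cell (cong (λ v → just (2F ∷ v)) (sym (VecP.map-replicate hd [] m)))
                                 (subst (λ v → Rep (map bit w ∷ v) (map (inSym machine) w)) (sym (VecP.map-replicate tl [] m)) (rep-input w))

    -- Stepping left and back turns the implicit blank before the origin into an explicit one, so
    -- that every instruction starts with the same left part `0F ∷ []`.
    bounce : ∀ h rs → Steps 2 (cfg (start₀ , nothing , 0F) [] h rs)
                              (at (fetch , just init , 0F) (0F ∷ []) (h ∷ rs))
    bounce h rs = stepL₀ {s = start₀ , nothing , 0F} refl ▸ stepR {s = start₁ , nothing , 0F} (h ∷ rs) refl

    prepare : ∀ w → ∃ λ rest → End rest ×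
              (∀ t → runFor machine (2 + t) (initConfig machine w)
                   ≡ runFor machine t (concrete (at (fetch , just init , 0F) (0F ∷ []) (map (inSym machine) w ++ rest))))
    prepare []      = 0F ∷ [] , one , run (bounce 0F [])
    prepare (b ∷ w) = [] , none , λ t → trans (run (bounce (inSym machine b) (map (inSym machine) w)) t)
      (cong (λ xs → runFor machine t (concrete (at (fetch , just init , 0F) (0F ∷ []) (inSym machine b ∷ xs)))) (sym (++-identityʳ _)))

    runFor-more : ∀ {b} t u c → runFor machine t c ≡ just b → runFor machine (t + u) c ≡ just b
    runFor-more (suc t) u c e with step machine c
    ... | inj₁ _  = e
    ... | inj₂ c′ = runFor-more t u c′ e

    -- The 3 counts the two steps of `bounce` and the halting transition.
    decides : ∀ {w n τ T} → Exec code (just init) (inputStore w) n τ →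
              3 + n * (2 * (length w + n) + 4) ≤ T → DecidesWithin machine w T (answer (top τ))
    decides {w} {n} {τ} {T} ex le with prepare w
    ... | rest , e , prep = subst (λ T → DecidesWithin machine w T (answer (top τ))) enough
          (runFor-more (2 + (H.time + 1)) _ (initConfig machine w) (trans (prep (H.time + 1)) (trans (run H.moves 1) (halts {s = fetch , nothing , 0F} {ls = 0F ∷ []} {h = hdT (H.hs ++ H.rest)} {rs = tlT (H.hs ++ H.rest)} (halt-answer H.rep H.isEnd)))))
      where
      module H = Reached (reach-halt ex (rep-input w) e)
      fits : 2 + (H.time + 1) ≤ T
      fits = ≤-trans (≤-reflexive (cong (2 +_) (+-comm H.time 1))) (≤-trans
        (s≤s (s≤s (s≤s (≤-trans H.inTime (≤-reflexive (cong (λ k → n * (2 * (k + n) + 4)) (length-map (inSym machine) w))))))) le)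
      enough : 2 + (H.time + 1) + (T ∸ (2 + (H.time + 1))) ≡ T
      enough = m+[n∸m]≡n fits

open StackMachine

-- Structured programs and their compilation to stack machine code

module Programs where

  open Finite
  open Instr

  finite⊤ : Finite ⊤
  finite⊤ = record { card = 1 ; enc = λ _ → 0F ; dec = λ _ → tt ; dec-enc = λ _ → refl }

  finite⊎ : ∀ {A B} → Finite A → Finite B → Finite (A ⊎ B)
  finite⊎ F G .card = card F + card G
  finite⊎ F G .enc (inj₁ a) = enc F a ↑ˡ card G
  finite⊎ F G .enc (inj₂ b) = card F ↑ʳ enc G b
  finite⊎ F G .dec i = Sum.map (dec F) (dec G) (splitAt (card F) i)
  finite⊎ F G .dec-enc (inj₁ a) =
    trans (cong (Sum.map (dec F) (dec G)) (splitAt-↑ˡ (card F) (enc F a) (card G))) (cong inj₁ (dec-enc F a))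
  finite⊎ F G .dec-enc (inj₂ b) =
    trans (cong (Sum.map (dec F) (dec G)) (splitAt-↑ʳ (card F) (card G) (enc G b))) (cong inj₂ (dec-enc G b))

  finiteΣ : ∀ n {B : Fin n → Set} → (∀ i → Finite (B i)) → Finite (Σ (Fin n) B)
  finiteΣ zero    F = record { card = 0 ; enc = λ () ; dec = λ () ; dec-enc = λ () }
  finiteΣ (suc n) {B} F = record
    { card = card FΣ ; enc = λ p → enc FΣ (to p) ; dec = λ i → from (dec FΣ i)
    ; dec-enc = λ p → trans (cong from (dec-enc FΣ (to p))) (from-to p) }
    where
    Split : Set
    Split = B fzero ⊎ Σ (Fin n) (λ i → B (fsuc i))
    FΣ : Finite Split
    FΣ = finite⊎ (F fzero) (finiteΣ n (λ i → F (fsuc i)))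
    to : Σ (Fin (suc n)) B → Split
    to (fzero , b)  = inj₁ b
    to (fsuc i , b) = inj₂ (i , b)
    from : Split → Σ (Fin (suc n)) B
    from (inj₁ b)       = fzero , b
    from (inj₂ (i , b)) = fsuc i , b
    from-to : ∀ p → from (to p) ≡ p
    from-to (fzero , b)  = refl
    from-to (fsuc i , b) = refl

  infixr 4 _⨾_

  data Prog (k : ℕ) : Set where
    skip : Prog k
    put  : Fin k → Letter → Prog k
    _⨾_  : Prog k → Prog k → Prog k
    -- Pops a symbol, runs the branch it selects, and repeats if the first table says so.
    loop : Fin k → (Digit → Bool) → (Digit → Prog k) → Prog k

  extend : ∀ {A B : Set} → (A → B) → Maybe B → Maybe A → Maybe B
  extend g e nothing  = e
  extend g e (just a) = just (g a)

  module _ {k : ℕ} where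

    Label : Prog k → Set
    Label skip         = ⊤
    Label (put i a)    = ⊤
    Label (p ⨾ q)      = Label p ⊎ Label q
    Label (loop i c f) = ⊤ ⊎ Σ Digit (λ x → Label (f x))

    finiteLabel : ∀ p → Finite (Label p)
    finiteLabel skip         = finite⊤
    finiteLabel (put i a)    = finite⊤
    finiteLabel (p ⨾ q)      = finite⊎ (finiteLabel p) (finiteLabel q)
    finiteLabel (loop i c f) = finite⊎ finite⊤ (finiteΣ 6 (λ x → finiteLabel (f x)))

    entry : ∀ p → Label p
    entry skip         = tt
    entry (put i a)    = tt
    entry (p ⨾ q)      = inj₁ (entry p)
    entry (loop i c f) = inj₁ tt

    relabel : ∀ {A B : Set} → (Maybe A → Maybe B) → Instr k A → Instr k B
    relabel h (instr o i f) = instr o i (λ x → h (f x))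

    resume : ∀ i c f → Digit → Maybe (Label (loop i c f))
    resume i c f x = if c x then just (inj₁ tt) else nothing


  module _ {k : ℕ} where

    codeOf : ∀ (p : Prog (suc k)) → Label p → Instr (suc k) (Label p)
    codeOf skip         tt             = instr nop 0F (λ _ → nothing)
    codeOf (put i a)    tt             = instr (push a) i (λ _ → nothing)
    codeOf (p ⨾ q)      (inj₁ l)       = relabel (extend inj₁ (just (inj₂ (entry q)))) (codeOf p l)
    codeOf (p ⨾ q)      (inj₂ l)       = relabel (extend inj₂ nothing) (codeOf q l)
    codeOf (loop i c f) (inj₁ tt)      = instr pop i (λ x → just (inj₂ (x , entry (f x))))
    codeOf (loop i c f) (inj₂ (x , l)) =
      relabel (extend (λ l → inj₂ (x , l)) (resume i c f x)) (codeOf (f x) l)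

    execOp-relabel : ∀ {A B : Set} (h : Maybe A → Maybe B) o (i : Fin (suc k)) f σ →
                     execOp o i (λ x → h (f x)) σ ≡ (h (proj₁ (execOp o i f σ)) , proj₂ (execOp o i f σ))
    execOp-relabel h (push _) i f σ = refl
    execOp-relabel h pop      i f σ = refl
    execOp-relabel h nop      i f σ = refl

    -- A run of a part is a run of the whole up to the point where the part exits; `extend`
    -- redirects this exit to `e`. Sequencing and looping differ only in the choice of `e`.
    embed : ∀ {A B : Set} {codeA : A → Instr (suc k) A} {codeB : B → Instr (suc k) B} (g : A → B) (e : Maybe B) →
            (∀ l → codeB (g l) ≡ relabel (extend g e) (codeA l)) →
            ∀ {ml σ n τ n′ ρ} → Exec codeA ml σ n τ → Exec codeB e τ n′ ρ →
            Exec codeB (extend g e ml) σ (n + n′) ρ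
    embed g e eq done ex′ = ex′
    embed {codeA = codeA} {codeB} g e eq (more {l = l} {σ = σ} ex) ex′ = more
      (subst (λ r → Exec codeB (proj₁ r) (proj₂ r) _ _)
        (sym (trans (cong (λ c → execInstr c σ) (eq l)) (execOp-relabel (extend g e) (op (codeA l)) (idx (codeA l)) (next (codeA l)) σ)))
        (embed g e eq ex ex′))

    record Runs (p : Prog (suc k)) (σ τ : Store (suc k)) (N : ℕ) : Set where
      constructor runs
      field
        count : ℕ
        bound : count ≤ N
        exec  : Exec (codeOf p) (just (entry p)) σ count τ

    weaken : ∀ {p σ τ N N′} → N ≤ N′ → Runs p σ τ N → Runs p σ τ N′
    weaken le (runs n b ex) = runs n (≤-trans b le) ex

    run-skip : ∀ {σ} → Runs skip σ σ 1
    run-skip = runs 1 ≤-refl (more done)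

    run-put : ∀ {i a σ} → Runs (put i a) σ (σ [ i ]≔ (a ∷ lookup σ i)) 1
    run-put = runs 1 ≤-refl (more done)

    infixr 4 _then_
    _then_ : ∀ {p q σ τ ρ a b} → Runs p σ τ a → Runs q τ ρ b → Runs (p ⨾ q) σ ρ (a + b)
    _then_ {p} {q} (runs n le ex) (runs n′ le′ ex′) =
      runs (n + n′) (+-mono-≤ le le′)
        (embed inj₁ (just (inj₂ (entry q))) (λ _ → refl) ex
          (subst (λ n → Exec (codeOf (p ⨾ q)) _ _ n _) (+-identityʳ n′)
            (embed inj₂ nothing (λ _ → refl) ex′ done)))

    run-exit : ∀ {i c f σ τ a} → let x = hd (lookup σ i) in c x ≡ false →
               Runs (f x) (σ [ i ]≔ tl (lookup σ i)) τ a → Runs (loop i c f) σ τ (suc a)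
    run-exit {i} {c} {f} {σ} {τ} stop (runs n le ex) = runs (suc n) (s≤s le)
      (more (subst (λ n → Exec (codeOf (loop i c f)) _ _ n _) (+-identityʳ n)
        (embed (λ l → inj₂ (x , l)) (resume i c f x) (λ _ → refl) ex
          (subst (λ b → Exec (codeOf (loop i c f)) (if b then just (inj₁ tt) else nothing) τ 0 τ) (sym stop) done))))
      where x = hd (lookup σ i)

    run-again : ∀ {i c f σ τ ρ a b} → let x = hd (lookup σ i) in c x ≡ true →
                Runs (f x) (σ [ i ]≔ tl (lookup σ i)) τ a → Runs (loop i c f) τ ρ b →
                Runs (loop i c f) σ ρ (suc (a + b))
    run-again {i} {c} {f} {σ} {τ} {ρ} eq (runs n le ex) (runs n′ le′ ex′) = runs (suc (n + n′)) (s≤s (+-mono-≤ le le′))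
      (more (embed (λ l → inj₂ (x , l)) (resume i c f x) (λ _ → refl) ex
          (subst (λ b → Exec (codeOf (loop i c f)) (if b then just (inj₁ tt) else nothing) τ n′ ρ) (sym eq) ex′)))
      where x = hd (lookup σ i)

open Programs

-- Moving and comparing unary numbers on stacks

module Routines where

  pattern O = 0F
  pattern I = 1F
  pattern Fix = 2F
  pattern On  = 3F
  pattern Off = 4F

  pattern ∅   = 0F
  pattern dO  = 1F
  pattern dI  = 2F
  pattern dFix = 3F
  pattern dOn  = 4F
  pattern dOff = 5F

  Str : Set
  Str = List Letter

  Stacks : Set
  Stacks = Store 12

  -- Roles of the stacks: x input, then edges of the current candidate, finally the answer; t sinks; r and d path
  -- vertices, then segments; u and v numbers being compared; c, w, p, q scratch; z the target, then whether the
  -- search goes on; f clashes of the current candidate.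
  st : (x c v t r d u w p q z f : Str) → Stacks
  st x c v t r d u w p q z f = x ∷ c ∷ v ∷ t ∷ r ∷ d ∷ u ∷ w ∷ p ∷ q ∷ z ∷ f ∷ []

  pattern iX = 0F
  pattern iC = 1F
  pattern iV = 2F
  pattern iT = 3F
  pattern iR = 4F
  pattern iD = 5F
  pattern iU = 6F
  pattern iW = 7F
  pattern iP = 8F
  pattern iQ = 9F
  pattern iZ = fsuc 9F
  pattern iF = fsuc iZ

  -- k exposes stack i: what a program does to that stack can then be stated for any layout of the others.
  record Slot (i : Fin 12) (k : Str → Stacks) : Set where
    constructor mkSlot
    field
      get : ∀ {a} → lookup (k a) i ≡ a
      set : ∀ {a b} → k a [ i ]≔ b ≡ k b

  open Slot

  module _ {i : Fin 12} (k : Str → Stacks) {{s : Slot i k}} where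

    put-slot : ∀ {a as} → Runs (put i a) (k as) (k (a ∷ as)) 1
    put-slot {a} {as} = subst (λ τ → Runs (put i a) (k as) τ 1)
      (trans (cong (λ b → k as [ i ]≔ (a ∷ b)) (get s)) (set s)) run-put

    pop-eq : ∀ as → k as [ i ]≔ tl (lookup (k as) i) ≡ k (tl as)
    pop-eq as = trans (cong (λ b → k as [ i ]≔ tl b) (get s)) (set s)

    exit-slot : ∀ {c f τ n} as → c (hd as) ≡ false → Runs (f (hd as)) (k (tl as)) τ n →
                Runs (loop i c f) (k as) τ (suc n)
    exit-slot {c} {f} {τ} {n} as e r = run-exit (trans (cong (λ b → c (hd b)) (get s)) e)
      (subst₂ (λ p σ → Runs p σ τ n) (cong (λ b → f (hd b)) (sym (get s))) (sym (pop-eq as)) r)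

    again-slot : ∀ {c f τ ρ n m} as → c (hd as) ≡ true → Runs (f (hd as)) (k (tl as)) τ n →
                 Runs (loop i c f) τ ρ m → Runs (loop i c f) (k as) ρ (suc (n + m))
    again-slot {c} {f} {τ} {n = n} as e r r′ = run-again (trans (cong (λ b → c (hd b)) (get s)) e)
      (subst₂ (λ p σ → Runs p σ τ n) (cong (λ b → f (hd b)) (sym (get s))) (sym (pop-eq as)) r) r′


  onI : Digit → Bool
  onI dI = true
  onI _  = false

  some : Digit → Bool
  some ∅ = false
  some _ = true

  case : Fin 12 → (Digit → Prog 12) → Prog 12
  case i = loop i (λ _ → false)

  emit : Fin 12 → Digit → Prog 12
  emit i fzero    = skip
  emit i (fsuc a) = put i a

  moveAll : (i j : Fin 12) → Prog 12
  moveAll i j = loop i some (emit j)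

  clear : Fin 12 → Prog 12
  clear i = loop i some (λ _ → skip)

  moveNumBody : Fin 12 → Digit → Prog 12
  moveNumBody j dI = put j I
  moveNumBody j _  = skip

  moveNum : (i j : Fin 12) → Prog 12
  moveNum i j = loop i onI (moveNumBody j)

  skipNum : Fin 12 → Prog 12
  skipNum i = loop i onI (λ _ → skip)

  copyNumBody : (j l : Fin 12) → Digit → Prog 12
  copyNumBody j l fzero    = skip
  copyNumBody j l (fsuc a) = put j a ⨾ put l a

  copyAll : (i j l : Fin 12) → Prog 12
  copyAll i j l = loop i some (copyNumBody j l)

  ones : ℕ → Str → Str
  ones zero    xs = xs
  ones (suc a) xs = I ∷ ones a xs

  ones-cons : ∀ a xs → ones a (I ∷ xs) ≡ I ∷ ones a xs
  ones-cons zero    xs = refl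
  ones-cons (suc a) xs = cong (I ∷_) (ones-cons a xs)

  ones-+ : ∀ a b xs → ones a (ones b xs) ≡ ones (a + b) xs
  ones-+ zero    b xs = refl
  ones-+ (suc a) b xs = cong (I ∷_) (ones-+ a b xs)

  ones-ʳ++ : ∀ a xs ys → ones a xs ʳ++ ys ≡ xs ʳ++ ones a ys
  ones-ʳ++ zero    xs ys = refl
  ones-ʳ++ (suc a) xs ys = trans (ones-ʳ++ a xs (I ∷ ys)) (cong (xs ʳ++_) (ones-cons a ys))

  length-ones : ∀ a → length (ones a []) ≡ a
  length-ones zero    = refl
  length-ones (suc a) = cong suc (length-ones a)

  reverse-twice : ∀ (xs : Str) → (xs ʳ++ []) ʳ++ [] ≡ xs
  reverse-twice xs = trans (ʳ++-ʳ++ xs) (++-identityʳ xs)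

  retarget : ∀ {p : Prog 12} {σ τ τ′ n} → τ ≡ τ′ → Runs p σ τ n → Runs p σ τ′ n
  retarget refl r = r

  module _ {i : Fin 12} (k : Str → Stacks) {{s : Slot i k}} where

    skipNum-run : ∀ a {xs} → Runs (skipNum i) (k (ones a (O ∷ xs))) (k xs) (a * 2 + 2)
    skipNum-run zero    = exit-slot k _ refl run-skip
    skipNum-run (suc a) = again-slot k _ refl run-skip (skipNum-run a)

    clear-run : ∀ xs → Runs (clear i) (k xs) (k []) (length xs * 2 + 2)
    clear-run []       = exit-slot k [] refl run-skip
    clear-run (x ∷ xs) = again-slot k (x ∷ xs) refl run-skip (clear-run xs)

  module _ {i j : Fin 12} (k : Str → Str → Stacks)
           {{si : ∀ {b} → Slot i (λ a → k a b)}} {{sj : ∀ {a} → Slot j (λ b → k a b)}} where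

    moveNum-run : ∀ a {xs ys} → Runs (moveNum i j) (k (ones a (O ∷ xs)) ys) (k xs (ones a ys)) (a * 2 + 2)
    moveNum-run zero    {ys = ys} = exit-slot (λ a → k a ys) _ refl run-skip
    moveNum-run (suc a) {xs} {ys} = again-slot (λ a → k a ys) _ refl (put-slot (k _))
      (retarget (cong (k xs) (ones-cons a ys)) (moveNum-run a))

    moveAll-run : ∀ xs {ys} → Runs (moveAll i j) (k xs ys) (k [] (xs ʳ++ ys)) (length xs * 2 + 2)
    moveAll-run []       {ys} = exit-slot (λ a → k a ys) [] refl run-skip
    moveAll-run (x ∷ xs) {ys} = again-slot (λ a → k a ys) (x ∷ xs) refl (put-slot (k _)) (moveAll-run xs)

    moveOnes-run : ∀ a {ys} → Runs (moveAll i j) (k (ones a []) ys) (k [] (ones a ys)) (a * 2 + 2)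
    moveOnes-run a {ys} = retarget (cong (k []) (ones-ʳ++ a [] ys))
      (subst (λ n → Runs (moveAll i j) (k (ones a []) ys) (k [] (ones a [] ʳ++ ys)) (n * 2 + 2)) (length-ones a) (moveAll-run (ones a [])))

  module _ {i j l : Fin 12} (k : Str → Str → Str → Stacks)
           {{si : ∀ {b c} → Slot i (λ a → k a b c)}} {{sj : ∀ {a c} → Slot j (λ b → k a b c)}}
           {{sl : ∀ {a b} → Slot l (λ c → k a b c)}} where

    copyOnes-run : ∀ a {ys zs} → Runs (copyAll i j l) (k (ones a []) ys zs) (k [] (ones a ys) (ones a zs)) (a * 3 + 2)
    copyOnes-run zero    {ys} {zs} = exit-slot (λ a → k a ys zs) [] refl run-skip
    copyOnes-run (suc a) {ys} {zs} = again-slot (λ a → k a ys zs) _ refl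
      (put-slot (λ b → k _ b zs) then put-slot (λ c → k _ _ c))
      (retarget (cong₂ (k []) (ones-cons a ys) (ones-cons a zs)) (copyOnes-run a))

  sgn : ℕ → ℕ
  sgn zero    = 0
  sgn (suc _) = 1

  -- Vanishes exactly for equal arguments. It is asymmetric because it is what the comparison loop
  -- can see: the surplus of `a` is met unit by unit, while a surplus of `u` shows only as a
  -- nonempty remainder and earns a single mark.
  gap : ℕ → ℕ → ℕ
  gap a u = sgn (u ∸ a) + (a ∸ u)

  gap≡0 : ∀ a u → gap a u ≡ 0 → a ≡ u
  gap≡0 zero    zero    _ = refl
  gap≡0 (suc a) (suc u) e = cong suc (gap≡0 a u e)

  gap-refl : ∀ a → gap a a ≡ 0
  gap-refl zero    = refl
  gap-refl (suc a) = gap-refl a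

  gap≤ : ∀ a u → gap a u ≤ suc a
  gap≤ a u = +-mono-≤ (sgn≤1 (u ∸ a)) (m∸n≤m a u)
    where
    sgn≤1 : ∀ n → sgn n ≤ 1
    sgn≤1 zero    = z≤n
    sgn≤1 (suc _) = ≤-refl

  matchOne : (r w n : Fin 12) → Digit → Prog 12
  matchOne r w n dI = put w I
  matchOne r w n _  = put n I

  compareBody : (j r w n : Fin 12) → Digit → Prog 12
  compareBody j r w n dI = put j I ⨾ case r (matchOne r w n)
  compareBody j r w n dO = put j O
  compareBody j r w n _  = skip

  leftover : (r n : Fin 12) → Digit → Prog 12
  leftover r n dI = put r I ⨾ put n I
  leftover r n _  = skip

  -- While the number a moves from i to j, n receives gap a u, where r holds u; w is scratch.
  compareNum : (i j r w n : Fin 12) → Prog 12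
  compareNum i j r w n = loop i onI (compareBody j r w n) ⨾ case r (leftover r n) ⨾ moveAll w r

  module _ {i j r w n : Fin 12} (k : Str → Str → Str → Str → Str → Stacks)
           {{si : ∀ {b c d e} → Slot i (λ a → k a b c d e)}} {{sj : ∀ {a c d e} → Slot j (λ b → k a b c d e)}}
           {{sr : ∀ {a b d e} → Slot r (λ c → k a b c d e)}} {{sw : ∀ {a b c e} → Slot w (λ d → k a b c d e)}}
           {{sn : ∀ {a b c d} → Slot n (λ e → k a b c d e)}} where

    compare-empty : ∀ a {xs ys ws ns} →
      Runs (loop i onI (compareBody j r w n)) (k (ones a (O ∷ xs)) ys [] ws ns)
           (k xs (O ∷ ones a ys) [] ws (ones a ns)) (a * 4 + 2)
    compare-empty zero {xs} {ys} {ws} {ns} =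
      exit-slot (λ a → k a ys [] ws ns) _ refl (put-slot (λ b → k xs b [] ws ns))
    compare-empty (suc a) {xs} {ys} {ws} {ns} = again-slot (λ a → k a ys [] ws ns) _ refl
      (put-slot (λ b → k _ b [] ws ns) then exit-slot (λ c → k _ _ c ws ns) [] refl (put-slot (λ e → k _ _ [] ws e)))
      (retarget (cong₂ (λ b e → k xs (O ∷ b) [] ws e) (ones-cons a ys) (ones-cons a ns)) (compare-empty a))

    compare-loop : ∀ a u {xs ys ws ns} →
      Runs (loop i onI (compareBody j r w n)) (k (ones a (O ∷ xs)) ys (ones u []) ws ns)
           (k xs (O ∷ ones a ys) (ones (u ∸ a) []) (ones (a ⊓ u) ws) (ones (a ∸ u) ns)) (a * 4 + 2)
    compare-loop zero zero    {ys = ys} {ws} {ns} =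
      exit-slot (λ a → k a ys [] ws ns) _ refl (put-slot (λ b → k _ b [] ws ns))
    compare-loop zero (suc u) {ys = ys} {ws} {ns} =
      exit-slot (λ a → k a ys (ones (suc u) []) ws ns) _ refl (put-slot (λ b → k _ b _ ws ns))
    compare-loop (suc a) zero = compare-empty (suc a)
    compare-loop (suc a) (suc u) {xs} {ys} {ws} {ns} = again-slot (λ a → k a ys _ ws ns) _ refl
      (put-slot (λ b → k _ b _ ws ns) then exit-slot (λ c → k _ _ c ws ns) (ones (suc u) []) refl (put-slot (λ d → k _ _ _ d ns)))
      (retarget (cong₂ (λ b d → k xs (O ∷ b) _ d _) (ones-cons a ys) (ones-cons (a ⊓ u) ws)) (compare-loop a u))

    leftover-run : ∀ u d {xs ys ws} →
      Runs (case r (leftover r n)) (k xs ys (ones u []) ws (ones d [])) (k xs ys (ones u []) ws (ones (sgn u + d) [])) 3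
    leftover-run zero    d {xs} {ys} {ws} = weaken (s≤s (s≤s z≤n)) (exit-slot (λ c → k xs ys c ws _) [] refl run-skip)
    leftover-run (suc u) d {xs} {ys} {ws} = exit-slot (λ c → k xs ys c ws _) (ones (suc u) []) refl
      (put-slot (λ c → k xs ys c ws _) then put-slot (λ e → k xs ys _ ws e))

    compare-run : ∀ a u {xs ys} →
      Runs (compareNum i j r w n) (k (ones a (O ∷ xs)) ys (ones u []) [] [])
           (k xs (O ∷ ones a ys) (ones u []) [] (ones (gap a u) [])) (a * 6 + 7)
    compare-run a u {xs} {ys} = retarget (cong (λ c → k xs (O ∷ ones a ys) c [] (ones (gap a u) [])) (trans (ones-+ (a ⊓ u) (u ∸ a) []) (cong (λ m → ones m []) (m⊓n+n∸m≡n a u))))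
      (weaken (cost a u) (compare-loop a u then leftover-run (u ∸ a) (a ∸ u) then
        moveOnes-run (λ d c → k xs (O ∷ ones a ys) c d (ones (gap a u) [])) (a ⊓ u)))
      where
      cost : ∀ a u → a * 4 + 2 + (3 + ((a ⊓ u) * 2 + 2)) ≤ a * 6 + 7
      cost a u = ≤-trans (+-monoʳ-≤ (a * 4 + 2) (+-monoʳ-≤ 3 (+-monoˡ-≤ 2 (*-monoˡ-≤ 2 (m⊓n≤m a u))))) (≤-reflexive (eq a))
        where
        eq : ∀ a → a * 4 + 2 + (3 + (a * 2 + 2)) ≡ a * 6 + 7
        eq = solve-∀

  instance
    ≡-refl : ∀ {A : Set} {a : A} → a ≡ a
    ≡-refl = refl

  instance
    -- For a layout given by `st` both equations hold by computation, so instance search closes them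
    -- with `≡-refl` and no slot has to be written down.
    slot : ∀ {i k} → {{∀ {a} → lookup (k a) i ≡ a}} → {{∀ {a b} → k a [ i ]≔ b ≡ k b}} → Slot i k
    slot {{g}} {{s}} = mkSlot g s

open Routines

-- Testing whether a list of edges is a function

module Consistency where

  peekBody : Fin 12 → Prog 12 → Digit → Prog 12
  peekBody i p fzero    = skip
  peekBody i p (fsuc a) = put i a ⨾ p

  -- The only test of a stack is a pop, so the body first restores the popped symbol. It works on
  -- lists of numbers because the delimiter makes even the number 0 a nonempty string.
  while : Fin 12 → Prog 12 → Prog 12
  while i p = loop i some (peekBody i p)

  ones-nonempty : ∀ a xs → ∃ λ y → ∃ λ ys → ones a (O ∷ xs) ≡ y ∷ ys
  ones-nonempty zero    xs = _ , _ , refl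
  ones-nonempty (suc a) xs = _ , _ , refl

  module _ {i : Fin 12} (k : Str → Stacks) {{s : Slot i k}} {p : Prog 12} where

    while-exit : Runs (while i p) (k []) (k []) 2
    while-exit = exit-slot k {{s}} [] refl run-skip

    while-again : ∀ a {xs τ ρ n m} → Runs p (k (ones a (O ∷ xs))) τ n → Runs (while i p) τ ρ m →
                  Runs (while i p) (k (ones a (O ∷ xs))) ρ (2 + n + m)
    while-again a {xs} {τ} {ρ} {n} {m} r r′ with ones a (O ∷ xs) | ones-nonempty a xs
    ... | .(y ∷ ys) | y , ys , refl = again-slot k {{s}} (y ∷ ys) refl (put-slot k {{s}} then r) r′

  -- `p` is the gap of two successors and `q` the gap of their vertices: a clash is an equal vertex
  -- with unequal successors.
  clash : (p q : ℕ) → ℕ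
  clash p zero    = sgn p
  clash p (suc _) = 0

  clashBody₀ : Digit → Prog 12
  clashBody₀ ∅ = skip
  clashBody₀ _ = clear iP ⨾ put iF I

  clashBody : Digit → Prog 12
  clashBody ∅ = case iP clashBody₀
  clashBody _ = clear iQ ⨾ clear iP

  -- The list in x consists of pairs (successor, vertex); u and v hold such a pair, and f receives a mark
  -- for every pair of the list with the same vertex but another successor.
  scanBody : Prog 12
  scanBody = compareNum iX iC iU iW iP ⨾ compareNum iX iC iV iW iQ ⨾ case iQ clashBody

  scan : Prog 12
  scan = while iX scanBody ⨾ moveAll iC iX

  check : Prog 12
  check = while iX (moveNum iX iU ⨾ moveNum iX iV ⨾ scan ⨾ clear iU ⨾ clear iV)

  -- One bound for vertex numbers and list lengths alike. The step counts below mention `B` but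
  -- never `n`, which later lets them be treated as polynomials in `B`.
  module Bounded (B n : ℕ) (n≤B : n ≤ B) where

    bounded : (a : Fin n) → toℕ a ≤ B
    bounded a = ≤-trans (toℕ≤n a) n≤B

    lin : ℕ → ℕ → ℕ
    lin c d = B * c + d

    lin-weaken : ∀ {p : Prog 12} {σ τ c d} (a : Fin n) → Runs p σ τ (toℕ a * c + d) → Runs p σ τ (lin c d)
    lin-weaken {c = c} {d} a = weaken (+-monoˡ-≤ d (*-monoˡ-≤ c (bounded a)))

    num : Fin n → Str → Str
    num a xs = ones (toℕ a) (O ∷ xs)

    Pairs : Set
    Pairs = List (Fin n × Fin n)

    pairs : Pairs → Str
    pairs []             = []
    pairs ((h , t) ∷ es) = num h (num t (pairs es))

    clashes : (u v : Fin n) → Pairs → ℕ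
    clashes u v []             = 0
    clashes u v ((h , t) ∷ es) = clashes u v es + clash (gap (toℕ h) (toℕ u)) (gap (toℕ t) (toℕ v))

    allClashes : Pairs → ℕ
    allClashes []             = 0
    allClashes ((u , v) ∷ es) = allClashes es + clashes u v es

    clearOnes : ∀ {i} (k : Str → Stacks) {{s : Slot i k}} {a} → a ≤ B → Runs (clear i) (k (ones a [])) (k []) (lin 2 2)
    clearOnes k {{s}} {a} le = weaken (+-monoˡ-≤ 2 (*-monoˡ-≤ 2 (≤-trans (≤-reflexive (length-ones a)) le)))
      (clear-run k {{s}} (ones a []))

    clash-run : ∀ p q → p ≤ suc B → q ≤ suc B → ∀ {x c v t r d u w z f} →
      Runs (case iQ clashBody) (st x c v t r d u w (ones p []) (ones q []) z f)
                               (st x c v t r d u w [] [] z (ones (clash p q) f)) (lin 4 8)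
    clash-run zero zero _ _ {x} {c} {v} {t} {r} {d} {u} {w} {z} {f} = weaken (≤-trans 3≤8 (m≤n+m 8 (B * 4)))
      (exit-slot (λ q → st x c v t r d u w [] q z f) [] refl (exit-slot (λ p → st x c v t r d u w p [] z f) [] refl run-skip))
      where
      3≤8 : 3 ≤ 8
      3≤8 = s≤s (s≤s (s≤s z≤n))
    clash-run (suc p) zero (s≤s le) _ {x} {c} {v} {t} {r} {d} {u} {w} {z} {f} = weaken (cost B)
      (exit-slot (λ q → st x c v t r d u w (ones (suc p) []) q z f) [] refl
        (exit-slot (λ p → st x c v t r d u w p [] z f) (ones (suc p) []) refl
          (clearOnes (λ p → st x c v t r d u w p [] z f) le then put-slot (λ f → st x c v t r d u w [] [] z f))))
      where
      cost : ∀ B → 2 + (B * 2 + 2 + 1) ≤ B * 4 + 8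
      cost B = ≤-trans (≤-reflexive (eq B)) (+-mono-≤ (*-monoʳ-≤ B 2≤4) 5≤8)
        where
        eq : ∀ B → 2 + (B * 2 + 2 + 1) ≡ B * 2 + 5
        eq = solve-∀
        2≤4 : 2 ≤ 4
        2≤4 = s≤s (s≤s z≤n)
        5≤8 : 5 ≤ 8
        5≤8 = s≤s (s≤s (s≤s (s≤s (s≤s z≤n))))
    clash-run p (suc q) le (s≤s le′) {x} {c} {v} {t} {r} {d} {u} {w} {z} {f} = weaken (≤-reflexive (eq B))
      (exit-slot (λ q → st x c v t r d u w (ones p []) q z f) (ones (suc q) []) refl
        (clearOnes (λ q → st x c v t r d u w (ones p []) q z f) le′ then
         weaken (cost p le) (clear-run (λ p → st x c v t r d u w p [] z f) (ones p []))))
      where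
      cost : ∀ p → p ≤ suc B → length (ones p []) * 2 + 2 ≤ B * 2 + 5
      cost p le = ≤-trans (+-monoˡ-≤ 2 (*-monoˡ-≤ 2 (≤-trans (≤-reflexive (length-ones p)) le)))
        (≤-trans (≤-reflexive (shift B)) (+-monoʳ-≤ (B * 2) (n≤1+n 4)))
        where
        shift : ∀ B → suc B * 2 + 2 ≡ B * 2 + 4
        shift = solve-∀
      eq : ∀ B → suc (B * 2 + 2 + (B * 2 + 5)) ≡ B * 4 + 8
      eq = solve-∀

    gap-bounded : (a u : Fin n) → gap (toℕ a) (toℕ u) ≤ suc B
    gap-bounded a u = ≤-trans (gap≤ (toℕ a) (toℕ u)) (s≤s (bounded a))

    scanBody-run : ∀ (u v h t : Fin n) {x c s r d z f} →
      Runs scanBody (st (num h (num t x)) c (ones (toℕ v) []) s r d (ones (toℕ u) []) [] [] [] z f)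
        (st x (O ∷ ones (toℕ t) (O ∷ ones (toℕ h) c)) (ones (toℕ v) []) s r d (ones (toℕ u) []) [] [] [] z
            (ones (clash (gap (toℕ h) (toℕ u)) (gap (toℕ t) (toℕ v))) f)) (lin 6 7 + (lin 6 7 + lin 4 8))
    scanBody-run u v h t {x} {c} {s} {r} {d} {z} {f} =
      lin-weaken h (compare-run (λ x c u w p → st x c (ones (toℕ v) []) s r d u w p [] z f) (toℕ h) (toℕ u)) then
      lin-weaken t (compare-run (λ x c v w q → st x c v s r d (ones (toℕ u) []) w (ones (gap (toℕ h) (toℕ u)) []) q z f) (toℕ t) (toℕ v)) then
      clash-run _ _ (gap-bounded h u) (gap-bounded t v)

    cScanBody cScan cCheckBody cCheck : ℕ
    cScanBody = lin 6 7 + (lin 6 7 + lin 4 8)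
    cScan = lin (2 + cScanBody) 2 + (B * (lin 1 1 + lin 1 1) * 2 + 2)
    cCheckBody = lin 2 2 + (lin 2 2 + (cScan + (lin 2 2 + lin 2 2)))
    cCheck = lin (2 + cCheckBody) 2

    scan-loop : ∀ u v es {c s r d z f} →
      Runs (while iX scanBody) (st (pairs es) c (ones (toℕ v) []) s r d (ones (toℕ u) []) [] [] [] z f)
        (st [] (pairs es ʳ++ c) (ones (toℕ v) []) s r d (ones (toℕ u) []) [] [] [] z (ones (clashes u v es) f))
        (length es * (2 + cScanBody) + 2)
    scan-loop u v [] {c} {s} {r} {d} {z} {f} =
      while-exit (λ x → st x c (ones (toℕ v) []) s r d (ones (toℕ u) []) [] [] [] z f)
    scan-loop u v ((h , t) ∷ es) {c} {s} {r} {d} {z} {f} =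
      weaken (≤-reflexive (sym (+-assoc (2 + cScanBody) (length es * (2 + cScanBody)) 2)))
      (while-again (λ x → st x c (ones (toℕ v) []) s r d (ones (toℕ u) []) [] [] [] z f) (toℕ h) (scanBody-run u v h t)
      (retarget (cong₂ (λ c f → st [] c (ones (toℕ v) []) s r d (ones (toℕ u) []) [] [] [] z f)
         (sym (trans (ones-ʳ++ (toℕ h) _ c) (ones-ʳ++ (toℕ t) _ _)))
         (ones-+ (clashes u v es) _ f))
       (scan-loop u v es)))

    length-ones-∷ : ∀ a (xs : Str) → length (ones a xs) ≡ a + length xs
    length-ones-∷ zero    xs = refl
    length-ones-∷ (suc a) xs = cong suc (length-ones-∷ a xs)

    length-num : ∀ a xs → length (num a xs) ≤ lin 1 1 + length xs
    length-num a xs = ≤-trans (≤-reflexive (trans (length-ones-∷ (toℕ a) _) (+-suc (toℕ a) _)))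
      (≤-trans (s≤s (+-monoˡ-≤ (length xs) (bounded a))) (≤-reflexive (eq B (length xs))))
      where
      eq : ∀ B l → suc (B + l) ≡ B * 1 + 1 + l
      eq = solve-∀

    length-pairs : ∀ es → length (pairs es) ≤ length es * (lin 1 1 + lin 1 1)
    length-pairs []             = z≤n
    length-pairs ((h , t) ∷ es) = ≤-trans (length-num h _) (≤-trans (+-monoʳ-≤ (lin 1 1)
      (≤-trans (length-num t _) (+-monoʳ-≤ (lin 1 1) (length-pairs es)))) (≤-reflexive (sym (+-assoc (lin 1 1) (lin 1 1) _))))

    scan-run : ∀ u v es → length es ≤ B → ∀ {s r d z f} →
      Runs scan (st (pairs es) [] (ones (toℕ v) []) s r d (ones (toℕ u) []) [] [] [] z f)
        (st (pairs es) [] (ones (toℕ v) []) s r d (ones (toℕ u) []) [] [] [] z (ones (clashes u v es) f)) cScan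
    scan-run u v es le {s} {r} {d} {z} {f} =
      weaken (+-monoˡ-≤ 2 (*-monoˡ-≤ (2 + cScanBody) le)) (scan-loop u v es) then
      retarget (cong (λ x → st x [] (ones (toℕ v) []) s r d (ones (toℕ u) []) [] [] [] z (ones (clashes u v es) f)) (reverse-twice (pairs es)))
        (weaken (+-monoˡ-≤ 2 (*-monoˡ-≤ 2 moved))
          (moveAll-run (λ c x → st x c (ones (toℕ v) []) s r d (ones (toℕ u) []) [] [] [] z _) (pairs es ʳ++ [])))
      where
      moved : length (pairs es ʳ++ []) ≤ B * (lin 1 1 + lin 1 1)
      moved = ≤-trans (≤-reflexive (trans (length-ʳ++ (pairs es)) (+-identityʳ _)))
        (≤-trans (length-pairs es) (*-monoˡ-≤ (lin 1 1 + lin 1 1) le))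

    check-loop : ∀ es → length es ≤ B → ∀ {s r d z f} →
      Runs check (st (pairs es) [] [] s r d [] [] [] [] z f)
        (st [] [] [] s r d [] [] [] [] z (ones (allClashes es) f)) (length es * (2 + cCheckBody) + 2)
    check-loop [] le {s} {r} {d} {z} {f} = while-exit (λ x → st x [] [] s r d [] [] [] [] z f)
    check-loop ((u , v) ∷ es) le {s} {r} {d} {z} {f} =
      weaken (≤-reflexive (sym (+-assoc (2 + cCheckBody) (length es * (2 + cCheckBody)) 2)))
      (while-again (λ x → st x [] [] s r d [] [] [] [] z f) (toℕ u)
        (lin-weaken u (moveNum-run (λ x u → st x [] [] s r d u [] [] [] z f) (toℕ u)) then
         lin-weaken v (moveNum-run (λ x v → st x [] v s r d (ones (toℕ u) []) [] [] [] z f) (toℕ v)) then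
         scan-run u v es short then
         clearOnes (λ u → st (pairs es) [] (ones (toℕ v) []) s r d u [] [] [] z _) (bounded u) then
         clearOnes (λ v → st (pairs es) [] v s r d [] [] [] [] z _) (bounded v))
        (retarget (cong (st [] [] [] s r d [] [] [] [] z) (ones-+ (allClashes es) (clashes u v es) f)) (check-loop es short)))
      where
      short : length es ≤ B
      short = ≤-trans (n≤1+n _) le

    check-run : ∀ es → length es ≤ B → ∀ {s r d z f} →
      Runs check (st (pairs es) [] [] s r d [] [] [] [] z f)
        (st [] [] [] s r d [] [] [] [] z (ones (allClashes es) f)) cCheck
    check-run es le = weaken (+-monoˡ-≤ 2 (*-monoˡ-≤ (2 + cCheckBody) le)) (check-loop es le)

    clash≤1 : ∀ p q → clash p q ≤ 1
    clash≤1 zero    zero    = z≤n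
    clash≤1 (suc p) zero    = ≤-refl
    clash≤1 p       (suc q) = z≤n

    clashes≤ : ∀ u v es → clashes u v es ≤ length es
    clashes≤ u v []             = z≤n
    clashes≤ u v ((h , t) ∷ es) = ≤-trans (+-mono-≤ (clashes≤ u v es) (clash≤1 (gap (toℕ h) (toℕ u)) (gap (toℕ t) (toℕ v)))) (≤-reflexive (+-comm _ 1))

    -- The marks of a failed candidate have to be erased before the next one, and this bounds the
    -- time for it.
    allClashes≤ : ∀ es → length es ≤ B → allClashes es ≤ length es * B
    allClashes≤ []             le = z≤n
    allClashes≤ ((u , v) ∷ es) le = ≤-trans (+-mono-≤ (allClashes≤ es (≤-trans (n≤1+n _) le))
      (≤-trans (clashes≤ u v es) (≤-trans (n≤1+n _) le))) (≤-reflexive (+-comm _ B))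

open Consistency

-- Running through the candidates with a binary counter

module CandidateSearch where

  -- The delimiter comes first because transferring the string to another stack reverses it, which
  -- yields the format `ones a (O ∷ xs)` read by `moveNum` and `compareNum`.
  rnum : ℕ → Str → Str
  rnum a xs = O ∷ ones a xs

  -- Stack p holds the mode of the filter: empty while symbols are copied to x, a single mark while
  -- they are dropped. The test pops the mark, so the second clause puts it back.
  keepBody : Letter → Digit → Prog 12
  keepBody a ∅ = put iX a
  keepBody a _ = put iP I

  filterBody : Digit → Prog 12
  filterBody ∅    = skip
  filterBody dO   = put iR O ⨾ case iP (keepBody O)
  filterBody dI   = put iR I ⨾ case iP (keepBody I)
  filterBody dFix = clear iP ⨾ put iR Fix
  filterBody dOn  = clear iP ⨾ put iR On
  filterBody dOff = clear iP ⨾ put iP I ⨾ put iR Off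

  filterLoop : Prog 12
  filterLoop = loop iD some filterBody

  select : Prog 12
  select = filterLoop ⨾ clear iP ⨾ moveAll iR iD

  -- Binary increment: On flags turn Off until an Off flag can turn On; only then z is marked.
  incAgain : Digit → Bool
  incAgain ∅    = false
  incAgain dOff = false
  incAgain _    = true

  incBody : Digit → Prog 12
  incBody ∅    = skip
  incBody dO   = put iR O
  incBody dI   = put iR I
  incBody dFix = put iR Fix
  incBody dOn  = put iR Off
  incBody dOff = put iR On ⨾ put iZ I

  increment : Prog 12
  increment = loop iD incAgain incBody ⨾ moveAll iD iR ⨾ moveAll iR iD

  verdict : Digit → Prog 12
  verdict ∅ = put iX I
  verdict _ = clear iF ⨾ increment

  candidate : Digit → Prog 12
  candidate ∅ = skip
  candidate _ = select ⨾ check ⨾ case iF verdict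

  search : Prog 12
  search = put iZ I ⨾ loop iZ some candidate

  -- A segment is a path vertex that every candidate keeps, or one that the candidate keeps iff its flag is set.
  data Seg (A : Set) : Set where
    fix : A → Seg A
    opt : Bool → A → Seg A

  flag : Bool → Letter
  flag true  = On
  flag false = Off

  inc : ∀ {A} → List (Seg A) → Bool × List (Seg A)
  inc []                = false , []
  inc (fix v ∷ L)       = let (b , L′) = inc L in b , fix v ∷ L′
  inc (opt true v ∷ L)  = let (b , L′) = inc L in b , opt false v ∷ L′
  inc (opt false v ∷ L) = true , opt true v ∷ L

  data Same {A : Set} : List (Seg A) → List (Seg A) → Set where
    []  : Same [] []
    fix : ∀ {v L L′} → Same L L′ → Same (fix v ∷ L) (fix v ∷ L′)
    opt : ∀ {b b′ v L L′} → Same L L′ → Same (opt b v ∷ L) (opt b′ v ∷ L′)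

  -- The binary number formed by the complemented flags, least significant first: the count of
  -- increments left before overflow.
  remaining : ∀ {A} → List (Seg A) → ℕ
  remaining []                = 0
  remaining (fix v ∷ L)       = remaining L
  remaining (opt true v ∷ L)  = remaining L + remaining L
  remaining (opt false v ∷ L) = suc (remaining L + remaining L)

  Same-refl : ∀ {A} (L : List (Seg A)) → Same L L
  Same-refl []            = []
  Same-refl (fix v ∷ L)   = fix (Same-refl L)
  Same-refl (opt b v ∷ L) = opt (Same-refl L)

  Same-inc : ∀ {A} {L₀ : List (Seg A)} L → Same L₀ L → Same L₀ (proj₂ (inc L))
  Same-inc []                []       = []
  Same-inc (fix v ∷ L)       (fix s)  = fix (Same-inc L s)
  Same-inc (opt true v ∷ L)  (opt s)  = opt (Same-inc L s)
  Same-inc (opt false v ∷ L) (opt s)  = opt s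

  inc-overflow : ∀ {A} (L : List (Seg A)) → proj₁ (inc L) ≡ false → remaining L ≡ 0
  inc-overflow []               e = refl
  inc-overflow (fix v ∷ L)      e = inc-overflow L e
  inc-overflow (opt true v ∷ L) e rewrite inc-overflow L e = refl

  inc-remaining : ∀ {A} (L : List (Seg A)) → proj₁ (inc L) ≡ true → remaining L ≡ suc (remaining (proj₂ (inc L)))
  inc-remaining (fix v ∷ L)       e = inc-remaining L e
  inc-remaining (opt true v ∷ L)  e rewrite inc-remaining L e = cong suc (+-suc _ _)
  inc-remaining (opt false v ∷ L) e = refl

  double-injective : ∀ m n → m + m ≡ n + n → m ≡ n
  double-injective zero    zero    e = refl
  double-injective (suc m) (suc n) e = cong suc (double-injective m n
    (suc-injective (trans (sym (+-suc m m)) (trans (suc-injective e) (+-suc n n)))))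

  odd≢even : ∀ m n → suc (m + m) ≢ n + n
  odd≢even zero    (suc n) e with trans e (cong suc (+-suc n n))
  ... | ()
  odd≢even (suc m) (suc n) e = odd≢even m n (trans (sym (+-suc m m)) (suc-injective (trans (suc-injective e) (+-suc n n))))

  -- Parity reveals the first flag and halving the rest. Hence each counter value belongs to exactly
  -- one candidate, and counting down misses none.
  remaining-injective : ∀ {A} {L L′ : List (Seg A)} → Same L L′ → remaining L ≡ remaining L′ → L ≡ L′
  remaining-injective []      e = refl
  remaining-injective (fix s) e = cong (_ ∷_) (remaining-injective s e)
  remaining-injective {L = opt true _ ∷ L}  {opt true _ ∷ L′}  (opt s) e =
    cong (_ ∷_) (remaining-injective s (double-injective (remaining L) (remaining L′) e))
  remaining-injective {L = opt false _ ∷ L} {opt false _ ∷ L′} (opt s) e =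
    cong (_ ∷_) (remaining-injective s (double-injective (remaining L) (remaining L′) (suc-injective e)))
  remaining-injective {L = opt true _ ∷ L}  {opt false _ ∷ L′} (opt s) e =
    contradiction (sym e) (odd≢even (remaining L′) (remaining L))
  remaining-injective {L = opt false _ ∷ L} {opt true _ ∷ L′}  (opt s) e =
    contradiction e (odd≢even (remaining L) (remaining L′))

  Same-trans : ∀ {A} {L L′ L″ : List (Seg A)} → Same L L′ → Same L L″ → Same L′ L″
  Same-trans []      []      = []
  Same-trans (fix s) (fix t) = fix (Same-trans s t)
  Same-trans (opt s) (opt t) = opt (Same-trans s t)

  module Search (B n : ℕ) (n≤B : n ≤ B) where

    open Bounded B n n≤B

    Segs : Set
    Segs = List (Seg (Fin n))

    -- An optional vertex is written twice: it is the head of the edge entering it and the tail of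
    -- the edge leaving it. Keeping or dropping both copies makes the surviving sequence a list of
    -- edges again, without any further bookkeeping.
    flat : Segs → Str
    flat []            = []
    flat (fix v ∷ L)   = Fix ∷ rnum (toℕ v) (flat L)
    flat (opt b v ∷ L) = flag b ∷ rnum (toℕ v) (rnum (toℕ v) (flat L))

    kept : Segs → List (Fin n)
    kept []                = []
    kept (fix v ∷ L)       = v ∷ kept L
    kept (opt true v ∷ L)  = v ∷ v ∷ kept L
    kept (opt false v ∷ L) = kept L

    rnums : List (Fin n) → Str
    rnums []       = []
    rnums (v ∷ vs) = rnum (toℕ v) (rnums vs)

    module _ {s z f : Str} where

      fst : (x r d p : Str) → Stacks
      fst x r d p = st x [] [] s r d [] [] p [] z f

      keepNum : ∀ a {x r d τ N} → Runs filterLoop (fst (ones a x) (ones a r) d []) τ N →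
                Runs filterLoop (fst x r (ones a d) []) τ (a * 4 + N)
      keepNum zero    k = k
      keepNum (suc a) {x} {r} {d} {τ} {N} k = again-slot (λ d → fst x r d []) (I ∷ ones a d) refl
        (put-slot (λ r → fst x r (ones a d) []) then
         exit-slot (λ p → fst x (I ∷ r) (ones a d) p) [] refl (put-slot (λ x → fst x (I ∷ r) (ones a d) [])))
        (keepNum a (subst₂ (λ x r → Runs filterLoop (fst x r d []) τ N) (sym (ones-cons a x)) (sym (ones-cons a r)) k))

      keepRnum : ∀ a {x r d τ N} → Runs filterLoop (fst (ones a (O ∷ x)) (ones a (O ∷ r)) d []) τ N →
                 Runs filterLoop (fst x r (rnum a d) []) τ (4 + (a * 4 + N))
      keepRnum a {x} {r} {d} k = again-slot (λ d → fst x r d []) (O ∷ ones a d) refl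
        (put-slot (λ r → fst x r (ones a d) []) then
         exit-slot (λ p → fst x (O ∷ r) (ones a d) p) [] refl (put-slot (λ x → fst x (O ∷ r) (ones a d) [])))
        (keepNum a k)

      dropNum : ∀ a {x r d τ N} → Runs filterLoop (fst x (ones a r) d (I ∷ [])) τ N →
                Runs filterLoop (fst x r (ones a d) (I ∷ [])) τ (a * 4 + N)
      dropNum zero    k = k
      dropNum (suc a) {x} {r} {d} {τ} {N} k = again-slot (λ d → fst x r d (I ∷ [])) (I ∷ ones a d) refl
        (put-slot (λ r → fst x r (ones a d) (I ∷ [])) then
         exit-slot (λ p → fst x (I ∷ r) (ones a d) p) (I ∷ []) refl (put-slot (λ p → fst x (I ∷ r) (ones a d) p)))
        (dropNum a (subst (λ r → Runs filterLoop (fst x r d (I ∷ [])) τ N) (sym (ones-cons a r)) k))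

      dropRnum : ∀ a {x r d τ N} → Runs filterLoop (fst x (ones a (O ∷ r)) d (I ∷ [])) τ N →
                 Runs filterLoop (fst x r (rnum a d) (I ∷ [])) τ (4 + (a * 4 + N))
      dropRnum a {x} {r} {d} k = again-slot (λ d → fst x r d (I ∷ [])) (O ∷ ones a d) refl
        (put-slot (λ r → fst x r (ones a d) (I ∷ [])) then
         exit-slot (λ p → fst x (O ∷ r) (ones a d) p) (I ∷ []) refl (put-slot (λ p → fst x (O ∷ r) (ones a d) p)))
        (dropNum a k)

    data Mode : Str → Set where
      keep : Mode []
      drop : Mode (I ∷ [])

    clearMode : ∀ {m s z f x r d} → Mode m → Runs (clear iP) (fst {s} {z} {f} x r d m) (fst {s} {z} {f} x r d []) 4
    clearMode {s = s} {z} {f} {x} {r} {d} keep = weaken (s≤s (s≤s z≤n)) (clear-run (fst {s} {z} {f} x r d) [])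
    clearMode {s = s} {z} {f} {x} {r} {d} drop = clear-run (fst {s} {z} {f} x r d) (I ∷ [])

    cFilterSeg : ℕ
    cFilterSeg = lin 8 15

    filter-loop : ∀ L {s z f x r m} → Mode m → Σ Str λ m′ → Mode m′ ×
      Runs filterLoop (fst {s} {z} {f} x r (flat L) m) (fst {s} {z} {f} (rnums (kept L) ʳ++ x) (flat L ʳ++ r) [] m′)
           (length L * cFilterSeg + 2)
    filter-loop [] {s} {z} {f} {x} {r} {m} md = m , md , exit-slot (λ d → fst {s} {z} {f} x r d m) [] refl run-skip
    filter-loop (fix v ∷ L) {s} {z} {f} {x} {r} {m} md with filter-loop L {s} {z} {f} {ones (toℕ v) (O ∷ x)} {ones (toℕ v) (O ∷ Fix ∷ r)} keep
    ... | m′ , md′ , run = m′ , md′ , weaken (cost (toℕ v) (bounded v) _)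
      (retarget (cong₂ (λ x r → fst {s} {z} {f} x r [] m′) (sym (ones-ʳ++ (toℕ v) _ _)) (sym (ones-ʳ++ (toℕ v) _ _)))
        (again-slot (λ d → fst {s} {z} {f} x r d m) (Fix ∷ rnum (toℕ v) (flat L)) refl
          (clearMode md then put-slot (λ r → fst {s} {z} {f} x r (rnum (toℕ v) (flat L)) []))
          (keepRnum (toℕ v) run)))
      where
      cost : ∀ a → a ≤ B → ∀ N → suc (5 + (4 + (a * 4 + (N + 2)))) ≤ cFilterSeg + N + 2
      cost a le N = ≤-trans (≤-reflexive (eq a N)) (+-monoˡ-≤ 2 (+-monoˡ-≤ N (+-mono-≤ (≤-trans (*-monoˡ-≤ 4 le) (*-monoʳ-≤ B (m≤m+n 4 4))) (m≤m+n 10 5))))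
        where
        eq : ∀ a N → suc (5 + (4 + (a * 4 + (N + 2)))) ≡ a * 4 + 10 + N + 2
        eq = solve-∀
    filter-loop (opt true v ∷ L) {s} {z} {f} {x} {r} {m} md with filter-loop L {s} {z} {f} {ones (toℕ v) (O ∷ ones (toℕ v) (O ∷ x))} {ones (toℕ v) (O ∷ ones (toℕ v) (O ∷ On ∷ r))} keep
    ... | m′ , md′ , run = m′ , md′ , weaken (cost (toℕ v) (bounded v) _)
      (retarget (cong₂ (λ x r → fst {s} {z} {f} x r [] m′)
          (sym (trans (ones-ʳ++ (toℕ v) _ _) (ones-ʳ++ (toℕ v) _ _)))
          (sym (trans (ones-ʳ++ (toℕ v) _ _) (ones-ʳ++ (toℕ v) _ _))))
        (again-slot (λ d → fst {s} {z} {f} x r d m) (On ∷ rnum (toℕ v) (rnum (toℕ v) (flat L))) refl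
          (clearMode md then put-slot (λ r → fst {s} {z} {f} x r (rnum (toℕ v) (rnum (toℕ v) (flat L))) []))
          (keepRnum (toℕ v) (keepRnum (toℕ v) run))))
      where
      cost : ∀ a → a ≤ B → ∀ N → suc (5 + (4 + (a * 4 + (4 + (a * 4 + (N + 2)))))) ≤ cFilterSeg + N + 2
      cost a le N = ≤-trans (≤-reflexive (eq a N)) (+-monoˡ-≤ 2 (+-monoˡ-≤ N (+-mono-≤ (*-monoˡ-≤ 8 le) (m≤m+n 14 1))))
        where
        eq : ∀ a N → suc (5 + (4 + (a * 4 + (4 + (a * 4 + (N + 2)))))) ≡ a * 8 + 14 + N + 2
        eq = solve-∀
    filter-loop (opt false v ∷ L) {s} {z} {f} {x} {r} {m} md with filter-loop L {s} {z} {f} {x} {ones (toℕ v) (O ∷ ones (toℕ v) (O ∷ Off ∷ r))} drop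
    ... | m′ , md′ , run = m′ , md′ , weaken (cost (toℕ v) (bounded v) _)
      (retarget (cong (λ r → fst {s} {z} {f} _ r [] m′)
          (sym (trans (ones-ʳ++ (toℕ v) _ _) (ones-ʳ++ (toℕ v) _ _))))
        (again-slot (λ d → fst {s} {z} {f} x r d m) (Off ∷ rnum (toℕ v) (rnum (toℕ v) (flat L))) refl
          (clearMode md then put-slot (λ p → fst {s} {z} {f} x r (rnum (toℕ v) (rnum (toℕ v) (flat L))) p)
                        then put-slot (λ r → fst {s} {z} {f} x r (rnum (toℕ v) (rnum (toℕ v) (flat L))) (I ∷ [])))
          (dropRnum (toℕ v) (dropRnum (toℕ v) run))))
      where
      cost : ∀ a → a ≤ B → ∀ N → suc (6 + (4 + (a * 4 + (4 + (a * 4 + (N + 2)))))) ≤ cFilterSeg + N + 2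
      cost a le N = ≤-trans (≤-reflexive (eq a N)) (+-monoˡ-≤ 2 (+-monoˡ-≤ N (+-monoˡ-≤ 15 (*-monoˡ-≤ 8 le))))
        where
        eq : ∀ a N → suc (6 + (4 + (a * 4 + (4 + (a * 4 + (N + 2)))))) ≡ a * 8 + 15 + N + 2
        eq = solve-∀

    cMove : ℕ
    cMove = B * lin 2 3 * 2 + 2

    cSelect : ℕ
    cSelect = lin cFilterSeg 2 + (4 + cMove)

    length-rnum : ∀ v xs → length (rnum (toℕ v) xs) ≤ lin 1 1 + length xs
    length-rnum v xs = ≤-trans (s≤s (≤-reflexive (length-ones-∷ (toℕ v) xs)))
      (≤-trans (s≤s (+-monoˡ-≤ (length xs) (bounded v))) (≤-reflexive (eq B (length xs))))
      where
      eq : ∀ B l → suc (B + l) ≡ B * 1 + 1 + l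
      eq = solve-∀

    length-flat : ∀ L → length (flat L) ≤ length L * lin 2 3
    length-flat []            = z≤n
    length-flat (fix v ∷ L)   = ≤-trans (s≤s (length-rnum v _)) (≤-trans (s≤s (+-monoʳ-≤ (lin 1 1) (length-flat L)))
      (+-monoˡ-≤ (length L * lin 2 3) (≤-trans (≤-reflexive (+-comm 1 _)) (≤-trans (≤-reflexive (+-assoc (B * 1) 1 1)) (+-mono-≤ (*-monoʳ-≤ B (n≤1+n 1)) (n≤1+n 2))))))
    length-flat (opt b v ∷ L) = ≤-trans (s≤s (≤-trans (length-rnum v _) (+-monoʳ-≤ (lin 1 1) (≤-trans (length-rnum v _) (+-monoʳ-≤ (lin 1 1) (length-flat L))))))
      (≤-reflexive (eq B (length L * lin 2 3)))
      where
      eq : ∀ B l → suc (B * 1 + 1 + (B * 1 + 1 + l)) ≡ B * 2 + 3 + l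
      eq = solve-∀

    flat≤ : ∀ L → length L ≤ B → length (flat L) ≤ B * lin 2 3
    flat≤ L le = ≤-trans (length-flat L) (*-monoˡ-≤ (lin 2 3) le)

    select-run : ∀ L → length L ≤ B → ∀ {s z f} →
      Runs select (st [] [] [] s [] (flat L) [] [] [] [] z f)
                  (st (rnums (kept L) ʳ++ []) [] [] s [] (flat L) [] [] [] [] z f) cSelect
    select-run L le {s} {z} {f} with filter-loop L {s} {z} {f} {[]} {[]} keep
    ... | m′ , md′ , run =
      weaken (+-monoˡ-≤ 2 (*-monoˡ-≤ cFilterSeg le)) run then clearMode md′ then
      retarget (cong (λ d → st (rnums (kept L) ʳ++ []) [] [] s [] d [] [] [] [] z f) (reverse-twice (flat L)))
        (weaken (+-monoˡ-≤ 2 (*-monoˡ-≤ 2 (≤-trans (≤-reflexive (trans (length-ʳ++ (flat L)) (+-identityʳ _))) (flat≤ L le))))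
          (moveAll-run (λ r d → st (rnums (kept L) ʳ++ []) [] [] s r d [] [] [] [] z f) (flat L ʳ++ [])))

    mark : Bool → Str → Str
    mark true  z = I ∷ z
    mark false z = z

    incLoop : Prog 12
    incLoop = loop iD incAgain incBody

    module _ {s f : Str} where

      ist : (r d z : Str) → Stacks
      ist r d z = st [] [] [] s r d [] [] [] [] z f

      passOnes : ∀ a {r d z τ N} → Runs incLoop (ist (ones a r) d z) τ N → Runs incLoop (ist r (ones a d) z) τ (a * 2 + N)
      passOnes zero    k = k
      passOnes (suc a) {r} {d} {z} {τ} {N} k = again-slot (λ d → ist r d z) (I ∷ ones a d) refl (put-slot (λ r → ist r (ones a d) z))
        (passOnes a (subst (λ r → Runs incLoop (ist r d z) τ N) (sym (ones-cons a r)) k))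

      passRnum : ∀ a {r d z τ N} → Runs incLoop (ist (ones a (O ∷ r)) d z) τ N → Runs incLoop (ist r (rnum a d) z) τ (2 + (a * 2 + N))
      passRnum a {r} {d} {z} k = again-slot (λ d → ist r d z) (O ∷ ones a d) refl (put-slot (λ r → ist r (ones a d) z)) (passOnes a k)

      cIncSeg : ℕ
      cIncSeg = lin 4 6

      -- The loop stops at the first flag it turns on, with the string split between the two stacks;
      -- `same` says that transferring the untouched remainder completes the reversed result.
      record Incremented (L : Segs) (r z : Str) : Set where
        field
          {d′ r′} : Str
          same    : d′ ʳ++ r′ ≡ flat (proj₂ (inc L)) ʳ++ r
          short   : length d′ ≤ length (flat L)
          incRun  : Runs incLoop (ist r (flat L) z) (ist r′ d′ (mark (proj₁ (inc L)) z)) (length L * cIncSeg + 3)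

      inc-loop : ∀ L {r z} → Incremented L r z
      inc-loop [] {r} {z} = record { same = refl ; short = z≤n
        ; incRun = weaken (n≤1+n 2) (exit-slot (λ d → ist r d z) [] refl run-skip) }
      inc-loop (fix v ∷ L) {r} {z} = record
        { same  = trans IH.same (sym (ones-ʳ++ (toℕ v) _ _))
        ; short = ≤-trans IH.short (≤-trans (≤-trans (m≤n+m _ (toℕ v)) (≤-reflexive (sym (length-ones-∷ (toℕ v) _)))) (≤-trans (n≤1+n _) (n≤1+n _)))
        ; incRun = weaken (cost (toℕ v) (bounded v) (length L * cIncSeg))
            (again-slot (λ d → ist r d z) (Fix ∷ rnum (toℕ v) (flat L)) refl (put-slot (λ r → ist r (rnum (toℕ v) (flat L)) z))
              (passRnum (toℕ v) IH.incRun)) }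
        where
        module IH = Incremented (inc-loop L {ones (toℕ v) (O ∷ Fix ∷ r)} {z})
        cost : ∀ a → a ≤ B → ∀ N → suc (1 + (2 + (a * 2 + (N + 3)))) ≤ cIncSeg + N + 3
        cost a le N = ≤-trans (≤-reflexive (eq a N)) (+-monoˡ-≤ 3 (+-monoˡ-≤ N (+-mono-≤ (≤-trans (*-monoˡ-≤ 2 le) (*-monoʳ-≤ B (m≤m+n 2 2))) (m≤m+n 4 2))))
          where
          eq : ∀ a N → suc (1 + (2 + (a * 2 + (N + 3)))) ≡ a * 2 + 4 + N + 3
          eq = solve-∀
      inc-loop (opt true v ∷ L) {r} {z} = record
        { same  = trans IH.same (sym (trans (ones-ʳ++ (toℕ v) _ _) (ones-ʳ++ (toℕ v) _ _)))
        ; short = ≤-trans IH.short (≤-trans (longer (flat L)) (≤-trans (longer (rnum (toℕ v) (flat L))) (n≤1+n _)))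
        ; incRun = weaken (cost (toℕ v) (bounded v) (length L * cIncSeg))
            (again-slot (λ d → ist r d z) (On ∷ rnum (toℕ v) (rnum (toℕ v) (flat L))) refl (put-slot (λ r → ist r (rnum (toℕ v) (rnum (toℕ v) (flat L))) z))
              (passRnum (toℕ v) (passRnum (toℕ v) IH.incRun))) }
        where
        module IH = Incremented (inc-loop L {ones (toℕ v) (O ∷ ones (toℕ v) (O ∷ Off ∷ r))} {z})
        longer : ∀ xs → length xs ≤ length (rnum (toℕ v) xs)
        longer xs = ≤-trans (≤-trans (m≤n+m _ (toℕ v)) (≤-reflexive (sym (length-ones-∷ (toℕ v) _)))) (n≤1+n _)
        cost : ∀ a → a ≤ B → ∀ N → suc (1 + (2 + (a * 2 + (2 + (a * 2 + (N + 3)))))) ≤ cIncSeg + N + 3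
        cost a le N = ≤-trans (≤-reflexive (eq a N)) (+-monoˡ-≤ 3 (+-monoˡ-≤ N (+-monoˡ-≤ 6 (*-monoˡ-≤ 4 le))))
          where
          eq : ∀ a N → suc (1 + (2 + (a * 2 + (2 + (a * 2 + (N + 3)))))) ≡ a * 4 + 6 + N + 3
          eq = solve-∀
      inc-loop (opt false v ∷ L) {r} {z} = record { same = refl ; short = n≤1+n _
        ; incRun = weaken (m≤n+m 3 _) (exit-slot (λ d → ist r d z) (Off ∷ rnum (toℕ v) (rnum (toℕ v) (flat L))) refl
            (put-slot (λ r → ist r (rnum (toℕ v) (rnum (toℕ v) (flat L))) z) then
             put-slot (λ z → ist (On ∷ r) (rnum (toℕ v) (rnum (toℕ v) (flat L))) z))) }

    length-inc : ∀ (L : Segs) → length (proj₂ (inc L)) ≡ length L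
    length-inc []                = refl
    length-inc (fix v ∷ L)       = cong suc (length-inc L)
    length-inc (opt true v ∷ L)  = cong suc (length-inc L)
    length-inc (opt false v ∷ L) = refl

    cIncrement : ℕ
    cIncrement = lin (lin 4 6) 3 + (cMove + cMove)

    increment-run : ∀ L → length L ≤ B → ∀ {s z f} →
      Runs increment (st [] [] [] s [] (flat L) [] [] [] [] z f)
                     (st [] [] [] s [] (flat (proj₂ (inc L))) [] [] [] [] (mark (proj₁ (inc L)) z) f) cIncrement
    increment-run L le {s} {z} {f} =
      weaken (+-monoˡ-≤ 3 (*-monoˡ-≤ (lin 4 6) le)) X.incRun then
      retarget (cong (λ r → st [] [] [] s r [] [] [] [] [] z′ f) X.same)
        (weaken (+-monoˡ-≤ 2 (*-monoˡ-≤ 2 (≤-trans X.short (flat≤ L le))))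
          (moveAll-run (λ d r → st [] [] [] s r d [] [] [] [] z′ f) X.d′)) then
      retarget (cong (λ d → st [] [] [] s [] d [] [] [] [] z′ f) (reverse-twice (flat L′)))
        (weaken (+-monoˡ-≤ 2 (*-monoˡ-≤ 2 (≤-trans (≤-reflexive (trans (length-ʳ++ (flat L′)) (+-identityʳ _)))
            (flat≤ L′ (≤-trans (≤-reflexive (length-inc L)) le)))))
          (moveAll-run (λ r d → st [] [] [] s r d [] [] [] [] z′ f) (flat L′ ʳ++ [])))
      where
      module X = Incremented {s} {f} (inc-loop L {[]} {z})
      L′ : Segs
      L′ = proj₂ (inc L)
      z′ : Str
      z′ = mark (proj₁ (inc L)) z

    cCandidate : ℕ
    cCandidate = cSelect + (cCheck + suc (B * B * 2 + 2 + cIncrement))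

    data Verdict (p : Prog 12) (σ : Stacks) (N : ℕ) (Yes No : Set) : Set where
      accepts : ∀ {τ} → Runs p σ τ N → answer (hd (lookup τ 0F)) ≡ true → Yes → Verdict p σ N Yes No
      rejects : ∀ {τ} → Runs p σ τ N → answer (hd (lookup τ 0F)) ≡ false → No → Verdict p σ N Yes No

    -- The search needs to know only which pairs the kept vertices spell on stack x; the
    -- graph-theoretic meaning of these pairs is supplied afterwards.
    module _ (L₀ : Segs) (edges : Segs → Pairs)
             (paired : ∀ L → Same L₀ L → rnums (kept L) ʳ++ [] ≡ pairs (edges L))
             (few : ∀ L → Same L₀ L → length (edges L) ≤ B) (small : ∀ L → Same L₀ L → length L ≤ B) where

      sst : Str → Segs → Str → Stacks
      sst s L z = st [] [] [] s [] (flat L) [] [] [] [] z []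

      checked-run : ∀ L → Same L₀ L → ∀ {s τ N} →
        Runs (case iF verdict) (st [] [] [] s [] (flat L) [] [] [] [] [] (ones (allClashes (edges L)) [])) τ N →
        Runs (candidate dI) (sst s L []) τ (cSelect + (cCheck + N))
      checked-run L same {s} r =
        retarget (cong (λ x → st x [] [] s [] (flat L) [] [] [] [] [] []) (paired L same)) (select-run L (small L same)) then
        check-run (edges L) (few L same) then r

      -- Each increment lowers `remaining` by one, so the negative answer covers exactly the
      -- candidates from `L` on.
      Searched : Str → ℕ → Segs → Set
      Searched s m L = Verdict (loop iZ some candidate) (sst s L (I ∷ [])) (suc m * suc cCandidate + 2)
        (∃ λ L′ → Same L₀ L′ × allClashes (edges L′) ≡ 0)
        (∀ L′ → Same L₀ L′ → remaining L′ ≤ remaining L → allClashes (edges L′) ≢ 0)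

      -- The recursive call is the argument `next`, so one case analysis serves both values of `m`
      -- and `search-loop` is structurally recursive.
      search-step : ∀ {s} m → (∀ m′ → m ≡ suc m′ → ∀ L → Same L₀ L → remaining L ≡ m′ → Searched s m′ L) →
                    ∀ L → Same L₀ L → remaining L ≡ m → Searched s m L
      -- The run is abstracted along with its number of marks, so that each branch sees a literally
      -- empty or nonempty stack f.
      search-step {s} m next L same em with allClashes (edges L) in clash | checked-run L same {s}
      ... | zero | run = accepts
        (weaken (+-monoˡ-≤ 2 (m≤m+n (suc cCandidate) (m * suc cCandidate)))
          (again-slot (λ z → sst s L z) (I ∷ []) refl
            (weaken (+-monoʳ-≤ cSelect (+-monoʳ-≤ cCheck (s≤s (≤-trans (s≤s z≤n) (≤-trans (m≤n+m 2 (B * B * 2)) (m≤m+n _ cIncrement))))))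
              (run (exit-slot (λ f → st [] [] [] s [] (flat L) [] [] [] [] [] f) [] refl
                (put-slot (λ x → st x [] [] s [] (flat L) [] [] [] [] [] [])))))
            (exit-slot (λ z → st (I ∷ []) [] [] s [] (flat L) [] [] [] [] z []) [] refl run-skip)))
        refl (L , same , clash)
      ... | suc k | run = next-try (proj₁ (inc L)) refl
        where
        few-clashes : length (ones k []) ≤ B * B
        few-clashes = ≤-trans (≤-reflexive (length-ones k)) (≤-trans (n≤1+n k)
          (≤-trans (≤-reflexive (sym clash)) (≤-trans (allClashes≤ (edges L) (few L same)) (*-monoˡ-≤ B (few L same)))))

        tried : ∀ {z τ N} → z ≡ mark (proj₁ (inc L)) [] → Runs (loop iZ some candidate) (sst s (proj₂ (inc L)) z) τ N →
                Runs (loop iZ some candidate) (sst s L (I ∷ [])) τ (suc cCandidate + N)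
        tried refl r = again-slot (λ z → sst s L z) (I ∷ []) refl
          (run (exit-slot (λ f → st [] [] [] s [] (flat L) [] [] [] [] [] f) (ones (suc k) []) refl
            (weaken (+-monoˡ-≤ 2 (*-monoˡ-≤ 2 few-clashes))
              (clear-run (λ f → st [] [] [] s [] (flat L) [] [] [] [] [] f) (ones k [])) then
             increment-run L (small L same)))) r

        failed : ∀ L′ → Same L₀ L′ → remaining L′ ≡ remaining L → allClashes (edges L′) ≢ 0
        failed L′ same′ e z with remaining-injective (Same-trans same′ same) e
        ... | refl with trans (sym clash) z
        ...   | ()

        all : (∀ L′ → Same L₀ L′ → remaining L′ ≤ remaining (proj₂ (inc L)) → allClashes (edges L′) ≢ 0) →
              proj₁ (inc L) ≡ true → ∀ L′ → Same L₀ L′ → remaining L′ ≤ remaining L → allClashes (edges L′) ≢ 0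
        all below e L′ same′ le with remaining L′ ≤? remaining (proj₂ (inc L))
        ... | yes le′ = below L′ same′ le′
        ... | no ¬le  = failed L′ same′ (≤-antisym le (≤-trans (≤-reflexive (inc-remaining L e)) (≰⇒> ¬le)))

        merge : ∀ m′ → m ≡ suc m′ → proj₁ (inc L) ≡ true → Searched s m′ (proj₂ (inc L)) → Searched s m L
        merge m′ refl e (accepts r a y) = accepts (weaken (≤-reflexive (sym (+-assoc (suc cCandidate) _ 2)))
          (tried (cong (λ b → mark b []) (sym e)) r)) a y
        merge m′ refl e (rejects r a ¬y) = rejects (weaken (≤-reflexive (sym (+-assoc (suc cCandidate) _ 2)))
          (tried (cong (λ b → mark b []) (sym e)) r)) a (all ¬y e)

        next-try : ∀ b → proj₁ (inc L) ≡ b → Searched s m L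
        -- Overflow means that `remaining L` is 0, so `L` was the only candidate left; z stays
        -- unmarked and ends the loop.
        next-try false e = rejects
          (weaken (+-monoˡ-≤ 2 (m≤m+n (suc cCandidate) (m * suc cCandidate)))
            (tried (cong (λ b → mark b []) (sym e))
              (exit-slot (λ z → sst s (proj₂ (inc L)) z) [] refl run-skip)))
          refl
          (λ L′ same′ le → failed L′ same′ (trans (n≤0⇒n≡0 (≤-trans le (≤-reflexive (inc-overflow L e)))) (sym (inc-overflow L e))))
        next-try true e = merge _ em′ e (next _ em′ (proj₂ (inc L)) (Same-inc L same) refl)
          where em′ = trans (sym em) (inc-remaining L e)

      search-loop : ∀ {s} m L → Same L₀ L → remaining L ≡ m → Searched s m L
      search-loop zero    = search-step zero (λ _ ())
      search-loop (suc m) = search-step (suc m) (λ { .m refl → search-loop m })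

open CandidateSearch

-- Reading the instance and marking the sinks

module Loading where

  memberBody : Digit → Prog 12
  memberBody ∅ = put iQ I
  memberBody _ = clear iP

  member : Prog 12
  member = while iT (compareNum iT iC iU iW iP ⨾ case iP memberBody) ⨾ moveAll iC iT

  found : Digit → Prog 12
  found ∅ = clear iU
  found _ = clear iQ ⨾ copyAll iU iD iW ⨾ put iD O ⨾ moveAll iW iD ⨾ put iD O ⨾ put iD Off

  markAgain : Digit → Bool
  markAgain dFix = true
  markAgain dOn  = true
  markAgain _    = false

  markBody : Digit → Prog 12
  markBody dFix = moveNum iR iU ⨾ moveAll iU iD ⨾ put iD O ⨾ put iD Fix
  markBody dOn  = moveNum iR iU ⨾ member ⨾ case iQ found
  markBody _    = skip

  -- Inner vertices of a path that are not sinks are dropped: no candidate needs them.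
  markSinks : Prog 12
  markSinks = loop iR markAgain markBody

  -- Candidates use only closure edges of the given paths, and validity places these in the closure
  -- of the digraph, so the machine can pass over the edge list.
  skipEdge : Digit → Prog 12
  skipEdge dI = skipNum iX ⨾ skipNum iX
  skipEdge _  = skip

  pushItem : Letter → Prog 12
  pushItem a = put iR O ⨾ moveNum iX iR ⨾ put iR a

  innerVertex : Digit → Prog 12
  innerVertex dI = pushItem On
  innerVertex _  = skip

  routeBody : Digit → Prog 12
  routeBody ∅ = skipNum iX
  routeBody _ = pushItem Fix ⨾ loop iV onI innerVertex ⨾ pushItem Fix

  -- The source is skipped, being the first vertex of the path, while the target is filed as a sink.
  -- Two units are popped from the path length, which leaves the number of inner vertices; an empty
  -- second pop betrays a path with one vertex.
  commodityBody : Digit → Prog 12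
  commodityBody dI = skipNum iX ⨾ put iT O ⨾ moveNum iX iT ⨾ moveNum iX iV ⨾ case iV (λ _ → skip) ⨾ case iV routeBody
  commodityBody _  = skip

  parse : Prog 12
  parse = skipNum iX ⨾ moveNum iX iZ ⨾ moveNum iX iC ⨾ loop iC onI skipEdge ⨾ moveNum iX iC ⨾ loop iC onI commodityBody

  emptyOnly : Digit → Prog 12
  emptyOnly ∅ = put iX I
  emptyOnly _ = skip

  -- Stack z holds the target in unary. The test consumes its only unit, which frees z for the
  -- search; for target 0 all paths are trivial iff stack r received no vertex.
  targetBody : Digit → Prog 12
  targetBody ∅ = case iR emptyOnly
  targetBody _ = markSinks ⨾ search

  program : Prog 12
  program = parse ⨾ case iZ targetBody

  -- A nonempty path with its two ends separated from the inner vertices, since only the latter can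
  -- be optional.
  data Route (A : Set) : Set where
    single : A → Route A
    long   : A → List A → A → Route A

  vertices : ∀ {A} → Route A → List A
  vertices (single a)    = a ∷ []
  vertices (long a ms b) = a ∷ (ms ++ (b ∷ []))

  module Load (B n : ℕ) (n≤B : n ≤ B) where

    open Bounded B n n≤B public
    open Search B n n≤B public

    nums : List (Fin n) → Str → Str
    nums []       xs = xs
    nums (v ∷ vs) xs = num v (nums vs xs)

    -- true marks an end of a route
    Items : Set
    Items = List (Bool × Fin n)

    itemFlag : Bool → Letter
    itemFlag true  = Fix
    itemFlag false = On

    items : Items → Str
    items []             = []
    items ((b , v) ∷ is) = itemFlag b ∷ num v (items is)

    hit : ℕ → ℕ
    hit zero    = 1
    hit (suc _) = 0

    hits : Fin n → List (Fin n) → ℕ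
    hits v []       = 0
    hits v (t ∷ ts) = hits v ts + hit (gap (toℕ t) (toℕ v))

    candidateSeg : ℕ → Fin n → Segs → Segs
    candidateSeg zero    v L = L
    candidateSeg (suc _) v L = opt false v ∷ L

    marked : List (Fin n) → Items → Segs → Segs
    marked ts []                 L = L
    marked ts ((true , v) ∷ is)  L = marked ts is (fix v ∷ L)
    marked ts ((false , v) ∷ is) L = marked ts is (candidateSeg (hits v ts) v L)

    cTest cMember cMark : ℕ
    cTest = lin 6 7 + lin 2 3
    cMember = lin (2 + cTest) 2 + (B * lin 1 1 * 2 + 2)
    cMark = lin 2 2 + (cMember + suc (lin 2 2 + (lin 3 2 + (1 + (lin 2 2 + 2)))))

    module _ {x r z f : Str} where

      mst : (c t d u w p q : Str) → Stacks
      mst c t d u w p q = st x c [] t r d u w p q z f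

      test-run : ∀ p → p ≤ suc B → ∀ {c t d u q} →
        Runs (case iP memberBody) (mst c t d u [] (ones p []) q) (mst c t d u [] [] (ones (hit p) q)) (lin 2 3)
      test-run zero le {c} {t} {d} {u} {q} = weaken (≤-trans (n≤1+n 2) (m≤n+m 3 (B * 2)))
        (exit-slot (λ p → mst c t d u [] p q) [] refl (put-slot (λ q → mst c t d u [] [] q)))
      test-run (suc p) (s≤s le) {c} {t} {d} {u} {q} = weaken (≤-reflexive (sym (+-suc (B * 2) 2)))
        (exit-slot (λ p → mst c t d u [] p q) (ones (suc p) []) refl (clearOnes (λ p → mst c t d u [] p q) le))

      member-loop : ∀ v ts {c d q} →
        Runs (while iT (compareNum iT iC iU iW iP ⨾ case iP memberBody))
          (mst c (nums ts []) d (ones (toℕ v) []) [] [] q)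
          (mst (nums ts [] ʳ++ c) [] d (ones (toℕ v) []) [] [] (ones (hits v ts) q)) (length ts * (2 + cTest) + 2)
      member-loop v [] {c} {d} {q} = while-exit (λ t → mst c t d (ones (toℕ v) []) [] [] q)
      member-loop v (t ∷ ts) {c} {d} {q} = weaken (≤-reflexive (sym (+-assoc (2 + cTest) (length ts * (2 + cTest)) 2)))
        (while-again (λ t → mst c t d (ones (toℕ v) []) [] [] q) (toℕ t)
          (lin-weaken t (compare-run (λ t c u w p → mst c t d u w p q) (toℕ t) (toℕ v)) then
           test-run (gap (toℕ t) (toℕ v)) (gap-bounded t v))
          (retarget (cong₂ (λ c q → mst c [] d (ones (toℕ v) []) [] [] q) (sym (ones-ʳ++ (toℕ t) _ c)) (ones-+ (hits v ts) _ q))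
            (member-loop v ts)))

      length-nums : ∀ ts → length (nums ts []) ≤ length ts * lin 1 1
      length-nums []       = z≤n
      length-nums (t ∷ ts) = ≤-trans (length-num t _) (+-monoʳ-≤ (lin 1 1) (length-nums ts))

      member-run : ∀ v ts → length ts ≤ B → ∀ {d q} →
        Runs member (mst [] (nums ts []) d (ones (toℕ v) []) [] [] q)
                    (mst [] (nums ts []) d (ones (toℕ v) []) [] [] (ones (hits v ts) q)) cMember
      member-run v ts le {d} {q} = weaken (+-monoˡ-≤ 2 (*-monoˡ-≤ (2 + cTest) le)) (member-loop v ts) then
        retarget (cong (λ t → mst [] t d (ones (toℕ v) []) [] [] (ones (hits v ts) q)) (reverse-twice (nums ts [])))
          (weaken (+-monoˡ-≤ 2 (*-monoˡ-≤ 2 (≤-trans (≤-reflexive (trans (length-ʳ++ (nums ts [])) (+-identityʳ _)))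
              (≤-trans (length-nums ts) (*-monoˡ-≤ (lin 1 1) le)))))
            (moveAll-run (λ c t → mst c t d (ones (toℕ v) []) [] [] (ones (hits v ts) q)) (nums ts [] ʳ++ [])))

      found-run : ∀ v h → h ≤ B → ∀ {t} L →
        Runs (case iQ found) (mst [] t (flat L) (ones (toℕ v) []) [] [] (ones h []))
                             (mst [] t (flat (candidateSeg h v L)) [] [] [] []) (suc (lin 2 2 + (lin 3 2 + (1 + (lin 2 2 + 2)))))
      found-run v zero le {t} L = weaken (s≤s (m≤m+n (lin 2 2) _))
        (exit-slot (λ q → mst [] t (flat L) (ones (toℕ v) []) [] [] q) [] refl
          (clearOnes (λ u → mst [] t (flat L) u [] [] []) (bounded v)))
      found-run v (suc h) le {t} L =
        exit-slot (λ q → mst [] t (flat L) (ones (toℕ v) []) [] [] q) (ones (suc h) []) refl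
          (clearOnes (λ q → mst [] t (flat L) (ones (toℕ v) []) [] [] q) (≤-trans (n≤1+n h) le) then
           lin-weaken v (copyOnes-run (λ u d w → mst [] t d u w [] []) (toℕ v)) then
           put-slot (λ d → mst [] t d [] (ones (toℕ v) []) [] []) then
           lin-weaken v (moveOnes-run (λ w d → mst [] t d [] w [] []) (toℕ v)) then
           put-slot (λ d → mst [] t d [] [] [] []) then
           put-slot (λ d → mst [] t d [] [] [] []))

    hits≤ : ∀ v ts → hits v ts ≤ length ts
    hits≤ v []       = z≤n
    hits≤ v (t ∷ ts) = ≤-trans (+-mono-≤ (hits≤ v ts) (hit≤1 (gap (toℕ t) (toℕ v)))) (≤-reflexive (+-comm _ 1))
      where
      hit≤1 : ∀ g → hit g ≤ 1
      hit≤1 zero    = ≤-refl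
      hit≤1 (suc _) = z≤n

    mark-run : ∀ ts → length ts ≤ B → ∀ is L {x z f} →
      Runs markSinks (st x [] [] (nums ts []) (items is) (flat L) [] [] [] [] z f)
                     (st x [] [] (nums ts []) [] (flat (marked ts is L)) [] [] [] [] z f) (length is * suc cMark + 2)
    mark-run ts le [] L {x} {z} {f} = exit-slot (λ r → st x [] [] (nums ts []) r (flat L) [] [] [] [] z f) [] refl run-skip
    mark-run ts le ((true , v) ∷ is) L {x} {z} {f} = weaken (≤-reflexive (sym (+-assoc (suc cMark) (length is * suc cMark) 2)))
      (again-slot (λ r → st x [] [] (nums ts []) r (flat L) [] [] [] [] z f) (items ((true , v) ∷ is)) refl
        (weaken (+-monoʳ-≤ (lin 2 2) (≤-trans cost (m≤n+m _ cMember)))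
         (lin-weaken v (moveNum-run (λ r u → st x [] [] (nums ts []) r (flat L) u [] [] [] z f) (toℕ v)) then
         lin-weaken v (moveOnes-run (λ u d → st x [] [] (nums ts []) (items is) d u [] [] [] z f) (toℕ v)) then
         put-slot (λ d → st x [] [] (nums ts []) (items is) d [] [] [] [] z f) then
         put-slot (λ d → st x [] [] (nums ts []) (items is) d [] [] [] [] z f)))
        (mark-run ts le is (fix v ∷ L)))
      where
      cost : lin 2 2 + 2 ≤ suc (lin 2 2 + (lin 3 2 + (1 + (lin 2 2 + 2))))
      cost = ≤-trans (+-monoʳ-≤ (lin 2 2) (≤-trans (m≤n+m 2 (B * 3)) (m≤m+n (lin 3 2) _))) (n≤1+n _)
    mark-run ts le ((false , v) ∷ is) L {x} {z} {f} = weaken (≤-reflexive (sym (+-assoc (suc cMark) (length is * suc cMark) 2)))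
      (again-slot (λ r → st x [] [] (nums ts []) r (flat L) [] [] [] [] z f) (items ((false , v) ∷ is)) refl
        (lin-weaken v (moveNum-run (λ r u → st x [] [] (nums ts []) r (flat L) u [] [] [] z f) (toℕ v)) then
         member-run v ts le then
         found-run v (hits v ts) (≤-trans (hits≤ v ts) le) L)
        (mark-run ts le is (candidateSeg (hits v ts) v L)))

    edgeNums : List (Fin n × Fin n) → Str → Str
    edgeNums []             xs = xs
    edgeNums ((u , v) ∷ es) xs = num u (num v (edgeNums es xs))

    Com : Set
    Com = Fin n × Fin n × Route (Fin n)

    com : Com → Str → Str
    com (s , t , P) xs = num s (num t (ones (length (vertices P)) (O ∷ nums (vertices P) xs)))

    coms : List Com → Str
    coms []       = []
    coms (c ∷ cs) = com c (coms cs)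

    innerItems : List (Fin n) → Items → Items
    innerItems []       is = is
    innerItems (v ∷ vs) is = innerItems vs ((false , v) ∷ is)

    routeItems : Route (Fin n) → Items → Items
    routeItems (single _)    is = is
    routeItems (long a ms b) is = (true , b) ∷ innerItems ms ((true , a) ∷ is)

    comItems : List Com → Items → Items
    comItems []                 is = is
    comItems ((s , t , P) ∷ cs) is = comItems cs (routeItems P is)

    sinks : List Com → List (Fin n) → List (Fin n)
    sinks []                 ts = ts
    sinks ((s , t , P) ∷ cs) ts = sinks cs (t ∷ ts)

    ShortRoutes : List Com → Set
    ShortRoutes []                 = ⊤
    ShortRoutes ((s , t , P) ∷ cs) = length (vertices P) ≤ B × ShortRoutes cs

    cItem cRoute cCom cParse : ℕ
    cItem = 1 + (lin 2 2 + 1)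
    cRoute = cItem + (lin (suc cItem) 2 + cItem)
    cCom = lin 2 2 + (1 + (lin 2 2 + (lin 2 2 + (2 + suc cRoute))))
    cParse = lin 2 2 + (4 + (lin 2 2 + (lin (suc (lin 2 2 + lin 2 2)) 2 + (lin 2 2 + lin (suc cCom) 2))))

    module _ {d z f : Str} where

      lst : (x c v t r : Str) → Stacks
      lst x c v t r = st x c v t r d [] [] [] [] z f

      item-run : ∀ b a {xs c v t is} →
        Runs (pushItem (itemFlag b)) (lst (num a xs) c v t (items is)) (lst xs c v t (items ((b , a) ∷ is))) cItem
      item-run b a {xs} {c} {v} {t} = put-slot (λ r → lst _ c v t r) then
        lin-weaken a (moveNum-run (λ x r → lst x c v t r) (toℕ a)) then put-slot (λ r → lst xs c v t r)

      inner-run : ∀ ms {xs c t is} →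
        Runs (loop iV onI innerVertex) (lst (nums ms xs) c (ones (length ms) []) t (items is))
                                       (lst xs c [] t (items (innerItems ms is))) (length ms * suc cItem + 2)
      inner-run [] {xs} {c} {t} = exit-slot (λ v → lst xs c v t _) [] refl run-skip
      inner-run (m ∷ ms) {xs} {c} {t} {is} = weaken (≤-reflexive (sym (+-assoc (suc cItem) (length ms * suc cItem) 2)))
        (again-slot (λ v → lst _ c v t _) (ones (suc (length ms)) []) refl (item-run false m {is = is}) (inner-run ms))

      route-run : ∀ P → length (vertices P) ≤ B → ∀ {xs c t is} →
        Runs (case iV (λ _ → skip) ⨾ case iV routeBody)
          (lst (nums (vertices P) xs) c (ones (length (vertices P)) []) t (items is))
          (lst xs c [] t (items (routeItems P is))) (2 + suc cRoute)
      route-run (single a) le {xs} {c} {t} {is} =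
        exit-slot (λ v → lst _ c v t _) (I ∷ []) refl run-skip then
        exit-slot (λ v → lst _ c v t _) [] refl
          (weaken (≤-trans (≤-trans (m≤m+n (lin 2 2) 1) (n≤1+n _)) (m≤m+n cItem _)) (lin-weaken a (skipNum-run (λ x → lst x c [] t _) (toℕ a))))
      route-run (long a ms b) le {xs} {c} {t} {is} =
        exit-slot (λ v → lst _ c v t _) (ones (suc (length (ms ++ (b ∷ [])))) []) refl run-skip then
        subst (λ l → Runs (case iV routeBody) (lst (num a (nums (ms ++ (b ∷ [])) xs)) c (ones l []) t (items is))
                                              (lst xs c [] t (items (routeItems (long a ms b) is))) (suc cRoute))
          (sym snoc)
          (exit-slot (λ v → lst _ c v t _) (ones (suc (length ms)) []) refl
            (item-run true a {is = is} then
             subst (λ x → Runs (loop iV onI innerVertex) (lst x c (ones (length ms) []) t (items ((true , a) ∷ is)))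
                 (lst (num b xs) c [] t (items (innerItems ms ((true , a) ∷ is)))) (lin (suc cItem) 2))
               (nums-snoc ms)
               (weaken (+-monoˡ-≤ 2 (*-monoˡ-≤ (suc cItem) short)) (inner-run ms {is = (true , a) ∷ is})) then
             item-run true b {is = innerItems ms ((true , a) ∷ is)}))
        where
        snoc : length (ms ++ (b ∷ [])) ≡ suc (length ms)
        snoc = trans (length-++ ms) (+-comm (length ms) 1)
        short : length ms ≤ B
        short = ≤-trans (≤-trans (n≤1+n _) (≤-trans (≤-reflexive (sym snoc)) (n≤1+n _))) le
        nums-snoc : ∀ ms → nums ms (num b xs) ≡ nums (ms ++ (b ∷ [])) xs
        nums-snoc []       = refl
        nums-snoc (m ∷ ms) = cong (num m) (nums-snoc ms)

      coms-run : ∀ cs → ShortRoutes cs → ∀ {ts is} →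
        Runs (loop iC onI commodityBody) (lst (coms cs) (ones (length cs) []) [] (nums ts []) (items is))
          (lst [] [] [] (nums (sinks cs ts) []) (items (comItems cs is))) (length cs * suc cCom + 2)
      coms-run [] _ = exit-slot (λ c → lst [] c [] _ _) [] refl run-skip
      coms-run ((s , t , P) ∷ cs) (le , les) {ts} {is} = weaken (≤-reflexive (sym (+-assoc (suc cCom) (length cs * suc cCom) 2)))
        (again-slot (λ c → lst _ c [] _ _) (ones (suc (length cs)) []) refl
          (lin-weaken s (skipNum-run (λ x → lst x c′ [] (nums ts []) (items is)) (toℕ s)) then
           put-slot (λ t → lst _ c′ [] t (items is)) then
           lin-weaken t (moveNum-run (λ x t → lst x c′ [] t (items is)) (toℕ t)) then
           weaken (+-monoˡ-≤ 2 (*-monoˡ-≤ 2 le)) (moveNum-run (λ x v → lst x c′ v (nums (t ∷ ts) []) (items is)) (length (vertices P))) then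
           route-run P le {is = is})
          (coms-run cs les))
        where
        c′ : Str
        c′ = ones (length cs) []

      edges-run : ∀ es {xs t r} →
        Runs (loop iC onI skipEdge) (lst (edgeNums es xs) (ones (length es) []) [] t r) (lst xs [] [] t r)
             (length es * suc (lin 2 2 + lin 2 2) + 2)
      edges-run [] {xs} {t} {r} = exit-slot (λ c → lst xs c [] t r) [] refl run-skip
      edges-run ((u , v) ∷ es) {xs} {t} {r} = weaken (≤-reflexive (sym (+-assoc (suc (lin 2 2 + lin 2 2)) (length es * suc (lin 2 2 + lin 2 2)) 2)))
        (again-slot (λ c → lst _ c [] t r) (ones (suc (length es)) []) refl
          (lin-weaken u (skipNum-run (λ x → lst x (ones (length es) []) [] t r) (toℕ u)) then
           lin-weaken v (skipNum-run (λ x → lst x (ones (length es) []) [] t r) (toℕ v)))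
          (edges-run es))

    input : ℕ → List (Fin n × Fin n) → List Com → Str
    input T E cs = ones n (O ∷ ones T (O ∷ ones (length E) (O ∷ edgeNums E (ones (length cs) (O ∷ coms cs)))))

    parse-run : ∀ T E cs → T ≤ 1 → length E ≤ B → length cs ≤ B → ShortRoutes cs →
      Runs parse (st (input T E cs) [] [] [] [] [] [] [] [] [] [] [])
        (st [] [] [] (nums (sinks cs []) []) (items (comItems cs [])) [] [] [] [] [] (ones T []) []) cParse
    parse-run T E cs le₁ le₂ le₃ les =
      weaken (+-monoˡ-≤ 2 (*-monoˡ-≤ 2 n≤B)) (skipNum-run (λ x → st x [] [] [] [] [] [] [] [] [] [] []) n) then
      weaken (+-monoˡ-≤ 2 (*-monoˡ-≤ 2 le₁)) (moveNum-run (λ x z → st x [] [] [] [] [] [] [] [] [] z []) T) then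
      weaken (+-monoˡ-≤ 2 (*-monoˡ-≤ 2 le₂)) (moveNum-run (λ x c → st x c [] [] [] [] [] [] [] [] (ones T []) []) (length E)) then
      weaken (+-monoˡ-≤ 2 (*-monoˡ-≤ _ le₂)) (edges-run E) then
      weaken (+-monoˡ-≤ 2 (*-monoˡ-≤ 2 le₃)) (moveNum-run (λ x c → st x c [] [] [] [] [] [] [] [] (ones T []) []) (length cs)) then
      weaken (+-monoˡ-≤ 2 (*-monoˡ-≤ (suc cCom) le₃)) (coms-run cs les {[]} {[]})

    inputStacks : ℕ → List (Fin n × Fin n) → List Com → Stacks
    inputStacks T E cs = st (input T E cs) [] [] [] [] [] [] [] [] [] [] []

    program-zero : ∀ E cs → length E ≤ B → length cs ≤ B → ShortRoutes cs →
      Verdict program (inputStacks 0 E cs) (cParse + 3) (comItems cs [] ≡ []) (comItems cs [] ≢ [])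
    program-zero E cs le₂ le₃ les with comItems cs [] | parse-run 0 E cs z≤n le₂ le₃ les
    ... | [] | run = accepts
      (run then exit-slot (λ z → st [] [] [] (nums (sinks cs []) []) [] [] [] [] [] [] z []) [] refl
        (exit-slot (λ r → st [] [] [] (nums (sinks cs []) []) r [] [] [] [] [] [] []) [] refl
          (put-slot (λ x → st x [] [] (nums (sinks cs []) []) [] [] [] [] [] [] [] []))))
      refl refl
    ... | (b , v) ∷ is | run = rejects
      (run then exit-slot (λ z → st [] [] [] (nums (sinks cs []) []) _ [] [] [] [] [] z []) [] refl
        (exit-slot (λ r → st [] [] [] (nums (sinks cs []) []) r [] [] [] [] [] [] []) (items ((b , v) ∷ is)) refl run-skip))
      refl (λ ())

    initialSegs : List Com → Segs
    initialSegs cs = marked (sinks cs []) (comItems cs []) []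

    cSearch : ℕ → ℕ
    cSearch m = cParse + suc (lin (suc cMark) 2 + (1 + (suc m * suc cCandidate + 2)))

    program-one : ∀ E cs → length E ≤ B → length cs ≤ B → ShortRoutes cs →
      length (sinks cs []) ≤ B → length (comItems cs []) ≤ B → (edges : Segs → Pairs) →
      (∀ L → Same (initialSegs cs) L → rnums (kept L) ʳ++ [] ≡ pairs (edges L)) →
      (∀ L → Same (initialSegs cs) L → length (edges L) ≤ B) → (∀ L → Same (initialSegs cs) L → length L ≤ B) →
      Verdict program (inputStacks 1 E cs) (cSearch (remaining (initialSegs cs)))
        (∃ λ L → Same (initialSegs cs) L × allClashes (edges L) ≡ 0)
        (∀ L → Same (initialSegs cs) L → remaining L ≤ remaining (initialSegs cs) → allClashes (edges L) ≢ 0)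
    program-one E cs le₂ le₃ les le₄ le₅ edges paired few small =
      finish (search-loop L₀ edges paired few small _ L₀ (Same-refl L₀) refl)
      where
      L₀ : Segs
      L₀ = initialSegs cs
      t : Str
      t = nums (sinks cs []) []
      Yes No : Set
      Yes = ∃ λ L → Same L₀ L × allClashes (edges L) ≡ 0
      No = ∀ L → Same L₀ L → remaining L ≤ remaining L₀ → allClashes (edges L) ≢ 0
      whole : ∀ {τ N} → Runs (loop iZ some candidate) (st [] [] [] t [] (flat L₀) [] [] [] [] (I ∷ []) []) τ N →
              Runs program (inputStacks 1 E cs) τ (cParse + suc (lin (suc cMark) 2 + (1 + N)))
      whole r = parse-run 1 E cs ≤-refl le₂ le₃ les then
        exit-slot (λ z → st [] [] [] t (items (comItems cs [])) [] [] [] [] [] z []) (I ∷ []) refl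
          (weaken (+-monoˡ-≤ 2 (*-monoˡ-≤ (suc cMark) le₅)) (mark-run (sinks cs []) le₄ (comItems cs []) []) then
           put-slot (λ z → st [] [] [] t [] (flat L₀) [] [] [] [] z []) then r)
      finish : Verdict (loop iZ some candidate) (st [] [] [] t [] (flat L₀) [] [] [] [] (I ∷ []) [])
                 (suc (remaining L₀) * suc cCandidate + 2) Yes No →
               Verdict program (inputStacks 1 E cs) (cSearch (remaining L₀)) Yes No
      finish (accepts r a y)  = accepts (whole r) a y
      finish (rejects r a ¬y) = rejects (whole r) a ¬y

open Loading

-- Shortcutting a solution to walks through sinks

module ShortcutGraphs where

  module _ {n : ℕ} where

    private
      V : Set
      V = Fin n

    head∉ : ∀ {x : V} {xs} → Unique (x ∷ xs) → x ∉ xs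
    head∉ (≢s ∷ _) x∈ = All.lookup ≢s x∈ refl

    closure-target : ∀ {P} {u v : V} → PathClosureEdge (u ∷ P) u v → Unique (u ∷ P) → v ∈ P
    source∈ : ∀ {P} {u v : V} → PathClosureEdge P u v → u ∈ P
    source∈ (here _)  = here refl
    source∈ (there p) = there (source∈ p)
    closure-target (here v∈) _ = v∈
    closure-target (there p) q = contradiction (source∈ p) (head∉ q)

    target∈ : ∀ {x P} {u v : V} → PathClosureEdge (x ∷ P) u v → v ∈ P
    target∈ (here v∈)                = v∈
    target∈ (there {xs = _ ∷ _} p) = there (target∈ p)

    closure-distinct : ∀ {P} {u v : V} → Unique P → PathClosureEdge P u v → u ≢ v
    closure-distinct q        (here v∈) refl = head∉ q v∈
    closure-distinct (_ ∷ q) (there p)      = closure-distinct q p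

    walk-head : ∀ {E} {s t x : V} {xs} → Walk E s t (x ∷ xs) → s ≡ x
    walk-head single     = refl
    walk-head (cons _ _) = refl

    walk-last : ∀ {E} {s t b : V} xs → Walk E s t (xs ++ [ b ]) → t ≡ b
    walk-last []           single     = refl
    walk-last (_ ∷ [])     (cons _ w) = walk-last [] w
    walk-last (_ ∷ y ∷ xs) (cons _ w) = walk-last (y ∷ xs) w

    walk-reach : ∀ {E} {s t v : V} {x xs} → Walk E s t (x ∷ xs) → v ∈ xs → Reach E s v
    walk-reach (cons e w) (here refl) = e ◅ ε
    walk-reach (cons e w) (there v∈)  = e ◅ walk-reach w v∈

    walk-closure : ∀ {E} {s t u v : V} {P} → Walk E s t P → PathClosureEdge P u v → Reach E u v
    walk-closure w          (here v∈) with walk-head w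
    ... | refl = walk-reach w v∈
    walk-closure single     (there ())
    walk-closure (cons _ w) (there p) = walk-closure w p

    path-closure : ∀ {E} {s t u v : V} {P} → IsDPath E s t P → PathClosureEdge P u v → ClosureEdge E u v
    path-closure (w , q) p = closure-distinct q p , walk-closure w p

    -- Closure edges lead only to later path vertices, so a walk that has passed `x` never returns
    -- to it.
    restrict : ∀ {H : Graph n} {x xs u t} → Unique (x ∷ xs) → u ∈ xs →
               Star (HPEdge H (x ∷ xs)) u t → Star (HPEdge H xs) u t
    restrict q u∈ ε = ε
    restrict q u∈ ((h , here v∈) ◅ r) = contradiction u∈ (head∉ q)
    restrict q u∈ ((h , p@(there p′)) ◅ r) = (h , p′) ◅ restrict q (target∈ p) r

    subset-unique : ∀ {p : Subset n} {x y} → ∣ p ∣ ≤ 1 → x ∈ₛ p → y ∈ₛ p → x ≡ y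
    subset-unique {p} {x} {y} le x∈ y∈ with y ≟ x
    ... | yes refl = refl
    ... | no  y≢x  = contradiction (≤-trans (x∈p⇒∣p-x∣<∣p∣ (x∈p∧x≢y⇒x∈p-y y∈ y≢x))
                                            (≤-pred (≤-trans (x∈p⇒∣p-x∣<∣p∣ x∈) le))) n≮0

    -- The sequence ks lists the edges (v , h) of a candidate one after the other.
    data Adj : List V → V → V → Set where
      here  : ∀ {v h ks} → Adj (v ∷ h ∷ ks) v h
      there : ∀ {v h v′ h′ ks} → Adj ks v h → Adj (v′ ∷ h′ ∷ ks) v h

    Functional : (V → V → Set) → Set
    Functional R = ∀ {v h h′} → R v h → R v h′ → h ≡ h′

    -- The edges of the walk from `a` through `xs` to `b`, each inner vertex doubled; the same
    -- pattern as the sequence kept by a candidate.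
    dup : V → List V → V → List V → List V
    dup a []       b ks = a ∷ b ∷ ks
    dup a (x ∷ xs) b ks = a ∷ x ∷ dup x xs b ks

    data Consec : V → List V → V → V → V → Set where
      last  : ∀ {a b} → Consec a [] b a b
      first : ∀ {a x xs b} → Consec a (x ∷ xs) b a x
      later : ∀ {a x xs b v h} → Consec x xs b v h → Consec a (x ∷ xs) b v h

    adj-dup : ∀ {a} xs {b ks v h} → Adj (dup a xs b ks) v h → Consec a xs b v h ⊎ Adj ks v h
    adj-dup []       here      = inj₁ last
    adj-dup []       (there p) = inj₂ p
    adj-dup (x ∷ xs) here      = inj₁ first
    adj-dup (x ∷ xs) (there p) with adj-dup xs p
    ... | inj₁ c = inj₁ (later c)
    ... | inj₂ q = inj₂ q

    dup-consec : ∀ {a xs b ks v h} → Consec a xs b v h → Adj (dup a xs b ks) v h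
    dup-consec last      = here
    dup-consec first     = here
    dup-consec (later c) = there (dup-consec c)

    dup-rest : ∀ {a} xs {b ks v h} → Adj ks v h → Adj (dup a xs b ks) v h
    dup-rest []       p = there p
    dup-rest (x ∷ xs) p = there (dup-rest xs p)

    data Sub : List V → List V → Set where
      []   : Sub [] []
      skip : ∀ {x xs ms} → Sub xs ms → Sub xs (x ∷ ms)
      take : ∀ {x xs ms} → Sub xs ms → Sub (x ∷ xs) (x ∷ ms)

    skip-closure : ∀ {a m ms} {u v : V} → PathClosureEdge (a ∷ ms) u v → PathClosureEdge (a ∷ m ∷ ms) u v
    skip-closure (here v∈) = here (there v∈)
    skip-closure (there p) = there (there p)

    consec-closure : ∀ {a xs ms b v h} → Sub xs ms → Consec a xs b v h → PathClosureEdge (a ∷ (ms ++ [ b ])) v h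
    consec-closure []       last      = here (here refl)
    consec-closure (skip s) c         = skip-closure (consec-closure s c)
    consec-closure (take s) first     = here (here refl)
    consec-closure (take s) (later c) = there (consec-closure s c)

    consec-star : ∀ {R : V → V → Set} {a} xs {b} → (∀ {v h} → Consec a xs b v h → R v h) → Star R a b
    consec-star []       f = f last ◅ ε
    consec-star (x ∷ xs) f = f first ◅ consec-star xs (λ c → f (later c))

    next : List V → V → Maybe V
    next []           x = nothing
    next (_ ∷ [])     x = nothing
    next (v ∷ h ∷ ks) x with x ≟ v
    ... | yes _ = just h
    ... | no  _ = next ks x

    next-adj : ∀ ks {x y} → next ks x ≡ just y → Adj ks x y
    next-adj (v ∷ h ∷ ks) {x} e with x ≟ v
    next-adj (v ∷ h ∷ ks) refl | yes refl = here
    next-adj (v ∷ h ∷ ks) e    | no  _    = there (next-adj ks e)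

    adj-next : ∀ {ks x y} → Adj ks x y → ∃ λ z → next ks x ≡ just z
    adj-next {x ∷ y ∷ ks} here with x ≟ x
    ... | yes _ = _ , refl
    ... | no ¬e = contradiction refl ¬e
    adj-next {v ∷ h ∷ ks} {x} (there p) with x ≟ v
    ... | yes _ = _ , refl
    ... | no  _ = adj-next p

    -- The first listed edge at a vertex decides, so outdegree at most 1 is built in; functionality
    -- of the list then ensures that no listed edge is lost.
    graphOf : List V → Graph n
    graphOf ks x = maybe ⁅_⁆ ⊥ (next ks x)

    graph-adj : ∀ ks {x y} → HEdge (graphOf ks) x y → Adj ks x y
    graph-adj ks {x} p with next ks x in e
    ... | nothing = contradiction p ∉⊥
    ... | just z with x∈⁅y⁆⇒x≡y z p
    ...   | refl = next-adj ks e

    adj-graph : ∀ {ks x y} → Functional (Adj ks) → Adj ks x y → HEdge (graphOf ks) x y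
    adj-graph {ks} {x} {y} f p with adj-next p
    ... | z , e with f p (next-adj ks e)
    ...   | refl rewrite e = x∈⁅x⁆ y

    graph-outdeg : ∀ ks x → outdeg (graphOf ks) x ≤ 1
    graph-outdeg ks x with next ks x
    ... | nothing = ≤-trans (≤-reflexive (∣⊥∣≡0 n)) z≤n
    ... | just z  = ≤-reflexive (∣⁅x⁆∣≡1 z)

    module _ (H : Graph n) (Sink : V → Set) where

      -- h is the first sink that the walk in H leaving v meets.
      data Next : V → V → Set where
        hit  : ∀ {v h} → HEdge H v h → Sink h → Next v h
        pass : ∀ {v c h} → HEdge H v c → ¬ Sink c → Next c h → Next v h

      -- With outdegree at most 1 the walk leaving `v` is unique, hence so is the first sink on it.
      -- The relation depends on `H` and the set of sinks but on no path, which is why the shortened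
      -- walks of different commodities fit together.
      next-functional : (∀ v → outdeg H v ≤ 1) → Functional Next
      next-functional deg (hit e s)    (hit e′ s′)     = subset-unique (deg _) e e′
      next-functional deg (hit e s)    (pass e′ ¬s _)  with subset-unique (deg _) e e′
      ... | refl = contradiction s ¬s
      next-functional deg (pass e ¬s _) (hit e′ s)     with subset-unique (deg _) e e′
      ... | refl = contradiction s ¬s
      next-functional deg (pass e _ p) (pass e′ _ p′)  with subset-unique (deg _) e e′
      ... | refl = next-functional deg p p′

      -- The walk leaving a meets no sink strictly before w.
      record Pending (a w : V) : Set where
        field
          stops     : Sink w → Next a w
          continues : ∀ {h} → ¬ Sink w → Next w h → Next a h

      open Pending

      pending-edge : ∀ {a w} → HEdge H a w → Pending a w
      pending-edge e .stops     = hit e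
      pending-edge e .continues = pass e

      pending-extend : ∀ {a w w′} → Pending a w → ¬ Sink w → HEdge H w w′ → Pending a w′
      pending-extend p ¬s e .stops s         = continues p ¬s (hit e s)
      pending-extend p ¬s e .continues ¬s′ q = continues p ¬s (pass e ¬s′ q)

      b∈ : ∀ ms {b : V} → b ∈ ms ++ [ b ]
      b∈ ms = ∈-++⁺ʳ ms (here refl)

      record Selection (a : V) (ms : List V) (b : V) : Set where
        field
          {xs}   : List V
          sub    : Sub xs ms
          sinks  : All Sink xs
          nexts  : ∀ {v h} → Consec a xs b v h → Next v h

      open Selection

      module _ (sink? : ∀ v → Dec (Sink v)) where

        -- The walk in `H` stands at `w`, and `a` is the starting vertex or the last sink selected.
        -- Path vertices before `w` are skipped; `w` itself is selected if it is a sink and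
        -- otherwise extends the pending edge of `a`. Since `b` is a sink, the last pending edge is
        -- completed there. The recursion is on the remaining path, not on the walk.
        follow : ∀ {a w b} ms → Unique (ms ++ [ b ]) → Sink b → Pending a w → w ∈ ms ++ [ b ] →
                 Star (HPEdge H (ms ++ [ b ])) w b → Selection a ms b
        leave : ∀ {a m b} ms → Unique (m ∷ (ms ++ [ b ])) → Sink b → (∀ {w} → HEdge H m w → Pending a w) →
                Star (HPEdge H (m ∷ (ms ++ [ b ]))) m b → Selection a ms b
        follow [] q s p (here refl) r = record { sub = [] ; sinks = [] ; nexts = λ { last → stops p s } }
        follow {w = w} (m ∷ ms) q s p w∈ r with w ≟ m
        follow (m ∷ ms) q s p w∈ r | yes refl with sink? m
        ... | yes sm = record { sub = take (sub IH) ; sinks = sm ∷ sinks IH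
                              ; nexts = λ { first → stops p sm ; (later c) → nexts IH c } }
          where IH = leave ms q s pending-edge r
        ... | no ¬sm = record { sub = skip (sub IH) ; sinks = sinks IH ; nexts = nexts IH }
          where IH = leave ms q s (pending-extend p ¬sm) r
        follow (m ∷ ms) q s p (here e) r | no w≢m = contradiction e w≢m
        follow (m ∷ ms) q@(_ ∷ q′) s p (there w∈) r | no w≢m =
          record { sub = skip (sub IH) ; sinks = sinks IH ; nexts = nexts IH }
          where IH = follow ms q′ s p w∈ (restrict q w∈ r)
        -- An empty walk would identify `m` with `b`, which occurs later on the path.
        leave ms q s p ε = contradiction (b∈ ms) (head∉ q)
        leave ms q@(_ ∷ q′) s p ((e , c) ◅ r) =
          follow ms q′ s (p e) (closure-target c q) (restrict q (closure-target c q) r)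

open ShortcutGraphs

-- Candidates correspond to solutions

module Correctness where

  module Correct (B n : ℕ) (n≤B : n ≤ B) where

    open Load B n n≤B public

    data Selects (Sink : Fin n → Set) : List Com → List (Fin n) → Set where
      []     : Selects Sink [] []
      single : ∀ {s t a cs ks} → Selects Sink cs ks → Selects Sink ((s , t , single a) ∷ cs) ks
      long   : ∀ {s t a ms b xs cs ks} → Sub xs ms → All Sink xs → Selects Sink cs ks →
               Selects Sink ((s , t , long a ms b) ∷ cs) (dup a xs b ks)

    Valid : EdgeList n → List Com → Set
    Valid E cs = ∀ {s t P} → (s , t , P) ∈ cs → IsDPath E s t (vertices P)

    Solves : EdgeList n → ℕ → List Com → Graph n → Set
    Solves E T cs H = (∀ i j → HEdge H i j → ClosureEdge E i j) × (∀ i → outdeg H i ≤ T)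
      × (∀ {s t P} → (s , t , P) ∈ cs → Star (HPEdge H (vertices P)) s t)

    module _ {E : EdgeList n} where

      ends : ∀ {s t a ms b} → IsDPath E s t (vertices (long a ms b)) → s ≡ a × t ≡ b
      ends {a = a} {ms} (w , _) = walk-head w , walk-last (a ∷ ms) w

      ends₁ : ∀ {s t a} → IsDPath E s t (vertices (single a)) → s ≡ t
      ends₁ (w , _) = trans (walk-head w) (sym (walk-last [] w))

      selects-closure : ∀ {Sink cs ks v h} → Selects Sink cs ks → Valid E cs → Adj ks v h → ClosureEdge E v h
      selects-closure (single s) valid p = selects-closure s (λ c∈ → valid (there c∈)) p
      selects-closure (long {xs = xs} sub _ s) valid p with adj-dup xs p
      ... | inj₁ c = path-closure (valid (here refl)) (consec-closure sub c)
      ... | inj₂ q = selects-closure s (λ c∈ → valid (there c∈)) q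

      selects-star : ∀ {Sink cs ks H} → Selects Sink cs ks → Valid E cs → (∀ {v h} → Adj ks v h → HEdge H v h) →
                     ∀ {s t P} → (s , t , P) ∈ cs → Star (HPEdge H (vertices P)) s t
      selects-star (single s) valid adj (here refl) with ends₁ (valid (here refl))
      ... | refl = ε
      selects-star (single s) valid adj (there c∈) = selects-star s (λ c∈ → valid (there c∈)) adj c∈
      selects-star (long {xs = xs} sub _ s) valid adj (here refl) with ends (valid (here refl))
      ... | refl , refl = consec-star xs (λ c → adj (dup-consec c) , consec-closure sub c)
      selects-star (long {xs = xs} sub _ s) valid adj (there c∈) =
        selects-star s (λ c∈ → valid (there c∈)) (λ p → adj (dup-rest xs p)) c∈

      sound : ∀ {Sink cs ks} → Selects Sink cs ks → Valid E cs → Functional (Adj ks) → Solves E 1 cs (graphOf ks)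
      sound {ks = ks} s valid f = (λ i j e → selects-closure s valid (graph-adj ks e)) , graph-outdeg ks ,
        selects-star s valid (adj-graph f)

      -- Each commodity is shortened separately by `leave`, but all resulting edges belong to the
      -- one relation `Next H Sink`; with `next-functional` the whole candidate is consistent.
      complete : ∀ {Sink cs H} → (∀ v → Dec (Sink v)) → (∀ {s t P} → (s , t , P) ∈ cs → Sink t) → Valid E cs →
                 (∀ {s t P} → (s , t , P) ∈ cs → Star (HPEdge H (vertices P)) s t) →
                 ∃ λ ks → Selects Sink cs ks × (∀ {v h} → Adj ks v h → Next H Sink v h)
      complete {cs = []} sink? sinks valid stars = [] , [] , λ ()
      complete {cs = (s , t , single a) ∷ cs} sink? sinks valid stars
        with complete sink? (λ c∈ → sinks (there c∈)) (λ c∈ → valid (there c∈)) (λ c∈ → stars (there c∈))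
      ... | ks , sel , nx = ks , single sel , nx
      complete {Sink} {(s , t , long a ms b) ∷ cs} {H} sink? sinks valid stars
        with complete sink? (λ c∈ → sinks (there c∈)) (λ c∈ → valid (there c∈)) (λ c∈ → stars (there c∈))
           | ends (valid (here refl)) | stars (here refl)
      ... | ks , sel , nx | refl , refl | r = dup a (Selection.xs C) b ks ,
          long (Selection.sub C) (Selection.sinks C) sel ,
          λ p → cases (adj-dup (Selection.xs C) p)
        where
        C : Selection H Sink a ms b
        C = leave H Sink sink? ms (proj₂ (valid (here refl))) (sinks (here refl)) (pending-edge H Sink) r
        cases : ∀ {v h} → Consec a (Selection.xs C) b v h ⊎ Adj ks v h → Next H Sink v h
        cases (inj₁ c) = Selection.nexts C c
        cases (inj₂ p) = nx p

    AllSingle : List Com → Set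
    AllSingle cs = ∀ {s t a ms b} → (s , t , long a ms b) ∉ cs

    solve-zero : ∀ {E cs} → Valid E cs → AllSingle cs → Solves E 0 cs (λ _ → ⊥)
    solve-zero {cs = cs} valid none = (λ i j e → contradiction e ∉⊥) , (λ i → ≤-reflexive (∣⊥∣≡0 n)) , stars
      where
      stars : ∀ {s t P} → (s , t , P) ∈ cs → Star (HPEdge (λ _ → ⊥) (vertices P)) s t
      stars {P = single a} c∈ with ends₁ (valid c∈)
      ... | refl = ε
      stars {P = long a ms b} c∈ = contradiction c∈ none

    zero-single : ∀ {E cs H} → Valid E cs → Solves E 0 cs H → AllSingle cs
    zero-single {H = H} valid (_ , deg , stars) {a = a} {ms} {b} c∈ with ends (valid c∈) | valid c∈ | stars c∈
    ... | refl , refl | _ , q | ε = contradiction (∈-++⁺ʳ ms (here refl)) (head∉ q)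
    ... | refl , refl | _ , q | (e , _) ◅ _ = contradiction (≤-trans (x∈p⇒∣p-x∣<∣p∣ e) (deg a)) n≮0

    comItems-nonempty : ∀ cs {i is} → comItems cs (i ∷ is) ≢ []
    comItems-nonempty (( _ , _ , single _) ∷ cs)    e = comItems-nonempty cs e
    comItems-nonempty (( _ , _ , long _ _ _) ∷ cs)  e = comItems-nonempty cs e

    noItems-single : ∀ cs → comItems cs [] ≡ [] → AllSingle cs
    noItems-single ((_ , _ , single _) ∷ cs)   e (there c∈) = noItems-single cs e c∈
    noItems-single ((_ , _ , long _ _ _) ∷ cs) e c∈         = comItems-nonempty cs e

    single-noItems : ∀ cs → AllSingle cs → comItems cs [] ≡ []
    single-noItems []                           none = refl
    single-noItems ((_ , _ , single _) ∷ cs)    none = single-noItems cs (λ c∈ → none (there c∈))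
    single-noItems ((_ , _ , long _ _ _) ∷ cs)  none = contradiction (here refl) none

    -- Membership in `ts` in terms of the counter of the machine, so that a case split on it agrees
    -- with the branching of `candidateSeg`.
    HitSink : List (Fin n) → Fin n → Set
    HitSink ts v = ∃ λ h → hits v ts ≡ suc h

    hitSink? : ∀ ts v → Dec (HitSink ts v)
    hitSink? ts v with hits v ts
    ... | zero  = no λ ()
    ... | suc h = yes (h , refl)

    hits-sound : ∀ v ts {h} → hits v ts ≡ suc h → v ∈ ts
    hits-sound v (t ∷ ts) e with gap (toℕ t) (toℕ v) in g
    ... | zero  = here (sym (toℕ-injective (gap≡0 (toℕ t) (toℕ v) g)))
    ... | suc _ = there (hits-sound v ts (trans (sym (+-identityʳ _)) e))

    hits-complete : ∀ {v ts} → v ∈ ts → HitSink ts v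
    hits-complete {v} {.v ∷ ts} (here refl) rewrite gap-refl (toℕ v) = _ , +-comm _ 1
    hits-complete {v} {t ∷ ts} (there v∈) with hits v ts | hits-complete v∈
    ... | .(suc h) | h , refl = _ , refl

    sinks-acc : ∀ cs {v ts} → v ∈ ts → v ∈ sinks cs ts
    sinks-acc []                 v∈ = v∈
    sinks-acc ((s , t , P) ∷ cs) v∈ = sinks-acc cs (there v∈)

    sinks-∈ : ∀ {cs s t P ts} → (s , t , P) ∈ cs → t ∈ sinks cs ts
    sinks-∈ {_ ∷ cs} (here refl) = sinks-acc cs (here refl)
    sinks-∈ {_ ∷ cs} (there c∈)  = sinks-∈ c∈

    length-sinks : ∀ cs ts → length (sinks cs ts) ≡ length cs + length ts
    length-sinks []                 ts = refl
    length-sinks ((s , t , P) ∷ cs) ts = trans (length-sinks cs (t ∷ ts)) (+-suc _ _)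

    module _ (ts : List (Fin n)) where

      innerSegs : List (Fin n) → Segs → Segs
      innerSegs []       L = L
      innerSegs (m ∷ ms) L = candidateSeg (hits m ts) m (innerSegs ms L)

      routeSegs : Route (Fin n) → Segs → Segs
      routeSegs (single _)    L = L
      routeSegs (long a ms b) L = fix a ∷ innerSegs ms (fix b ∷ L)

      comSegs : List Com → Segs
      comSegs []                 = []
      comSegs ((s , t , P) ∷ cs) = routeSegs P (comSegs cs)

      marked-inner : ∀ ms is L → marked ts (innerItems ms is) L ≡ marked ts is (innerSegs ms L)
      marked-inner []       is L = refl
      marked-inner (m ∷ ms) is L = marked-inner ms ((false , m) ∷ is) L

      marked-route : ∀ P is L → marked ts (routeItems P is) L ≡ marked ts is (routeSegs P L)
      marked-route (single _)    is L = refl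
      marked-route (long a ms b) is L = marked-inner ms ((true , a) ∷ is) (fix b ∷ L)

      -- Reading the instance stacks the path vertices in reverse and marking reverses them once
      -- more, so the segments end up in the order of the instance.
      marked-coms : ∀ cs is → marked ts (comItems cs is) [] ≡ marked ts is (comSegs cs)
      marked-coms []                 is = refl
      marked-coms ((s , t , P) ∷ cs) is = trans (marked-coms cs (routeItems P is)) (marked-route P is (comSegs cs))

      -- `shape` is quantified over `a` because the vertex preceding the rest of the walk changes
      -- whenever an inner vertex is taken.
      record Split (ms : List (Fin n)) (b : Fin n) (L₀ L : Segs) : Set where
        field
          {xs}  : List (Fin n)
          {L′}  : Segs
          sub   : Sub xs ms
          sinky : All (HitSink ts) xs
          same  : Same L₀ L′
          shape : ∀ a → a ∷ kept L ≡ dup a xs b (kept L′)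

      open Split

      split : ∀ ms {b L₀ L} → Same (innerSegs ms (fix b ∷ L₀)) L → Split ms b L₀ L
      split [] (fix s) = record { sub = [] ; sinky = [] ; same = s ; shape = λ a → refl }
      split (m ∷ ms) s with hits m ts in h
      split (m ∷ ms) s | zero = record { sub = skip (sub X) ; sinky = sinky X ; same = same X ; shape = shape X }
        where X = split ms s
      split (m ∷ ms) (opt {b′ = false} s) | suc _ = record { sub = skip (sub X) ; sinky = sinky X ; same = same X ; shape = shape X }
        where X = split ms s
      split (m ∷ ms) (opt {b′ = true} s) | suc _ = record
        { sub = take (sub X) ; sinky = (_ , h) ∷ sinky X ; same = same X ; shape = λ a → cong (λ ks → a ∷ m ∷ ks) (shape X m) }
        where X = split ms s

      same-selects : ∀ cs {L} → Same (comSegs cs) L → Selects (HitSink ts) cs (kept L)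
      same-selects [] [] = []
      same-selects ((s , t , single a) ∷ cs) p = single (same-selects cs p)
      same-selects ((s , t , long a ms b) ∷ cs) (fix p) =
        subst (Selects (HitSink ts) _) (sym (shape X a)) (long (sub X) (sinky X) (same-selects cs (same X)))
        where X = split ms p

      unsplit : ∀ {xs ms} → Sub xs ms → All (HitSink ts) xs → ∀ {b L₀ L′} → Same L₀ L′ →
                ∃ λ L → Same (innerSegs ms (fix b ∷ L₀)) L × (∀ a → a ∷ kept L ≡ dup a xs b (kept L′))
      unsplit [] [] s = _ , fix s , λ a → refl
      unsplit (skip {x} sub) al {b} s with hits x ts | unsplit sub al {b} s
      ... | zero  | L , s′ , e = L , s′ , e
      ... | suc _ | L , s′ , e = opt false x ∷ L , opt s′ , e
      unsplit (take {x} sub) (sx ∷ al) {b} s with hits x ts | sx | unsplit sub al {b} s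
      ... | .(suc h) | h , refl | L , s′ , e = opt true x ∷ L , opt s′ , λ a → cong (λ ks → a ∷ x ∷ ks) (e x)

      selects-same : ∀ {cs ks} → Selects (HitSink ts) cs ks → ∃ λ L → Same (comSegs cs) L × kept L ≡ ks
      selects-same []         = [] , [] , refl
      selects-same (single s) = selects-same s
      selects-same (long sub al s) with selects-same s
      ... | L′ , same′ , refl with unsplit sub al same′
      ...   | L , same″ , e = fix _ ∷ L , fix same″ , e _

    data Even : List (Fin n) → Set where
      []   : Even []
      pair : ∀ {a b ks} → Even ks → Even (a ∷ b ∷ ks)

    even-dup : ∀ a xs b {ks} → Even ks → Even (dup a xs b ks)
    even-dup a []       b e = pair e
    even-dup a (x ∷ xs) b e = pair (even-dup x xs b e)

    selects-even : ∀ {Sink cs ks} → Selects Sink cs ks → Even ks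
    selects-even []             = []
    selects-even (single s)     = selects-even s
    selects-even (long {xs = xs} _ _ s) = even-dup _ xs _ (selects-even s)

    -- The filter reverses the kept sequence onto stack x, hence the accumulator and the successor
    -- in first place. A lone last vertex would be lost; `Even` excludes it.
    pairUp : List (Fin n) → Pairs → Pairs
    pairUp (v ∷ h ∷ ks) acc = pairUp ks ((h , v) ∷ acc)
    pairUp _            acc = acc

    pairs-pairUp : ∀ {ks} → Even ks → ∀ acc → rnums ks ʳ++ pairs acc ≡ pairs (pairUp ks acc)
    pairs-pairUp [] acc = refl
    pairs-pairUp (pair {v} {h} e) acc =
      trans (ones-ʳ++ (toℕ v) _ _) (trans (ones-ʳ++ (toℕ h) _ _) (pairs-pairUp e ((h , v) ∷ acc)))

    pairUp-acc : ∀ {ks} → Even ks → ∀ {acc p} → p ∈ acc → p ∈ pairUp ks acc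
    pairUp-acc []       p∈ = p∈
    pairUp-acc (pair e) p∈ = pairUp-acc e (there p∈)

    adj-pairUp : ∀ {ks} → Even ks → ∀ {acc v h} → Adj ks v h → (h , v) ∈ pairUp ks acc
    adj-pairUp (pair e) here      = pairUp-acc e (here refl)
    adj-pairUp (pair e) (there p) = adj-pairUp e p

    pairUp-adj : ∀ {ks} → Even ks → ∀ {acc v h} → (h , v) ∈ pairUp ks acc → Adj ks v h ⊎ (h , v) ∈ acc
    pairUp-adj []       p∈ = inj₂ p∈
    pairUp-adj (pair e) p∈ with pairUp-adj e p∈
    ... | inj₁ p           = inj₁ (there p)
    ... | inj₂ (here refl) = inj₁ here
    ... | inj₂ (there q)   = inj₂ q

    length-pairUp : ∀ ks acc → length (pairUp ks acc) ≤ length ks + length acc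
    length-pairUp []           acc = ≤-refl
    length-pairUp (_ ∷ [])     acc = n≤1+n _
    length-pairUp (v ∷ h ∷ ks) acc = ≤-trans (length-pairUp ks _) (≤-trans (≤-reflexive (+-suc _ _)) (n≤1+n _))

    clashes-sound : ∀ u v es → clashes u v es ≡ 0 → ∀ {h} → (h , v) ∈ es → h ≡ u
    clashes-sound u v ((h , .v) ∷ es) e (here refl) =
      toℕ-injective (gap≡0 (toℕ h) (toℕ u) (sgn≡0 (trans (cong (clash (gap (toℕ h) (toℕ u))) (sym (gap-refl (toℕ v)))) (m+n≡0⇒n≡0 (clashes u v es) e))))
      where
      sgn≡0 : ∀ {m} → clash m 0 ≡ 0 → m ≡ 0
      sgn≡0 {zero} _ = refl
    clashes-sound u v (_ ∷ es) e (there p∈) = clashes-sound u v es (m+n≡0⇒m≡0 (clashes u v es) e) p∈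

    clashes-complete : ∀ u v es → (∀ {h} → (h , v) ∈ es → h ≡ u) → clashes u v es ≡ 0
    clashes-complete u v []             f = refl
    clashes-complete u v ((h , t) ∷ es) f rewrite clashes-complete u v es (λ p∈ → f (there p∈))
      with gap (toℕ t) (toℕ v) in g
    ... | suc _ = refl
    ... | zero with toℕ-injective (gap≡0 (toℕ t) (toℕ v) g)
    ...   | refl with f (here refl)
    ...     | refl rewrite gap-refl (toℕ h) = refl

    allClashes-sound : ∀ es → allClashes es ≡ 0 → ∀ {v h h′} → (h , v) ∈ es → (h′ , v) ∈ es → h ≡ h′
    allClashes-sound ((u , v) ∷ es) e (here refl) (here refl) = refl
    allClashes-sound ((u , v) ∷ es) e (here refl) (there q)   = sym (clashes-sound u v es (m+n≡0⇒n≡0 (allClashes es) e) q)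
    allClashes-sound ((u , v) ∷ es) e (there p)   (here refl) = clashes-sound u v es (m+n≡0⇒n≡0 (allClashes es) e) p
    allClashes-sound ((u , v) ∷ es) e (there p)   (there q)   = allClashes-sound es (m+n≡0⇒m≡0 (allClashes es) e) p q

    allClashes-complete : ∀ es → (∀ {v h h′} → (h , v) ∈ es → (h′ , v) ∈ es → h ≡ h′) → allClashes es ≡ 0
    allClashes-complete []             f = refl
    allClashes-complete ((u , v) ∷ es) f = cong₂ _+_ (allClashes-complete es (λ p q → f (there p) (there q)))
      (clashes-complete u v es (λ p∈ → f (there p∈) (here refl)))

open Correctness

-- The number of candidates and the lengths of all lists

module Counting where

  unique-length : ∀ {A : Set} {xs ts : List A} → Unique xs → (∀ {x} → x ∈ xs → x ∈ ts) → length xs ≤ length ts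
  unique-length {xs = []} _ _ = z≤n
  unique-length {xs = x ∷ xs} (x∉ ∷ q) f with ∈-∃++ (f (here refl))
  ... | ys , zs , refl = ≤-trans (s≤s (unique-length q g))
    (≤-reflexive (trans (cong suc (length-++ ys)) (trans (sym (+-suc (length ys) (length zs))) (sym (length-++ ys)))))
    where
    g : ∀ {y} → y ∈ xs → y ∈ ys ++ zs
    g {y} y∈ with ∈-++⁻ ys (f (there y∈))
    ... | inj₁ p         = ∈-++⁺ˡ p
    ... | inj₂ (here e)  = contradiction (sym e) (All.lookup x∉ y∈)
    ... | inj₂ (there p) = ∈-++⁺ʳ ys p

  unique-init : ∀ {A : Set} xs {ys : List A} → Unique (xs ++ ys) → Unique xs
  unique-init []       _       = []
  unique-init (x ∷ xs) (a ∷ q) = All.tabulate (λ y∈ → All.lookup a (∈-++⁺ˡ y∈)) ∷ unique-init xs q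

  opts : ∀ {A : Set} → List (Seg A) → ℕ
  opts []            = 0
  opts (fix _ ∷ L)   = opts L
  opts (opt _ _ ∷ L) = suc (opts L)

  remaining< : ∀ {A : Set} (L : List (Seg A)) → remaining L < 2 ^ opts L
  remaining< []                = ≤-refl
  remaining< (fix v ∷ L)       = remaining< L
  remaining< (opt b v ∷ L) = ≤-trans (at-most b) (≤-trans (≤-reflexive (double (remaining L))) (*-monoʳ-≤ 2 (remaining< L)))
    where
    at-most : ∀ b → suc (remaining (opt b v ∷ L)) ≤ 2 + (remaining L + remaining L)
    at-most true  = s≤s (n≤1+n _)
    at-most false = ≤-refl
    double : ∀ r → 2 + (r + r) ≡ 2 * suc r
    double = solve-∀

  data AllOff {A : Set} : List (Seg A) → Set where
    []  : AllOff []
    fix : ∀ {v L} → AllOff L → AllOff (fix v ∷ L)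
    opt : ∀ {v L} → AllOff L → AllOff (opt false v ∷ L)

  -- A counter started with all flags off has the largest value, so the negative answer of the
  -- search extends to every candidate.
  off-maximal : ∀ {A : Set} {L₀ L : List (Seg A)} → AllOff L₀ → Same L₀ L → remaining L ≤ remaining L₀
  off-maximal []      []                 = z≤n
  off-maximal (fix o) (fix s)            = off-maximal o s
  off-maximal (opt o) (opt {b′ = true} s)  = ≤-trans (+-mono-≤ (off-maximal o s) (off-maximal o s)) (n≤1+n _)
  off-maximal (opt o) (opt {b′ = false} s) = s≤s (+-mono-≤ (off-maximal o s) (off-maximal o s))

  Same-length : ∀ {A : Set} {L₀ L : List (Seg A)} → Same L₀ L → length L ≡ length L₀
  Same-length []      = refl
  Same-length (fix s) = cong suc (Same-length s)
  Same-length (opt s) = cong suc (Same-length s)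

  module Count (B n : ℕ) (n≤B : n ≤ B) where

    open Correct B n n≤B public

    length-unique : {xs : List (Fin n)} → Unique xs → length xs ≤ n
    length-unique q = ≤-trans (unique-length q (λ {x} _ → ∈-allFin x)) (≤-reflexive (length-tabulate (λ i → i)))

    UniqueRoutes : List Com → Set
    UniqueRoutes cs = ∀ {s t P} → (s , t , P) ∈ cs → Unique (vertices P)

    module _ (ts : List (Fin n)) where

      hitsOf : List (Fin n) → List (Fin n)
      hitsOf [] = []
      hitsOf (m ∷ ms) with hits m ts
      ... | zero  = hitsOf ms
      ... | suc _ = m ∷ hitsOf ms

      hitsOf-∈ : ∀ ms {x} → x ∈ hitsOf ms → x ∈ ms × x ∈ ts
      hitsOf-∈ (m ∷ ms) x∈ with hits m ts in e
      hitsOf-∈ (m ∷ ms) x∈          | zero  = let (p , q) = hitsOf-∈ ms x∈ in there p , q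
      hitsOf-∈ (m ∷ ms) (here refl) | suc _ = here refl , hits-sound m ts e
      hitsOf-∈ (m ∷ ms) (there x∈)  | suc _ = let (p , q) = hitsOf-∈ ms x∈ in there p , q

      hitsOf-unique : ∀ {ms} → Unique ms → Unique (hitsOf ms)
      hitsOf-unique [] = []
      hitsOf-unique {m ∷ ms} (a ∷ q) with hits m ts
      ... | zero  = hitsOf-unique q
      ... | suc _ = All.tabulate (λ y∈ → All.lookup a (proj₁ (hitsOf-∈ ms y∈))) ∷ hitsOf-unique q

      opts-inner : ∀ ms L → opts (innerSegs ts ms L) ≡ length (hitsOf ms) + opts L
      opts-inner []       L = refl
      opts-inner (m ∷ ms) L with hits m ts
      ... | zero  = opts-inner ms L
      ... | suc _ = cong suc (opts-inner ms L)

      -- The optional vertices of one path are distinct members of `ts`. With one target per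
      -- commodity in `ts` this gives the exponent `k * k`.
      opts-coms : ∀ cs → UniqueRoutes cs → opts (comSegs ts cs) ≤ length cs * length ts
      opts-coms [] _ = z≤n
      opts-coms ((s , t , single a) ∷ cs) q = ≤-trans (opts-coms cs (λ c∈ → q (there c∈))) (m≤n+m _ (length ts))
      opts-coms ((s , t , long a ms b) ∷ cs) q = ≤-trans (≤-reflexive (opts-inner ms _))
        (+-mono-≤ (unique-length (hitsOf-unique (inner (q (here refl)))) (λ x∈ → proj₂ (hitsOf-∈ ms x∈)))
                  (opts-coms cs (λ c∈ → q (there c∈))))
        where
        inner : Unique (a ∷ (ms ++ (b ∷ []))) → Unique ms
        inner (_ ∷ q) = unique-init ms q

      off-inner : ∀ ms {L} → AllOff L → AllOff (innerSegs ts ms L)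
      off-inner []       o = o
      off-inner (m ∷ ms) o with hits m ts
      ... | zero  = off-inner ms o
      ... | suc _ = opt (off-inner ms o)

      off-coms : ∀ cs → AllOff (comSegs ts cs)
      off-coms []                            = []
      off-coms ((s , t , single a) ∷ cs)     = off-coms cs
      off-coms ((s , t , long a ms b) ∷ cs)  = fix (off-inner ms (fix (off-coms cs)))

      length-inner : ∀ ms L → length (innerSegs ts ms L) ≤ length ms + length L
      length-inner []       L = ≤-refl
      length-inner (m ∷ ms) L with hits m ts
      ... | zero  = ≤-trans (length-inner ms L) (n≤1+n _)
      ... | suc _ = s≤s (length-inner ms L)

      length-comSegs : ∀ cs → UniqueRoutes cs → length (comSegs ts cs) ≤ length cs * n
      length-comSegs [] _ = z≤n
      length-comSegs ((s , t , single a) ∷ cs) q = ≤-trans (length-comSegs cs (λ c∈ → q (there c∈))) (m≤n+m _ n)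
      length-comSegs ((s , t , long a ms b) ∷ cs) q = ≤-trans (s≤s (length-inner ms _))
        (≤-trans (≤-reflexive (trans (cong suc (sym (+-assoc (length ms) 1 _))) (cong (λ l → suc (l + length (comSegs ts cs))) (sym (length-++ ms)))))
          (+-mono-≤ (length-unique (q (here refl))) (length-comSegs cs (λ c∈ → q (there c∈)))))

    length-innerItems : ∀ ms is → length (innerItems ms is) ≡ length ms + length is
    length-innerItems []       is = refl
    length-innerItems (m ∷ ms) is = trans (length-innerItems ms _) (+-suc (length ms) (length is))

    length-routeItems : ∀ P is → length (routeItems P is) ≤ length (vertices P) + length is
    length-routeItems (single a)    is = n≤1+n _
    length-routeItems (long a ms b) is = ≤-reflexive (cong suc (trans (length-innerItems ms _)
      (trans (sym (+-assoc (length ms) 1 (length is))) (cong (_+ length is) (sym (length-++ ms))))))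

    length-comItems : ∀ cs is → UniqueRoutes cs → length (comItems cs is) ≤ length cs * n + length is
    length-comItems [] is _ = ≤-refl
    length-comItems ((s , t , P) ∷ cs) is q = ≤-trans (length-comItems cs (routeItems P is) (λ c∈ → q (there c∈)))
      (≤-trans (+-monoʳ-≤ (length cs * n) (≤-trans (length-routeItems P is) (+-monoˡ-≤ (length is) (length-unique (q (here refl))))))
        (≤-reflexive (regroup (length cs * n) n (length is))))
      where
      regroup : ∀ a b c → a + (b + c) ≡ b + a + c
      regroup = solve-∀

    length-kept : ∀ L → length (kept L) ≤ length L + length L
    length-kept []                = z≤n
    length-kept (fix v ∷ L)       = s≤s (≤-trans (length-kept L) (+-monoʳ-≤ (length L) (n≤1+n _)))
    length-kept (opt true v ∷ L)  = s≤s (≤-trans (s≤s (length-kept L)) (≤-reflexive (sym (+-suc _ _))))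
    length-kept (opt false v ∷ L) = ≤-trans (length-kept L) (+-mono-≤ (n≤1+n _) (n≤1+n _))

    short-routes : ∀ cs → UniqueRoutes cs → ShortRoutes cs
    short-routes []                 _ = tt
    short-routes ((s , t , P) ∷ cs) q = ≤-trans (length-unique (q (here refl))) n≤B , short-routes cs (λ c∈ → q (there c∈))

    edgesOf : Segs → Pairs
    edgesOf L = pairUp (kept L) []

    module _ (E : EdgeList n) (cs : List Com) (valid : Valid E cs)
             (E≤ : length E ≤ B) (cs≤ : length cs ≤ B) (2kn≤B : length cs * n + length cs * n ≤ B) where

      private
        ts : List (Fin n)
        ts = sinks cs []

        unique : UniqueRoutes cs
        unique c∈ = proj₂ (valid c∈)

        initial : initialSegs cs ≡ comSegs ts cs
        initial = marked-coms ts cs []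

        kn≤B : length cs * n ≤ B
        kn≤B = ≤-trans (m≤m+n _ _) 2kn≤B

        selected : ∀ {L} → Same (initialSegs cs) L → Selects (HitSink ts) cs (kept L)
        selected {L} s = same-selects ts cs (subst (λ L₀ → Same L₀ L) initial s)

        length≤ : ∀ L → Same (initialSegs cs) L → length L ≤ length cs * n
        length≤ L s = ≤-trans (≤-reflexive (trans (Same-length s) (cong length initial))) (length-comSegs ts cs unique)

        ts≡ : length ts ≡ length cs
        ts≡ = trans (length-sinks cs []) (+-identityʳ _)

      remaining-initial : suc (remaining (initialSegs cs)) ≤ 2 ^ (length cs * length cs)
      remaining-initial = subst (λ L → suc (remaining L) ≤ 2 ^ (length cs * length cs)) (sym initial)
        (≤-trans (remaining< (comSegs ts cs)) (^-monoʳ-≤ 2 (≤-trans (opts-coms ts cs unique) (≤-reflexive (cong (length cs *_) ts≡)))))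

      decide-one : Verdict program (inputStacks 1 E cs) (cSearch (remaining (initialSegs cs)))
                           (∃ (Solves E 1 cs)) (¬ ∃ (Solves E 1 cs))
      decide-one with program-one E cs E≤ cs≤ (short-routes cs unique)
        (≤-trans (≤-reflexive ts≡) cs≤) (≤-trans (length-comItems cs [] unique) (≤-trans (≤-reflexive (+-identityʳ _)) kn≤B)) edgesOf
        (λ L s → pairs-pairUp (selects-even (selected s)) [])
        (λ L s → ≤-trans (length-pairUp (kept L) []) (≤-trans (≤-reflexive (+-identityʳ _)) (≤-trans (length-kept L)
          (≤-trans (+-mono-≤ (length≤ L s) (length≤ L s)) 2kn≤B))))
        (λ L s → ≤-trans (length≤ L s) kn≤B)
      ... | accepts r a (L , s , e) = accepts r a (graphOf (kept L) ,
        sound (selected s) valid (λ p q → allClashes-sound (edgesOf L) e (adj-pairUp even p) (adj-pairUp even q)))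
        where
        even : Even (kept L)
        even = selects-even (selected s)
      ... | rejects r a none = rejects r a refute
        where
        refute : ¬ ∃ (Solves E 1 cs)
        refute (H , _ , deg , stars)
          with complete (hitSink? ts) (λ c∈ → hits-complete (sinks-∈ c∈)) valid stars
        ... | ks , sel , nx with selects-same ts sel
        ...   | L , s , refl = none L s′ (subst (λ L₀ → remaining L ≤ remaining L₀) (sym initial) (off-maximal (off-coms ts cs) s))
                (allClashes-complete (edgesOf L) (λ p q → next-functional H (HitSink ts) deg (nx (adj p)) (nx (adj q))))
          where
          s′ : Same (initialSegs cs) L
          s′ = subst (λ L₀ → Same L₀ L) (sym initial) s
          adj : ∀ {v h} → (h , v) ∈ edgesOf L → Adj (kept L) v h
          adj p with pairUp-adj (selects-even sel) p
          ... | inj₁ q = q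

      decide-zero : Verdict program (inputStacks 0 E cs) (cParse + 3) (∃ (Solves E 0 cs)) (¬ ∃ (Solves E 0 cs))
      decide-zero with program-zero E cs E≤ cs≤ (short-routes cs unique)
      ... | accepts r a none = accepts r a (_ , solve-zero valid (noItems-single cs none))
      ... | rejects r a some = rejects r a (λ { (H , s) → some (single-noItems cs (zero-single valid s)) })

open Counting

-- Polynomial bounds and the encoding of instances

module Encoding where

  -- A single power suffices as normal form: its base is at least 2, so the sum of two bounds is
  -- absorbed by one more factor.
  IsPoly : (ℕ → ℕ) → Set
  IsPoly f = ∃ λ c → ∀ s → f s ≤ (2 + s) ^ c

  pow-mono : ∀ s {c d} → c ≤ d → (2 + s) ^ c ≤ (2 + s) ^ d
  pow-mono s = ^-monoʳ-≤ (2 + s)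

  poly-const : ∀ k → IsPoly (λ _ → k)
  poly-const k = k , λ s → ≤-trans (k≤2^k k) (^-monoˡ-≤ k (m≤m+n 2 s))
    where
    k≤2^k : ∀ k → k ≤ 2 ^ k
    k≤2^k zero    = z≤n
    k≤2^k (suc k) = ≤-trans (+-mono-≤ (m^n>0 2 k) (k≤2^k k)) (≤-reflexive (cong (2 ^ k +_) (sym (+-identityʳ _))))

  poly-id : IsPoly (λ s → s)
  poly-id = 1 , λ s → ≤-trans (m≤n+m s 2) (≤-reflexive (sym (*-identityʳ (2 + s))))

  poly-+ : ∀ {f g} → IsPoly f → IsPoly g → IsPoly (λ s → f s + g s)
  poly-+ (c , p) (d , q) = suc (c + d) , λ s → ≤-trans
    (+-mono-≤ (≤-trans (p s) (pow-mono s (m≤m+n c d))) (≤-trans (q s) (pow-mono s (m≤n+m d c))))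
    (≤-trans (≤-reflexive (cong ((2 + s) ^ (c + d) +_) (sym (+-identityʳ _)))) (*-monoˡ-≤ ((2 + s) ^ (c + d)) (m≤m+n 2 s)))

  poly-* : ∀ {f g} → IsPoly f → IsPoly g → IsPoly (λ s → f s * g s)
  poly-* (c , p) (d , q) = c + d , λ s → ≤-trans (*-mono-≤ (p s) (q s)) (≤-reflexive (sym (^-distribˡ-+-* (2 + s) c d)))

  poly-suc : ∀ {f} → IsPoly f → IsPoly (λ s → suc (f s))
  poly-suc p = poly-+ (poly-const 1) p

  module _ {B : ℕ → ℕ} (pB : IsPoly B) where

    private
      -- The step counts depend on `B` alone, so `n = 0` stands for every number of vertices.
      module C (s : ℕ) = Count (B s) 0 z≤n

      affine : ∀ {c d : ℕ → ℕ} → IsPoly c → IsPoly d → IsPoly (λ s → B s * c s + d s)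
      affine pc pd = poly-+ (poly-* pB pc) pd

      lin : ∀ c d → IsPoly (λ s → C.lin s c d)
      lin c d = affine (poly-const c) (poly-const d)

      twice : ∀ {f} → IsPoly f → IsPoly (λ s → f s * 2 + 2)
      twice p = poly-+ (poly-* p (poly-const 2)) (poly-const 2)

      pScanBody : IsPoly C.cScanBody
      pScanBody = poly-+ (lin 6 7) (poly-+ (lin 6 7) (lin 4 8))

      pScan : IsPoly C.cScan
      pScan = poly-+ (affine (poly-+ (poly-const 2) pScanBody) (poly-const 2)) (twice (poly-* pB (poly-+ (lin 1 1) (lin 1 1))))

      pCheckBody : IsPoly C.cCheckBody
      pCheckBody = poly-+ (lin 2 2) (poly-+ (lin 2 2) (poly-+ pScan (poly-+ (lin 2 2) (lin 2 2))))

      pCheck : IsPoly C.cCheck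
      pCheck = affine (poly-+ (poly-const 2) pCheckBody) (poly-const 2)

      pMove : IsPoly C.cMove
      pMove = twice (poly-* pB (lin 2 3))

      pSelect : IsPoly C.cSelect
      pSelect = poly-+ (affine (lin 8 15) (poly-const 2)) (poly-+ (poly-const 4) pMove)

      pIncrement : IsPoly C.cIncrement
      pIncrement = poly-+ (affine (lin 4 6) (poly-const 3)) (poly-+ pMove pMove)

      pCandidate : IsPoly C.cCandidate
      pCandidate = poly-+ pSelect (poly-+ pCheck (poly-suc (poly-+ (twice (poly-* pB pB)) pIncrement)))

      pMember : IsPoly C.cMember
      pMember = poly-+ (affine (poly-+ (poly-const 2) (poly-+ (lin 6 7) (lin 2 3))) (poly-const 2)) (twice (poly-* pB (lin 1 1)))

      pMark : IsPoly C.cMark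
      pMark = poly-+ (lin 2 2) (poly-+ pMember (poly-suc (poly-+ (lin 2 2) (poly-+ (lin 3 2)
        (poly-+ (poly-const 1) (poly-+ (lin 2 2) (poly-const 2)))))))

      pItem : IsPoly C.cItem
      pItem = poly-+ (poly-const 1) (poly-+ (lin 2 2) (poly-const 1))

      pRoute : IsPoly C.cRoute
      pRoute = poly-+ pItem (poly-+ (affine (poly-suc pItem) (poly-const 2)) pItem)

      pCom : IsPoly C.cCom
      pCom = poly-+ (lin 2 2) (poly-+ (poly-const 1) (poly-+ (lin 2 2) (poly-+ (lin 2 2) (poly-+ (poly-const 2) (poly-suc pRoute)))))

      pParse : IsPoly C.cParse
      pParse = poly-+ (lin 2 2) (poly-+ (poly-const 4) (poly-+ (lin 2 2) (poly-+
        (affine (poly-suc (poly-+ (lin 2 2) (lin 2 2))) (poly-const 2)) (poly-+ (lin 2 2) (affine (poly-suc pCom) (poly-const 2))))))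

    poly-search : IsPoly (λ s → C.cSearch s 0)
    poly-search = poly-+ pParse (poly-suc (poly-+ (affine (poly-suc pMark) (poly-const 2))
      -- The summand 0 comes from unfolding `1 * suc cCandidate`.
      (poly-+ (poly-const 1) (poly-+ (poly-+ (poly-suc pCandidate) (poly-const 0)) (poly-const 2)))))

  map-unary : ∀ k w → map bit (unary k ++ w) ≡ ones k (O ∷ map bit w)
  map-unary zero    w = refl
  map-unary (suc k) w = cong (I ∷_) (map-unary k w)

  unsnoc : ∀ {A : Set} → A → List A → List A × A
  unsnoc b []       = [] , b
  unsnoc b (x ∷ xs) = let (ms , l) = unsnoc x xs in b ∷ ms , l

  unsnoc-snoc : ∀ {A : Set} (b : A) xs → proj₁ (unsnoc b xs) ++ (proj₂ (unsnoc b xs) ∷ []) ≡ b ∷ xs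
  unsnoc-snoc b []       = refl
  unsnoc-snoc b (x ∷ xs) = cong (b ∷_) (unsnoc-snoc x xs)

  -- The default only serves the empty list, which is never a valid path; `faithful` excludes it.
  toRoute : ∀ {A : Set} → A → List A → Route A
  toRoute d []           = single d
  toRoute d (a ∷ [])     = single a
  toRoute d (a ∷ b ∷ xs) = long a (proj₁ (unsnoc b xs)) (proj₂ (unsnoc b xs))

  module Encode (B n : ℕ) (n≤B : n ≤ B) where

    open Count B n n≤B public

    toCom : Commodity n → Com
    toCom (s , t , P) = s , t , toRoute s P

    map-edges : ∀ E w → map bit (concatMap encEdge E ++ w) ≡ edgeNums E (map bit w)
    map-edges []            w = refl
    map-edges ((u , v) ∷ E) w = begin
      map bit (((unary (toℕ u) ++ unary (toℕ v)) ++ concatMap encEdge E) ++ w)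
        ≡⟨ cong (map bit) (trans (++-assoc (unary (toℕ u) ++ unary (toℕ v)) _ w) (++-assoc (unary (toℕ u)) (unary (toℕ v)) _)) ⟩
      map bit (unary (toℕ u) ++ unary (toℕ v) ++ concatMap encEdge E ++ w)
        ≡⟨ map-unary (toℕ u) _ ⟩
      ones (toℕ u) (O ∷ map bit (unary (toℕ v) ++ concatMap encEdge E ++ w))
        ≡⟨ cong (num u) (trans (map-unary (toℕ v) _) (cong (num v) (map-edges E w))) ⟩
      num u (num v (edgeNums E (map bit w))) ∎
      where open ≡-Reasoning

    map-vertices : ∀ P w → map bit (concatMap encVertex P ++ w) ≡ nums P (map bit w)
    map-vertices []      w = refl
    map-vertices (v ∷ P) w = trans (cong (map bit) (++-assoc (unary (toℕ v)) _ w))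
      (trans (map-unary (toℕ v) _) (cong (num v) (map-vertices P w)))

    map-com : ∀ s t P w → map bit (encCommodity (s , t , P) ++ w) ≡ num s (num t (ones (length P) (O ∷ nums P (map bit w))))
    map-com s t P w = begin
      map bit ((unary (toℕ s) ++ unary (toℕ t) ++ unary (length P) ++ concatMap encVertex P) ++ w)
        ≡⟨ cong (map bit) (trans (++-assoc (unary (toℕ s)) _ w) (cong (unary (toℕ s) ++_)
             (trans (++-assoc (unary (toℕ t)) _ w) (cong (unary (toℕ t) ++_) (++-assoc (unary (length P)) _ w))))) ⟩
      map bit (unary (toℕ s) ++ unary (toℕ t) ++ unary (length P) ++ concatMap encVertex P ++ w)
        ≡⟨ trans (map-unary (toℕ s) _) (cong (num s) (trans (map-unary (toℕ t) _) (cong (num t)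
             (trans (map-unary (length P) _) (cong (λ x → ones (length P) (O ∷ x)) (map-vertices P w)))))) ⟩
      num s (num t (ones (length P) (O ∷ nums P (map bit w)))) ∎
      where open ≡-Reasoning

    Faithful : List (Commodity n) → Set
    Faithful K = ∀ {s t P} → (s , t , P) ∈ K → vertices (toRoute s P) ≡ P

    map-coms : ∀ K → Faithful K → map bit (concatMap encCommodity K) ≡ coms (map toCom K)
    map-coms []                _ = refl
    map-coms ((s , t , P) ∷ K) f rewrite f (here refl) =
      trans (map-com s t P (concatMap encCommodity K))
        (cong (λ x → num s (num t (ones (length P) (O ∷ nums P x)))) (map-coms K (λ c∈ → f (there c∈))))

    map-encode : ∀ E T K → Faithful K →
      map bit (encode (record { n = n ; E = E ; T = T ; K = K })) ≡ input T E (map toCom K)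
    map-encode E T K f = begin
      map bit (unary n ++ unary T ++ (unary (length E) ++ concatMap encEdge E) ++ (unary (length K) ++ concatMap encCommodity K))
        ≡⟨ trans (map-unary n _) (cong (λ x → ones n (O ∷ x)) (trans (map-unary T _) (cong (λ x → ones T (O ∷ x))
             (trans (cong (map bit) (++-assoc (unary (length E)) (concatMap encEdge E) _)) (trans (map-unary (length E) _) (cong (λ x → ones (length E) (O ∷ x))
             (trans (map-edges E _) (cong (edgeNums E) (trans (map-unary (length K) _)
               (cong (λ x → ones (length K) (O ∷ x)) (map-coms K f))))))))))) ⟩
      ones n (O ∷ ones T (O ∷ ones (length E) (O ∷ edgeNums E (ones (length K) (O ∷ coms (map toCom K))))))
        ≡⟨ cong (λ l → ones n (O ∷ ones T (O ∷ ones (length E) (O ∷ edgeNums E (ones l (O ∷ coms (map toCom K))))))) (sym (length-map toCom K)) ⟩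
      input T E (map toCom K) ∎
      where open ≡-Reasoning

open Encoding

-- The time bound and the final decision

module Decision where

  module Solver = Compile (finiteLabel program) (codeOf program) (entry program)

  factor : ℕ → ℕ
  factor k = 2 ^ (k * k)

  -- The bound `B` has to dominate the number of edges of a candidate, estimated by `2 * k * n`;
  -- both `k` and `n` are at most the input size.
  box : ℕ → ℕ
  box s = s * s + s * s

  ≤box : ∀ s → 2 ≤ s → s ≤ box s
  ≤box s 2≤s = ≤-trans (≤-reflexive (sym (*-identityˡ s))) (≤-trans (*-monoˡ-≤ s (≤-trans (n≤1+n 1) 2≤s)) (m≤m+n (s * s) (s * s)))

  -- The instruction count for a single candidate, which is the polynomial part of the running time.
  instructions : ℕ → ℕ
  instructions s = Count.cSearch (box s) 0 z≤n 0

  steps-bound : ℕ → ℕ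
  steps-bound s = 3 + instructions s * (2 * (s + instructions s) + 4)

  -- The final bound is a power of the size itself; since `2 + s ≤ s ^ 2` from 2 on, doubling the
  -- exponent is enough. Encodings have length at least 2 thanks to the delimiters of the two list
  -- lengths.
  poly-power : ∀ {f} → IsPoly f → ∃ λ c → ∀ s → 2 ≤ s → f s ≤ s ^ c
  poly-power (c , p) = 2 * c , λ s 2≤s → ≤-trans (p s) (≤-trans (^-monoˡ-≤ c (2+s≤s² s 2≤s)) (≤-reflexive (^-*-assoc s 2 c)))
    where
    2+s≤s² : ∀ s → 2 ≤ s → 2 + s ≤ s ^ 2
    2+s≤s² s 2≤s = ≤-trans (+-monoˡ-≤ s 2≤s) (≤-trans (≤-reflexive (cong (s +_) (sym (+-identityʳ s))))
      (≤-trans (*-monoˡ-≤ s 2≤s) (≤-reflexive (cong (s *_) (sym (*-identityʳ s))))))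

  -- The exponent is a huge numeral, which conversion checking must never unfold.
  abstract
    steps≤power : ∃ λ c → ∀ s → 2 ≤ s → steps-bound s ≤ s ^ c
    steps≤power = poly-power (poly-+ (poly-const 3) (poly-* pI (poly-+ (poly-* (poly-const 2) (poly-+ poly-id pI)) (poly-const 4))))
      where
      pI : IsPoly instructions
      pI = poly-search (poly-+ (poly-* poly-id poly-id) (poly-* poly-id poly-id))

  exponent : ℕ
  exponent = proj₁ steps≤power

  -- Only the cost `y` of a candidate is multiplied by the number of candidates; reading and marking
  -- are charged once per candidate as well, so that a common factor comes out.
  search-count : ∀ a x y m F → suc m ≤ F →
    a + suc (x + (1 + (suc m * y + 2))) ≤ F * (a + suc (x + (1 + (1 * y + 2))))
  search-count a x y m F le = ≤-trans (≤-reflexive (regroup a x (suc m * y)))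
    (≤-trans (+-monoˡ-≤ (suc m * y) (m≤m+n (a + x + 4) (m * (a + x + 4))))
    (≤-trans (≤-reflexive (collect a x y (suc m))) (*-monoˡ-≤ _ le)))
    where
    regroup : ∀ a x z → a + suc (x + (1 + (z + 2))) ≡ (a + x + 4) + z
    regroup = solve-∀
    collect : ∀ a x y m → m * (a + x + 4) + m * y ≡ m * (a + suc (x + (1 + (1 * y + 2))))
    collect = solve-∀

  zero-count : ∀ a x y F → 1 ≤ F → a + 3 ≤ F * (a + suc (x + (1 + (1 * y + 2))))
  zero-count a x y F le = ≤-trans (+-monoʳ-≤ a (s≤s (≤-trans (s≤s (≤-trans (n≤1+n 1) (m≤n+m 2 (1 * y)))) (m≤n+m (1 + (1 * y + 2)) x))))
    (≤-trans (≤-reflexive (sym (*-identityˡ _))) (*-monoˡ-≤ _ le))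

  search-bound : ∀ B n (n≤B : n ≤ B) m F → suc m ≤ F → Count.cSearch B n n≤B m ≤ F * Count.cSearch B 0 z≤n 0
  search-bound B n n≤B m F = search-count cParse (lin (suc cMark) 2) (suc cCandidate) m F
    where open Count B n n≤B

  zero-bound : ∀ B n (n≤B : n ≤ B) F → 1 ≤ F → Count.cParse B n n≤B + 3 ≤ F * Count.cSearch B 0 z≤n 0
  zero-bound B n n≤B F = zero-count cParse (lin (suc cMark) 2) (suc cCandidate) F
    where open Count B n n≤B

  -- `N` occurs twice in the simulation time, as the number of instructions and in the length of a
  -- sweep, so the factor `F` comes out squared.
  time-fits : ∀ s F Q N → 1 ≤ F → N ≤ F * Q →
    3 + N * (2 * (s + N) + 4) ≤ F * F * (3 + Q * (2 * (s + Q) + 4))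
  time-fits s F Q N 1≤F le = ≤-trans (+-mono-≤ (scale 3 1≤F²) (*-mono-≤ le inner)) (≤-reflexive (collect F Q (2 * (s + Q) + 4)))
    where
    scale : ∀ {G} a → 1 ≤ G → a ≤ G * a
    scale {G} a le = ≤-trans (≤-reflexive (sym (*-identityˡ a))) (*-monoˡ-≤ a le)
    1≤F² : 1 ≤ F * F
    1≤F² = *-mono-≤ 1≤F 1≤F
    inner : 2 * (s + N) + 4 ≤ F * (2 * (s + Q) + 4)
    inner = ≤-trans (+-mono-≤ (*-monoʳ-≤ 2 (+-mono-≤ (scale s 1≤F) le)) (scale 4 1≤F)) (≤-reflexive (distribute F s Q))
      where
      distribute : ∀ F s Q → 2 * (F * s + F * Q) + F * 4 ≡ F * (2 * (s + Q) + 4)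
      distribute = solve-∀
    collect : ∀ F Q z → F * F * 3 + F * Q * (F * z) ≡ F * F * (3 + Q * z)
    collect = solve-∀

  length-unary : ∀ k → length (unary k) ≡ suc k
  length-unary zero    = refl
  length-unary (suc k) = cong suc (length-unary k)

  module _ (I : Instance) where

    open Instance I

    private
      tailK tailE tailT : List Bool
      tailK = encList encCommodity K
      tailE = encList encEdge E ++ tailK
      tailT = unary T ++ tailE

    length-encList : ∀ {A : Set} (enc : A → List Bool) xs → suc (length xs) ≤ length (encList enc xs)
    length-encList enc xs = ≤-trans (≤-reflexive (sym (length-unary (length xs))))
      (≤-trans (m≤m+n _ _) (≤-reflexive (sym (length-++ (unary (length xs))))))

    size-n : suc n + length tailT ≡ size I
    size-n = trans (cong (_+ length tailT) (sym (length-unary n))) (sym (length-++ (unary n)))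

    E≤tailE : suc (length E) + suc (length K) ≤ length tailE
    E≤tailE = ≤-trans (+-mono-≤ (length-encList encEdge E) (length-encList encCommodity K)) (≤-reflexive (sym (length-++ (encList encEdge E))))

    tailE≤tailT : length tailE ≤ length tailT
    tailE≤tailT = ≤-trans (m≤n+m _ _) (≤-reflexive (sym (length-++ (unary T))))

    n≤size : n ≤ size I
    n≤size = ≤-trans (≤-trans (n≤1+n n) (m≤m+n (suc n) _)) (≤-reflexive size-n)

    E+K≤size : suc (length E) + suc (length K) ≤ size I
    E+K≤size = ≤-trans (≤-trans E≤tailE tailE≤tailT) (≤-trans (m≤n+m _ (suc n)) (≤-reflexive size-n))

    E≤size : length E ≤ size I
    E≤size = ≤-trans (≤-trans (n≤1+n _) (m≤m+n _ _)) E+K≤size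

    K≤size : length K ≤ size I
    K≤size = ≤-trans (≤-trans (n≤1+n _) (m≤n+m _ (suc (length E)))) E+K≤size

    2≤size : 2 ≤ size I
    2≤size = ≤-trans (+-mono-≤ (s≤s (z≤n {length E})) (s≤s (z≤n {length K}))) E+K≤size

    size≤box : size I ≤ box (size I)
    size≤box = ≤box (size I) 2≤size

    open Encode (box (size I)) n (≤-trans n≤size size≤box)

    private
      cs : List Com
      cs = map toCom K

    module _ (valid : ValidInstance I) where

      faithful : Faithful K
      faithful {s} {t} {P} c∈ with P | valid c∈
      ... | []         | () , _
      ... | a ∷ []     | _ = refl
      ... | a ∷ b ∷ xs | _ = cong (a ∷_) (unsnoc-snoc b xs)

      validComs : Valid E cs
      validComs c∈ with ∈-map⁻ toCom c∈
      ... | (s , t , P) , k∈ , refl = subst (IsDPath E s t) (sym (faithful k∈)) (valid k∈)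

      solves→MDSPP : ∃ (Solves E T cs) → MDSPP I
      solves→MDSPP (H , edges , deg , stars) = H , edges , deg , λ {s} {t} k∈ →
        subst (λ P → Star (HPEdge H P) s t) (faithful k∈) (stars (∈-map⁺ toCom k∈))

      MDSPP→solves : MDSPP I → ∃ (Solves E T cs)
      MDSPP→solves (H , edges , deg , stars) = H , edges , deg , stars′
        where
        stars′ : ∀ {s t P} → (s , t , P) ∈ cs → Star (HPEdge H (vertices P)) s t
        stars′ c∈ with ∈-map⁻ toCom c∈
        ... | (s , t , P) , k∈ , refl = subst (λ P → Star (HPEdge H P) s t) (sym (faithful k∈)) (stars k∈)

      Outcome : Set
      Outcome = (DecidesWithin Solver.machine (encode I) (factor (length K) * factor (length K) * size I ^ exponent) true × MDSPP I)
        ⊎ (DecidesWithin Solver.machine (encode I) (factor (length K) * factor (length K) * size I ^ exponent) false × ¬ MDSPP I)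

      F : ℕ
      F = factor (length K)

      decided : ∀ {τ N} → Runs program (inputStacks T E cs) τ N → N ≤ F * instructions (size I) →
                DecidesWithin Solver.machine (encode I) (F * F * size I ^ exponent) (answer (hd (lookup τ 0F)))
      decided {τ} {N} (runs n n≤N ex) le = Solver.decides
        (subst (λ σ → Exec (codeOf program) (just (entry program)) σ n τ) (cong (λ x → st x [] [] [] [] [] [] [] [] [] [] []) (sym (map-encode E T K faithful))) ex)
        (≤-trans (time-fits (size I) F (instructions (size I)) n (m^n>0 2 (length K * length K)) (≤-trans n≤N le))
          (*-monoʳ-≤ (F * F) (proj₂ steps≤power (size I) 2≤size)))

      outcome : ∀ {N} → N ≤ F * instructions (size I) →
                Verdict program (inputStacks T E cs) N (∃ (Solves E T cs)) (¬ ∃ (Solves E T cs)) → Outcome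
      outcome le (accepts r a y) = inj₁ (subst (DecidesWithin Solver.machine (encode I) (F * F * size I ^ exponent)) a (decided r le) , solves→MDSPP y)
      outcome le (rejects r a ¬y) = inj₂ (subst (DecidesWithin Solver.machine (encode I) (F * F * size I ^ exponent)) a (decided r le) , λ y → ¬y (MDSPP→solves y))

      private
        cs≡ : length cs ≡ length K
        cs≡ = length-map toCom K

        2kn≤box : length cs * n + length cs * n ≤ box (size I)
        2kn≤box = +-mono-≤ kn kn
          where
          kn : length cs * n ≤ size I * size I
          kn = *-mono-≤ (≤-trans (≤-reflexive cs≡) K≤size) n≤size

        E≤box : length E ≤ box (size I)
        E≤box = ≤-trans E≤size size≤box

        cs≤box : length cs ≤ box (size I)
        cs≤box = ≤-trans (≤-reflexive cs≡) (≤-trans K≤size size≤box)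

      solve : T ≤ 1 → Outcome
      -- `T` is a field of the instance, so the case split is made on a fresh copy linked to it by
      -- an equation.
      solve T≤1 = byTarget T refl T≤1
        where
        byTarget : ∀ T′ → T ≡ T′ → T′ ≤ 1 → Outcome
        byTarget zero e _ = outcome (zero-bound (box (size I)) n (≤-trans n≤size size≤box) F (m^n>0 2 (length K * length K)))
          (subst (λ T → Verdict program (inputStacks T E cs) (cParse + 3) (∃ (Solves E T cs)) (¬ ∃ (Solves E T cs))) (sym e)
            (decide-zero E cs validComs E≤box cs≤box 2kn≤box))
        byTarget (suc zero) e _ = outcome (search-bound (box (size I)) n (≤-trans n≤size size≤box) (remaining (initialSegs cs)) F
            (subst (λ k → suc (remaining (initialSegs cs)) ≤ 2 ^ (k * k)) cs≡ (remaining-initial E cs validComs E≤box cs≤box 2kn≤box)))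
          (subst (λ T → Verdict program (inputStacks T E cs) (cSearch (remaining (initialSegs cs))) (∃ (Solves E T cs)) (¬ ∃ (Solves E T cs))) (sym e)
            (decide-one E cs validComs E≤box cs≤box 2kn≤box))
        byTarget (suc (suc _)) e (s≤s ())

open Decision

theorem5 : Σ TM λ M → Σ (ℕ → ℕ) λ f → Σ ℕ λ c →
    ∀ (I : Instance) → ValidInstance I → Instance.T I ≤ 1 →
    (DecidesWithin M (encode I) (f (length (Instance.K I)) * size I ^ c) true × MDSPP I)
    ⊎ (DecidesWithin M (encode I) (f (length (Instance.K I)) * size I ^ c) false × ¬ MDSPP I)
theorem5 = Solver.machine , (λ k → factor k * factor k) , exponent , solve
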